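{- Let $p$ and $q$ be prime numbers with $q=p+2$ and $p\equiv3\pmod 8$, and let $E$ be the elliptic curve $y^2=x(x+p)(x+q)$ over $\mathbf{Q}$. Suppose there are integers $a,b,c$ and $\varepsilon,\delta\in\{+1,-1\}$ with $q=a^2+b^2$ and $(a+\varepsilon)^2+(b+\delta)^2=c^2$. Then $\operatorname{rank}E(\mathbf{Q})=1$. -}

module Defs where

open import Data.Nat as ℕ using (ℕ; zero; suc)
open import Data.Integer as ℤ using (ℤ)
open import Data.Rational as ℚ using (ℚ; 0ℚ; 1ℚ; _+_; _*_; _-_; -_; _÷_)
open import Data.Rational.Properties using (_≟_)
open import Data.Fin using (Fin)
open import Data.Vec using (Vec; []; _∷_; lookup)
open import Data.Product using (Σ; _×_; ∃)
open import Relation.Nullary using (yes; no; ¬_)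
open import Relation.Binary.PropositionalEquality using (_≡_)

data Point : Set where
  O   : Point
  aff : ℚ → ℚ → Point

-- A Weierstrass curve  y² = x³ + A x² + B x + C  over ℚ.
record Curve : Set where
  constructor weier
  field
    A B C : ℚ

open Curve public

OnCurve : Curve → Point → Set
OnCurve E O         = Data.Unit.⊤ where import Data.Unit
OnCurve E (aff x y) = y * y ≡ x * x * x + A E * x * x + B E * x + C E

-- total division (the value at zero is never used on curve points)
_/'_ : ℚ → ℚ → ℚ
a /' b with b ≟ 0ℚ
... | yes _ = 0ℚ
... | no b≢0 = _÷_ a b {{ℚ.≢-nonZero b≢0}}

two three : ℚ
two = 1ℚ + 1ℚ
three = two + 1ℚ

neg : Point → Point
neg O         = O
neg (aff x y) = aff x (- y)

add : Curve → Point → Point → Point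
add E O Q = Q
add E P O = P
add E (aff x₁ y₁) (aff x₂ y₂) with x₁ ≟ x₂
... | no _ = third ((y₂ - y₁) /' (x₂ - x₁))
  where
  third : ℚ → Point
  third l = let x₃ = l * l - A E - x₁ - x₂ in aff x₃ (- (l * (x₃ - x₁) + y₁))
... | yes _ with (y₁ + y₂) ≟ 0ℚ
...   | yes _ = O
...   | no _  = third ((three * x₁ * x₁ + two * A E * x₁ + B E) /' (two * y₁))
  where
  third : ℚ → Point
  third l = let x₃ = l * l - A E - x₁ - x₂ in aff x₃ (- (l * (x₃ - x₁) + y₁))

natMul : Curve → ℕ → Point → Point
natMul E zero    P = O
natMul E (suc n) P = add E P (natMul E n P)

intMul : Curve → ℤ → Point → Point
intMul E (ℤ.+ n)    P = natMul E n P
intMul E ℤ.-[1+ n ] P = neg (natMul E (suc n) P)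

linComb : Curve → ∀ {n} → Vec ℤ n → Vec Point n → Point
linComb E []       []       = O
linComb E (c ∷ cs) (P ∷ Ps) = add E (intMul E c P) (linComb E cs Ps)

AllOn : Curve → ∀ {n} → Vec Point n → Set
AllOn E {n} Ps = (i : Fin n) → OnCurve E (lookup Ps i)

Independent : Curve → ∀ {n} → Vec Point n → Set
Independent E {n} Ps =
  (cs : Vec ℤ n) → linComb E cs Ps ≡ O → (i : Fin n) → lookup cs i ≡ ℤ.+ 0

HasRank : Curve → ℕ → Set
HasRank E r =
  (Σ (Vec Point r) λ Ps → AllOn E Ps × Independent E Ps)
  × ((Ps : Vec Point (suc r)) → AllOn E Ps → ¬ Independent E Ps)

-- the curve y² = x (x + p) (x + q) = x³ + (p+q) x² + p q x
curvePQ : ℕ → ℕ → Curve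
curvePQ p q = weier (ℤ.+ (p ℕ.+ q) ℚ./ 1) (ℤ.+ (p ℕ.* q) ℚ./ 1) 0ℚ

{-# OPTIONS --safe #-}

-- The intersection of quadrics J : v² = 1 + p u², w² = 1 + q u² is isomorphic to the elliptic curve,
-- and since pq is not a square its addition law has no exceptional pairs of rational points: the
-- group axioms are polynomial identities.
--
-- Upper bound.  In lowest terms u = U/T, v = V/T, w = W/T the number U is even, and each of the
-- pairs (V ± T)/2, (W ± T)/2, (W ± V)/2 is coprime with product p, q or 2 times a square.  Because
-- 2 is not a square modulo p, only two classes of points survive modulo doubles and torsion, told
-- apart by δ = (1 + v)(1 + w) modulo squares.  So one of P, Q, P ± Q is a double up to torsion.
-- Halving it keeps the height |W| bounded, hence returns to an earlier pair of points, although it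
-- doubles the index of the spanned group; this is impossible for independent P and Q.
--
-- Lower bound.  The circles q = m² + r² and 2 = n² + r² give the point (- m² , m n r), where δ is
-- minus a square.  It is not a double up to torsion, and there are no points of order four, so no
-- multiple of it is torsion.

module Submission where

open import Algebra.Bundles using (AbelianGroup; CommutativeMonoid; CommutativeRing)
open import Algebra.Structures using (IsAbelianGroup; IsCommutativeRing)
open import Data.Bool using (Bool; true; false; _∧_; if_then_else_)
open import Data.Empty using (⊥; ⊥-elim)
open import Data.Fin as Fin using (Fin)
import Data.Fin.Properties as Finₚ
open import Data.Integer as ℤ using (ℤ; +_; -[1+_])
import Data.Integer.Properties as ℤₚ
open import Data.List using (List; []; _∷_)
open import Data.Nat as ℕ using (ℕ; zero; suc)
open import Data.Nat.Coprimality as Coprimality using (Coprime; coprime-divisor; coprime-factors; coprime-Bézout)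
open import Data.Nat.Divisibility as ∣ using (_∣_; divides; quotient; m∣n⇒n≡quotient*m; ∣-trans; ∣-refl; ∣-antisym; ∣m⇒∣m*n; ∣n⇒∣m*n; ∣m∣n⇒∣m+n; ∣m+n∣m⇒∣n; *-pres-∣; m∣m*n; n∣m*n; ∣1⇒≡1)
open import Data.Nat.DivMod using (_%_; _/_; m≡m%n+[m/n]*n; m%n<n; m%n≤m; m%n≤n; %-distribˡ-*; %-distribˡ-+)
open import Data.Nat.GCD using (gcd; gcd-greatest; gcd[m,n]∣m; gcd[m,n]∣n; c*gcd[m,n]≡gcd[cm,cn]; module Bézout)
open import Data.Nat.Induction using (<-wellFounded; Acc; acc)
open import Data.Nat.Primality using (Prime; euclidsLemma; prime⇒irreducible; prime⇒nonZero; prime[2]; ¬prime[1]; ¬prime[0])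
import Data.Nat.Properties as ℕₚ
open import Data.Nat.Tactic.RingSolver using (solve-∀)
open import Data.Product using (Σ; ∃; _×_; _,_; proj₁; proj₂)
open import Data.Rational as ℚ using (ℚ; 0ℚ; 1ℚ; mkℚ; ↥_; ↧_; ↧ₙ_)
import Data.Rational.Properties as ℚₚ
import Data.Rational.Unnormalised.Base as ℚᵘ
import Data.Rational.Unnormalised.Properties as ℚᵘₚ
open import Data.Sum using (_⊎_; inj₁; inj₂)
open import Data.Unit using (⊤; tt)
open import Data.Vec as Vec using (Vec; []; _∷_)
open import Relation.Binary.Definitions using (DecidableEquality)
open import Relation.Binary.PropositionalEquality using (_≡_; _≢_; refl; sym; trans; cong; cong₂; subst; subst₂; module ≡-Reasoning)
open import Relation.Binary.PropositionalEquality.Properties using (isEquivalence)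
open import Relation.Nullary using (¬_; Dec; yes; no; recompute)
open import Relation.Nullary.Decidable using (from-no; False; toWitnessFalse)

-- Addition on `E` branches on equal abscissas, which would turn associativity into a long case
-- analysis; hence the detour through `J`. A point `(x , y)` goes to
-- `(2y , x² + 2px + pq , x² + 2qx + pq)` divided by `x² - pq`, a denominator that cannot vanish for
-- the same reason as that of the addition law. Relations are compared on both sides because this
-- map is additive and has trivial kernel.
--
-- Two obstacles shape the upper bound. Halving works only up to torsion; therefore independence is
-- followed on the doubles `2P` and `2Q`, where points of order two disappear. And heights are
-- controlled only up to constants: `H = |W|` satisfies `H(R)⁴ ≤ 2q H(2R)` and
-- `H(P + Q) H(P - Q) ≤ H(P)² H(Q)²`, so one bound `M ≥ 2q` survives every halving. The pigeonhole
-- principle on points of height at most `M` then takes the place of finite generation.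

-- Deciding polynomial identities by computation

record ≡-CommutativeRing : Set₁ where
  infixl 6 _+_ _-_
  infixl 7 _*_
  infix 8 -_
  field
    Carrier : Set
    _+_ _*_ : Carrier → Carrier → Carrier
    -_ : Carrier → Carrier
    0# 1# : Carrier
    isCommutativeRing : IsCommutativeRing _≡_ _+_ _*_ -_ 0# 1#
  open IsCommutativeRing isCommutativeRing public
    hiding (refl; sym; trans; reflexive; isEquivalence; setoid; _-_)

  _-_ : Carrier → Carrier → Carrier
  x - y = x + - y

-- Sparse Horner form: c ∷ cs stands for c + x · cs in the outermost variable x.
data Poly : ℕ → Set where
  con : ℤ → Poly 0
  []  : ∀ {n} → Poly (suc n)
  _∷_ : ∀ {n} → Poly n → Poly (suc n) → Poly (suc n)

isZero : ∀ {n} → Poly n → Bool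
isZero (con (+ 0)) = true
isZero (con _) = false
isZero [] = true
isZero (c ∷ cs) = isZero cs ∧ isZero c

infixr 5 _∷′_

-- Zero leading coefficients are dropped as soon as they arise, which keeps intermediate results
-- small.
_∷′_ : ∀ {n} → Poly n → Poly (suc n) → Poly (suc n)
c ∷′ (d ∷ ds) = c ∷ d ∷ ds
c ∷′ [] = if isZero c then [] else (c ∷ [])

zeroᵖ : ∀ {n} → Poly n
zeroᵖ {zero} = con (+ 0)
zeroᵖ {suc n} = []

constᵖ : ∀ {n} → ℤ → Poly n
constᵖ {zero} i = con i
constᵖ {suc n} i = constᵖ i ∷′ []

varᵖ : ∀ {n} → Fin n → Poly n
varᵖ Fin.zero = zeroᵖ ∷ constᵖ (+ 1) ∷ []
varᵖ (Fin.suc i) = varᵖ i ∷ []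

infixl 6 _+ᵖ_
infixl 7 _*ᵖ_

_+ᵖ_ : ∀ {n} → Poly n → Poly n → Poly n
con i +ᵖ con j = con (i ℤ.+ j)
[] +ᵖ ds = ds
(c ∷ cs) +ᵖ [] = c ∷ cs
(c ∷ cs) +ᵖ (d ∷ ds) = (c +ᵖ d) ∷′ (cs +ᵖ ds)

-ᵖ_ : ∀ {n} → Poly n → Poly n
-ᵖ con i = con (ℤ.- i)
-ᵖ [] = []
-ᵖ (c ∷ cs) = (-ᵖ c) ∷ (-ᵖ cs)

mutual
  scale : ∀ {n} → Poly n → Poly (suc n) → Poly (suc n)
  scale c [] = []
  scale c (d ∷ ds) = (c *ᵖ d) ∷′ scale c ds

  _*ᵖ_ : ∀ {n} → Poly n → Poly n → Poly n
  con i *ᵖ con j = con (i ℤ.* j)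
  [] *ᵖ ds = []
  (c ∷ cs) *ᵖ ds =
    if isZero c then zeroᵖ ∷′ (cs *ᵖ ds) else scale c ds +ᵖ (zeroᵖ ∷′ (cs *ᵖ ds))

infixl 6 _:+_ _:-_
infixl 7 _:*_
infix 8 :-_
infix 4 _:=_

data Expr (n : ℕ) : Set where
  var : Fin n → Expr n
  lit : ℤ → Expr n
  _:+_ _:-_ _:*_ : Expr n → Expr n → Expr n
  :-_ : Expr n → Expr n

normalise : ∀ {n} → Expr n → Poly n
normalise (var i) = varᵖ i
normalise (lit i) = constᵖ i
normalise (e :+ f) = normalise e +ᵖ normalise f
normalise (e :- f) = normalise e +ᵖ (-ᵖ normalise f)
normalise (e :* f) = normalise e *ᵖ normalise f
normalise (:- e) = -ᵖ normalise e

-- A rewriting rule x² ↦ s + t x for some of the variables, where s and t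
-- only involve the variables after x.
data Rules : ℕ → Set where
  []      : Rules 0
  free    : ∀ {n} → Rules n → Rules (suc n)
  square  : ∀ {n} → (Vec (Expr n) n → Expr n) → Rules n → Rules (suc n)
  quad    : ∀ {n} → (Vec (Expr n) n → Expr n × Expr n) → Rules n → Rules (suc n)

vars : ∀ {n} → Vec (Expr n) n
vars = Vec.tabulate var

recompose : ∀ {n} → Poly n × Poly n → Poly (suc n)
recompose (a , b) = a ∷′ b ∷′ []

mutual
  -- Curve equations enter as rewriting rules, so that no cofactors have to be supplied for them.
  -- Every variable with a rule ends up with degree at most one.
  reduce : ∀ {n} → Rules n → Poly n → Poly n
  reduce [] c = c
  reduce (free Γ) cs = reduceAll Γ cs
  reduce (square s Γ) cs =
    recompose (fold Γ (reduce Γ (normalise (s vars))) zeroᵖ cs)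
  reduce (quad s Γ) cs =
    recompose (fold Γ (reduce Γ (normalise (proj₁ (s vars)))) (reduce Γ (normalise (proj₂ (s vars)))) cs)

  reduceAll : ∀ {n} → Rules n → Poly (suc n) → Poly (suc n)
  reduceAll Γ [] = []
  reduceAll Γ (c ∷ cs) = reduce Γ c ∷′ reduceAll Γ cs

  -- Horner's scheme modulo `x² = s + t x`: if the tail is `a + b x`, then `c + x (a + b x) = (c + s
  -- b) + (a + t b) x`.
  fold : ∀ {n} → Rules n → Poly n → Poly n → Poly (suc n) → Poly n × Poly n
  fold Γ s t [] = zeroᵖ , zeroᵖ
  fold Γ s t (c ∷ cs) =
    let (a , b) = fold Γ s t cs in reduce Γ (c +ᵖ s *ᵖ b) , reduce Γ (a +ᵖ t *ᵖ b)

data Equation (n : ℕ) : Set where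
  _:=_ : Expr n → Expr n → Equation n

-- An equation together with the multiples of hypotheses it follows from.
Goal : ℕ → Set
Goal n = Equation n × List (Expr n × Equation n)

difference : ∀ {n} → Goal n → Expr n
difference ((l := r) , []) = l :- r
difference (e , (c , (l := r)) ∷ hs) = difference (e , hs) :- c :* (l :- r)

checks : ∀ {n} → Rules n → Goal n → Bool
checks Γ g = isZero (reduce Γ (normalise (difference g)))

module Solver (R : ≡-CommutativeRing) where
  open ≡-CommutativeRing R
  open ≡-Reasoning
  import Algebra.Properties.Ring as RingProperties

  commutativeRing : CommutativeRing _ _
  commutativeRing = record { isCommutativeRing = isCommutativeRing }

  open RingProperties (CommutativeRing.ring commutativeRing)
    using (-‿involutive; -‿+-comm; -‿distribˡ-*; -‿distribʳ-*; -0#≈0#)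
  open import Algebra.Properties.CommutativeSemigroup (CommutativeRing.+-commutativeSemigroup commutativeRing)
    using () renaming (interchange to +-interchange)
  open import Algebra.Properties.CommutativeSemigroup (CommutativeRing.*-commutativeSemigroup commutativeRing)
    using (x∙yz≈y∙xz)

  ιⁿ : ℕ → Carrier
  ιⁿ zero = 0#
  ιⁿ (suc n) = 1# + ιⁿ n

  ι : ℤ → Carrier
  ι (+ n) = ιⁿ n
  ι -[1+ n ] = - ιⁿ (suc n)

  ιⁿ-+ : ∀ m n → ιⁿ (m ℕ.+ n) ≡ ιⁿ m + ιⁿ n
  ιⁿ-+ zero n = sym (+-identityˡ _)
  ιⁿ-+ (suc m) n = trans (cong (_+_ 1#) (ιⁿ-+ m n)) (sym (+-assoc _ _ _))

  ιⁿ-* : ∀ m n → ιⁿ (m ℕ.* n) ≡ ιⁿ m * ιⁿ n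
  ιⁿ-* zero n = sym (zeroˡ _)
  ιⁿ-* (suc m) n = begin
    ιⁿ (n ℕ.+ m ℕ.* n)        ≡⟨ ιⁿ-+ n (m ℕ.* n) ⟩
    ιⁿ n + ιⁿ (m ℕ.* n)       ≡⟨ cong₂ _+_ (sym (*-identityˡ _)) (ιⁿ-* m n) ⟩
    1# * ιⁿ n + ιⁿ m * ιⁿ n   ≡⟨ sym (distribʳ _ _ _) ⟩
    (1# + ιⁿ m) * ιⁿ n        ∎

  ι-⊖ : ∀ m n → ι (m ℤ.⊖ n) ≡ ιⁿ m - ιⁿ n
  ι-⊖ m zero = sym (trans (cong (_+_ (ιⁿ m)) -0#≈0#) (+-identityʳ _))
  ι-⊖ zero (suc n) = sym (+-identityˡ _)
  ι-⊖ (suc m) (suc n) = begin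
    ι (suc m ℤ.⊖ suc n)               ≡⟨ cong ι (ℤₚ.[1+m]⊖[1+n]≡m⊖n m n) ⟩
    ι (m ℤ.⊖ n)                       ≡⟨ ι-⊖ m n ⟩
    ιⁿ m - ιⁿ n                       ≡⟨ sym (+-identityˡ _) ⟩
    0# + (ιⁿ m - ιⁿ n)                ≡⟨ cong (_+ (ιⁿ m - ιⁿ n)) (sym (-‿inverseʳ 1#)) ⟩
    (1# - 1#) + (ιⁿ m - ιⁿ n)         ≡⟨ +-interchange _ _ _ _ ⟩
    (1# + ιⁿ m) + (- 1# + - ιⁿ n)     ≡⟨ cong (_+_ (1# + ιⁿ m)) (-‿+-comm _ _) ⟩
    (1# + ιⁿ m) - (1# + ιⁿ n)         ∎

  ι-neg : ∀ i → ι (ℤ.- i) ≡ - ι i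
  ι-neg (+ zero) = sym -0#≈0#
  ι-neg (+ suc n) = refl
  ι-neg -[1+ n ] = sym (-‿involutive _)

  ι-+ : ∀ i j → ι (i ℤ.+ j) ≡ ι i + ι j
  ι-+ (+ m) (+ n) = ιⁿ-+ m n
  ι-+ (+ m) -[1+ n ] = ι-⊖ m (suc n)
  ι-+ -[1+ m ] (+ n) = trans (ι-⊖ n (suc m)) (+-comm _ _)
  ι-+ -[1+ m ] -[1+ n ] = begin
    - ιⁿ (suc (suc (m ℕ.+ n)))       ≡⟨ cong (λ k → - ιⁿ (suc k)) (sym (ℕₚ.+-suc m n)) ⟩
    - ιⁿ (suc m ℕ.+ suc n)           ≡⟨ cong -_ (ιⁿ-+ (suc m) (suc n)) ⟩
    - (ιⁿ (suc m) + ιⁿ (suc n))      ≡⟨ sym (-‿+-comm _ _) ⟩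
    - ιⁿ (suc m) + - ιⁿ (suc n)      ∎

  ι-pos-* : ∀ m j → ι (+ m ℤ.* j) ≡ ιⁿ m * ι j
  ι-pos-* m (+ n) = trans (cong ι (sym (ℤₚ.pos-* m n))) (ιⁿ-* m n)
  ι-pos-* m -[1+ n ] = begin
    ι (+ m ℤ.* -[1+ n ])          ≡⟨ cong ι (sym (ℤₚ.neg-distribʳ-* (+ m) (+ suc n))) ⟩
    ι (ℤ.- (+ m ℤ.* + suc n))     ≡⟨ ι-neg (+ m ℤ.* + suc n) ⟩
    - ι (+ m ℤ.* + suc n)         ≡⟨ cong -_ (ι-pos-* m (+ suc n)) ⟩
    - (ιⁿ m * ιⁿ (suc n))         ≡⟨ -‿distribʳ-* _ _ ⟩
    ιⁿ m * - ιⁿ (suc n)           ∎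

  ι-* : ∀ i j → ι (i ℤ.* j) ≡ ι i * ι j
  ι-* (+ m) j = ι-pos-* m j
  ι-* -[1+ m ] j = begin
    ι (-[1+ m ] ℤ.* j)            ≡⟨ cong ι (sym (ℤₚ.neg-distribˡ-* (+ suc m) j)) ⟩
    ι (ℤ.- (+ suc m ℤ.* j))       ≡⟨ ι-neg (+ suc m ℤ.* j) ⟩
    - ι (+ suc m ℤ.* j)           ≡⟨ cong -_ (ι-pos-* (suc m) j) ⟩
    - (ιⁿ (suc m) * ι j)          ≡⟨ -‿distribˡ-* _ _ ⟩
    - ιⁿ (suc m) * ι j            ∎

  -- The literals 0 and 1 are interpreted without a trailing + 0#.
  ⟦lit⟧ : ℤ → Carrier
  ⟦lit⟧ (+ 0) = 0#
  ⟦lit⟧ (+ 1) = 1#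
  ⟦lit⟧ i = ι i

  ⟦lit⟧≡ι : ∀ i → ⟦lit⟧ i ≡ ι i
  ⟦lit⟧≡ι (+ 0) = refl
  ⟦lit⟧≡ι (+ 1) = sym (+-identityʳ _)
  ⟦lit⟧≡ι (+ suc (suc n)) = refl
  ⟦lit⟧≡ι -[1+ n ] = refl

  ⟦_⟧ : ∀ {n} → Expr n → Vec Carrier n → Carrier
  ⟦ var i ⟧ ρ = Vec.lookup ρ i
  ⟦ lit i ⟧ ρ = ⟦lit⟧ i
  ⟦ e :+ f ⟧ ρ = ⟦ e ⟧ ρ + ⟦ f ⟧ ρ
  ⟦ e :- f ⟧ ρ = ⟦ e ⟧ ρ - ⟦ f ⟧ ρ
  ⟦ e :* f ⟧ ρ = ⟦ e ⟧ ρ * ⟦ f ⟧ ρ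
  ⟦ :- e ⟧ ρ = - ⟦ e ⟧ ρ

  ⟦_⟧ᵖ : ∀ {n} → Poly n → Vec Carrier n → Carrier
  ⟦ con i ⟧ᵖ ρ = ι i
  ⟦ [] ⟧ᵖ ρ = 0#
  ⟦ c ∷ cs ⟧ᵖ (x ∷ ρ) = ⟦ c ⟧ᵖ ρ + x * ⟦ cs ⟧ᵖ (x ∷ ρ)

  Valid : ∀ {n} → Rules n → Vec Carrier n → Set
  Valid [] ρ = ⊤
  Valid (free Γ) (x ∷ ρ) = Valid Γ ρ
  Valid (square s Γ) (x ∷ ρ) = x * x ≡ ⟦ s vars ⟧ ρ × Valid Γ ρ
  Valid (quad s Γ) (x ∷ ρ) = x * x ≡ ⟦ proj₁ (s vars) ⟧ ρ + ⟦ proj₂ (s vars) ⟧ ρ * x × Valid Γ ρ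

  Holds : ∀ {n} → Equation n → Vec Carrier n → Set
  Holds (l := r) ρ = ⟦ l ⟧ ρ ≡ ⟦ r ⟧ ρ

  isZero-sound : ∀ {n} (c : Poly n) ρ → isZero c ≡ true → ⟦ c ⟧ᵖ ρ ≡ 0#
  isZero-sound (con (+ 0)) ρ _ = refl
  isZero-sound [] ρ _ = refl
  isZero-sound (c ∷ cs) (x ∷ ρ) eq with isZero cs in eq₁
  ... | true = begin
    ⟦ c ⟧ᵖ ρ + x * ⟦ cs ⟧ᵖ (x ∷ ρ) ≡⟨ cong₂ (λ a b → a + x * b) (isZero-sound c ρ eq) (isZero-sound cs (x ∷ ρ) eq₁) ⟩
    0# + x * 0#                    ≡⟨ trans (+-identityˡ _) (zeroʳ x) ⟩
    0#                             ∎

  ∷′-sound : ∀ {n} (c : Poly n) cs x ρ → ⟦ c ∷′ cs ⟧ᵖ (x ∷ ρ) ≡ ⟦ c ⟧ᵖ ρ + x * ⟦ cs ⟧ᵖ (x ∷ ρ)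
  ∷′-sound c (d ∷ ds) x ρ = refl
  ∷′-sound c [] x ρ with isZero c in eq
  ... | false = refl
  ... | true = sym (isZero-sound (c ∷ []) (x ∷ ρ) eq)

  zero-sound : ∀ {n} ρ → ⟦ zeroᵖ {n} ⟧ᵖ ρ ≡ 0#
  zero-sound [] = refl
  zero-sound (x ∷ ρ) = refl

  const-sound : ∀ {n} i ρ → ⟦ constᵖ {n} i ⟧ᵖ ρ ≡ ι i
  const-sound i [] = refl
  const-sound i (x ∷ ρ) = begin
    ⟦ constᵖ i ∷′ [] ⟧ᵖ (x ∷ ρ)  ≡⟨ ∷′-sound (constᵖ i) [] x ρ ⟩
    ⟦ constᵖ i ⟧ᵖ ρ + x * 0#     ≡⟨ cong₂ _+_ (const-sound i ρ) (zeroʳ x) ⟩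
    ι i + 0#                     ≡⟨ +-identityʳ _ ⟩
    ι i                          ∎

  var-sound : ∀ {n} (i : Fin n) ρ → ⟦ varᵖ i ⟧ᵖ ρ ≡ Vec.lookup ρ i
  var-sound Fin.zero (x ∷ ρ) = begin
    ⟦ zeroᵖ ⟧ᵖ ρ + x * (⟦ constᵖ (+ 1) ⟧ᵖ ρ + x * 0#) ≡⟨ cong₂ (λ a b → a + x * b) (zero-sound ρ) (cong₂ _+_ (const-sound (+ 1) ρ) (zeroʳ x)) ⟩
    0# + x * ((1# + 0#) + 0#)  ≡⟨ trans (+-identityˡ _) (cong (_*_ x) (trans (+-identityʳ _) (+-identityʳ _))) ⟩
    x * 1#                     ≡⟨ *-identityʳ x ⟩
    x                          ∎
  var-sound (Fin.suc i) (x ∷ ρ) = trans (cong₂ _+_ (var-sound i ρ) (zeroʳ x)) (+-identityʳ _)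

  +ᵖ-sound : ∀ {n} (c d : Poly n) ρ → ⟦ c +ᵖ d ⟧ᵖ ρ ≡ ⟦ c ⟧ᵖ ρ + ⟦ d ⟧ᵖ ρ
  +ᵖ-sound (con i) (con j) ρ = ι-+ i j
  +ᵖ-sound [] ds ρ = sym (+-identityˡ _)
  +ᵖ-sound (c ∷ cs) [] ρ = sym (+-identityʳ _)
  +ᵖ-sound (c ∷ cs) (d ∷ ds) (x ∷ ρ) = begin
    ⟦ (c +ᵖ d) ∷′ (cs +ᵖ ds) ⟧ᵖ (x ∷ ρ)             ≡⟨ ∷′-sound (c +ᵖ d) (cs +ᵖ ds) x ρ ⟩
    ⟦ c +ᵖ d ⟧ᵖ ρ + x * ⟦ cs +ᵖ ds ⟧ᵖ (x ∷ ρ)       ≡⟨ cong₂ (λ a b → a + x * b) (+ᵖ-sound c d ρ) (+ᵖ-sound cs ds (x ∷ ρ)) ⟩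
    (C + D) + x * (CS + DS)                         ≡⟨ cong (_+_ (C + D)) (distribˡ x CS DS) ⟩
    (C + D) + (x * CS + x * DS)                     ≡⟨ +-interchange _ _ _ _ ⟩
    (C + x * CS) + (D + x * DS)                     ∎
    where
    C = ⟦ c ⟧ᵖ ρ
    D = ⟦ d ⟧ᵖ ρ
    CS = ⟦ cs ⟧ᵖ (x ∷ ρ)
    DS = ⟦ ds ⟧ᵖ (x ∷ ρ)

  -ᵖ-sound : ∀ {n} (c : Poly n) ρ → ⟦ -ᵖ c ⟧ᵖ ρ ≡ - ⟦ c ⟧ᵖ ρ
  -ᵖ-sound (con i) ρ = ι-neg i
  -ᵖ-sound [] ρ = sym -0#≈0#
  -ᵖ-sound (c ∷ cs) (x ∷ ρ) = begin
    ⟦ -ᵖ c ⟧ᵖ ρ + x * ⟦ -ᵖ cs ⟧ᵖ (x ∷ ρ)        ≡⟨ cong₂ (λ a b → a + x * b) (-ᵖ-sound c ρ) (-ᵖ-sound cs (x ∷ ρ)) ⟩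
    - ⟦ c ⟧ᵖ ρ + x * - ⟦ cs ⟧ᵖ (x ∷ ρ)          ≡⟨ cong (_+_ (- ⟦ c ⟧ᵖ ρ)) (sym (-‿distribʳ-* _ _)) ⟩
    - ⟦ c ⟧ᵖ ρ + - (x * ⟦ cs ⟧ᵖ (x ∷ ρ))        ≡⟨ -‿+-comm _ _ ⟩
    - (⟦ c ⟧ᵖ ρ + x * ⟦ cs ⟧ᵖ (x ∷ ρ))          ∎

  mutual
    scale-sound : ∀ {n} (c : Poly n) ds x ρ → ⟦ scale c ds ⟧ᵖ (x ∷ ρ) ≡ ⟦ c ⟧ᵖ ρ * ⟦ ds ⟧ᵖ (x ∷ ρ)
    scale-sound c [] x ρ = sym (zeroʳ _)
    scale-sound c (d ∷ ds) x ρ = begin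
      ⟦ (c *ᵖ d) ∷′ scale c ds ⟧ᵖ (x ∷ ρ)         ≡⟨ ∷′-sound (c *ᵖ d) (scale c ds) x ρ ⟩
      ⟦ c *ᵖ d ⟧ᵖ ρ + x * ⟦ scale c ds ⟧ᵖ (x ∷ ρ) ≡⟨ cong₂ (λ a b → a + x * b) (*ᵖ-sound c d ρ) (scale-sound c ds x ρ) ⟩
      C * D + x * (C * DS)                        ≡⟨ cong (_+_ (C * D)) (x∙yz≈y∙xz x C DS) ⟩
      C * D + C * (x * DS)                        ≡⟨ sym (distribˡ C D (x * DS)) ⟩
      C * (D + x * DS)                            ∎
      where
      C = ⟦ c ⟧ᵖ ρ
      D = ⟦ d ⟧ᵖ ρ
      DS = ⟦ ds ⟧ᵖ (x ∷ ρ)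

    shift-sound : ∀ {n} (cs ds : Poly (suc n)) x ρ →
      ⟦ zeroᵖ ∷′ (cs *ᵖ ds) ⟧ᵖ (x ∷ ρ) ≡ (x * ⟦ cs ⟧ᵖ (x ∷ ρ)) * ⟦ ds ⟧ᵖ (x ∷ ρ)
    shift-sound cs ds x ρ = begin
      ⟦ zeroᵖ ∷′ (cs *ᵖ ds) ⟧ᵖ (x ∷ ρ)             ≡⟨ ∷′-sound zeroᵖ (cs *ᵖ ds) x ρ ⟩
      ⟦ zeroᵖ ⟧ᵖ ρ + x * ⟦ cs *ᵖ ds ⟧ᵖ (x ∷ ρ)     ≡⟨ cong₂ (λ a b → a + x * b) (zero-sound ρ) (*ᵖ-sound cs ds (x ∷ ρ)) ⟩
      0# + x * (⟦ cs ⟧ᵖ (x ∷ ρ) * ⟦ ds ⟧ᵖ (x ∷ ρ)) ≡⟨ trans (+-identityˡ _) (sym (*-assoc _ _ _)) ⟩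
      (x * ⟦ cs ⟧ᵖ (x ∷ ρ)) * ⟦ ds ⟧ᵖ (x ∷ ρ)      ∎

    *ᵖ-sound : ∀ {n} (c d : Poly n) ρ → ⟦ c *ᵖ d ⟧ᵖ ρ ≡ ⟦ c ⟧ᵖ ρ * ⟦ d ⟧ᵖ ρ
    *ᵖ-sound (con i) (con j) ρ = ι-* i j
    *ᵖ-sound [] ds ρ = sym (zeroˡ _)
    *ᵖ-sound (c ∷ cs) ds (x ∷ ρ) with isZero c in eq
    ... | true = begin
      ⟦ zeroᵖ ∷′ (cs *ᵖ ds) ⟧ᵖ (x ∷ ρ)             ≡⟨ shift-sound cs ds x ρ ⟩
      (x * CS) * DS                                ≡⟨ cong (_* DS) (sym (trans (cong (_+ x * CS) (isZero-sound c ρ eq)) (+-identityˡ _))) ⟩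
      (⟦ c ⟧ᵖ ρ + x * CS) * DS                     ∎
      where
      CS = ⟦ cs ⟧ᵖ (x ∷ ρ)
      DS = ⟦ ds ⟧ᵖ (x ∷ ρ)
    ... | false = begin
      ⟦ scale c ds +ᵖ (zeroᵖ ∷′ (cs *ᵖ ds)) ⟧ᵖ (x ∷ ρ)  ≡⟨ +ᵖ-sound (scale c ds) _ (x ∷ ρ) ⟩
      ⟦ scale c ds ⟧ᵖ (x ∷ ρ) + ⟦ zeroᵖ ∷′ (cs *ᵖ ds) ⟧ᵖ (x ∷ ρ) ≡⟨ cong₂ _+_ (scale-sound c ds x ρ) (shift-sound cs ds x ρ) ⟩
      ⟦ c ⟧ᵖ ρ * DS + (x * CS) * DS                ≡⟨ sym (distribʳ DS _ _) ⟩
      (⟦ c ⟧ᵖ ρ + x * CS) * DS                     ∎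
      where
      CS = ⟦ cs ⟧ᵖ (x ∷ ρ)
      DS = ⟦ ds ⟧ᵖ (x ∷ ρ)

  normalise-sound : ∀ {n} (e : Expr n) ρ → ⟦ normalise e ⟧ᵖ ρ ≡ ⟦ e ⟧ ρ
  normalise-sound (var i) ρ = var-sound i ρ
  normalise-sound (lit i) ρ = trans (const-sound i ρ) (sym (⟦lit⟧≡ι i))
  normalise-sound (e :+ f) ρ = trans (+ᵖ-sound (normalise e) (normalise f) ρ) (cong₂ _+_ (normalise-sound e ρ) (normalise-sound f ρ))
  normalise-sound (e :- f) ρ = trans (+ᵖ-sound (normalise e) (-ᵖ normalise f) ρ)
    (cong₂ _+_ (normalise-sound e ρ) (trans (-ᵖ-sound (normalise f) ρ) (cong -_ (normalise-sound f ρ))))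
  normalise-sound (e :* f) ρ = trans (*ᵖ-sound (normalise e) (normalise f) ρ) (cong₂ _*_ (normalise-sound e ρ) (normalise-sound f ρ))
  normalise-sound (:- e) ρ = trans (-ᵖ-sound (normalise e) ρ) (cong -_ (normalise-sound e ρ))

  recompose-sound : ∀ {n} (r : Poly n × Poly n) x ρ → ⟦ recompose r ⟧ᵖ (x ∷ ρ) ≡ ⟦ proj₁ r ⟧ᵖ ρ + x * ⟦ proj₂ r ⟧ᵖ ρ
  recompose-sound (a , b) x ρ = begin
    ⟦ a ∷′ b ∷′ [] ⟧ᵖ (x ∷ ρ)                 ≡⟨ ∷′-sound a (b ∷′ []) x ρ ⟩
    ⟦ a ⟧ᵖ ρ + x * ⟦ b ∷′ [] ⟧ᵖ (x ∷ ρ)       ≡⟨ cong (λ z → ⟦ a ⟧ᵖ ρ + x * z) (trans (∷′-sound b [] x ρ) (trans (cong (_+_ _) (zeroʳ x)) (+-identityʳ _))) ⟩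
    ⟦ a ⟧ᵖ ρ + x * ⟦ b ⟧ᵖ ρ                   ∎

  mutual
    reduce-sound : ∀ {n} (Γ : Rules n) c ρ → Valid Γ ρ → ⟦ reduce Γ c ⟧ᵖ ρ ≡ ⟦ c ⟧ᵖ ρ
    reduce-sound [] c ρ _ = refl
    reduce-sound (free Γ) cs (x ∷ ρ) v = reduceAll-sound Γ cs x ρ v
    reduce-sound (square s Γ) cs (x ∷ ρ) (e , v) =
      trans (recompose-sound (fold Γ _ _ cs) x ρ) (fold-sound Γ (reduce Γ (normalise (s vars))) zeroᵖ cs x ρ v
        (begin
          x * x                            ≡⟨ e ⟩
          ⟦ s vars ⟧ ρ                     ≡⟨ sym (rhs-sound Γ (s vars) ρ v) ⟩
          _                                ≡⟨ sym (+-identityʳ _) ⟩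
          _ + 0#                           ≡⟨ cong (_+_ _) (sym (trans (cong (_* x) (zero-sound ρ)) (zeroˡ x))) ⟩
          _ + ⟦ zeroᵖ ⟧ᵖ ρ * x             ∎))
    reduce-sound (quad s Γ) cs (x ∷ ρ) (e , v) =
      trans (recompose-sound (fold Γ _ _ cs) x ρ) (fold-sound Γ (reduce Γ (normalise (proj₁ (s vars)))) (reduce Γ (normalise (proj₂ (s vars)))) cs x ρ v
        (trans e (sym (cong₂ (λ a b → a + b * x) (rhs-sound Γ (proj₁ (s vars)) ρ v) (rhs-sound Γ (proj₂ (s vars)) ρ v)))))

    rhs-sound : ∀ {n} (Γ : Rules n) e ρ → Valid Γ ρ → ⟦ reduce Γ (normalise e) ⟧ᵖ ρ ≡ ⟦ e ⟧ ρ
    rhs-sound Γ e ρ v = trans (reduce-sound Γ (normalise e) ρ v) (normalise-sound e ρ)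

    reduceAll-sound : ∀ {n} (Γ : Rules n) cs x ρ → Valid Γ ρ → ⟦ reduceAll Γ cs ⟧ᵖ (x ∷ ρ) ≡ ⟦ cs ⟧ᵖ (x ∷ ρ)
    reduceAll-sound Γ [] x ρ v = refl
    reduceAll-sound Γ (c ∷ cs) x ρ v = trans (∷′-sound (reduce Γ c) (reduceAll Γ cs) x ρ)
      (cong₂ (λ a b → a + x * b) (reduce-sound Γ c ρ v) (reduceAll-sound Γ cs x ρ v))

    fold-sound : ∀ {n} (Γ : Rules n) s t cs x ρ → Valid Γ ρ → x * x ≡ ⟦ s ⟧ᵖ ρ + ⟦ t ⟧ᵖ ρ * x →
      ⟦ proj₁ (fold Γ s t cs) ⟧ᵖ ρ + x * ⟦ proj₂ (fold Γ s t cs) ⟧ᵖ ρ ≡ ⟦ cs ⟧ᵖ (x ∷ ρ)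
    fold-sound Γ s t [] x ρ v e =
      trans (cong₂ (λ a b → a + x * b) (zero-sound ρ) (zero-sound ρ)) (trans (+-identityˡ _) (zeroʳ x))
    fold-sound Γ s t (c ∷ cs) x ρ v e = begin
      ⟦ reduce Γ (c +ᵖ s *ᵖ b) ⟧ᵖ ρ + x * ⟦ reduce Γ (a +ᵖ t *ᵖ b) ⟧ᵖ ρ
        ≡⟨ cong₂ (λ y z → y + x * z) (step c s) (step a t) ⟩
      (C + S * B) + x * (A + T * B)
        ≡⟨ cong (_+_ (C + S * B)) (distribˡ x A (T * B)) ⟩
      (C + S * B) + (x * A + x * (T * B))
        ≡⟨ cong (_+_ (C + S * B)) (+-comm _ _) ⟩
      (C + S * B) + (x * (T * B) + x * A)
        ≡⟨ +-assoc C _ _ ⟩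
      C + (S * B + (x * (T * B) + x * A))
        ≡⟨ cong (_+_ C) (sym (+-assoc _ _ _)) ⟩
      C + (S * B + x * (T * B) + x * A)
        ≡⟨ cong (λ z → C + (S * B + z + x * A)) (trans (sym (*-assoc x T B)) (cong (_* B) (*-comm x T))) ⟩
      C + (S * B + (T * x) * B + x * A)
        ≡⟨ cong (λ z → C + (z + x * A)) (sym (distribʳ B S (T * x))) ⟩
      C + ((S + T * x) * B + x * A)
        ≡⟨ cong (λ z → C + (z * B + x * A)) (sym e) ⟩
      C + ((x * x) * B + x * A)
        ≡⟨ cong (_+_ C) (trans (+-comm _ _) (cong (_+_ (x * A)) (*-assoc x x B))) ⟩
      C + (x * A + x * (x * B))
        ≡⟨ cong (_+_ C) (sym (distribˡ x A (x * B))) ⟩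
      C + x * (A + x * B)
        ≡⟨ cong (λ z → C + x * z) (fold-sound Γ s t cs x ρ v e) ⟩
      C + x * ⟦ cs ⟧ᵖ (x ∷ ρ) ∎
      where
      a = proj₁ (fold Γ s t cs)
      b = proj₂ (fold Γ s t cs)
      A = ⟦ a ⟧ᵖ ρ
      B = ⟦ b ⟧ᵖ ρ
      C = ⟦ c ⟧ᵖ ρ
      S = ⟦ s ⟧ᵖ ρ
      T = ⟦ t ⟧ᵖ ρ
      step : ∀ d f → ⟦ reduce Γ (d +ᵖ f *ᵖ b) ⟧ᵖ ρ ≡ ⟦ d ⟧ᵖ ρ + ⟦ f ⟧ᵖ ρ * B
      step d f = trans (reduce-sound Γ (d +ᵖ f *ᵖ b) ρ v)
        (trans (+ᵖ-sound d (f *ᵖ b) ρ) (cong (_+_ (⟦ d ⟧ᵖ ρ)) (*ᵖ-sound f b ρ)))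

  x-y≡0⇒x≡y : ∀ {x y} → x - y ≡ 0# → x ≡ y
  x-y≡0⇒x≡y {x} {y} e = begin
    x               ≡⟨ sym (+-identityʳ x) ⟩
    x + 0#          ≡⟨ cong (_+_ x) (sym (-‿inverseˡ y)) ⟩
    x + (- y + y)   ≡⟨ sym (+-assoc x (- y) y) ⟩
    (x - y) + y     ≡⟨ cong (_+ y) e ⟩
    0# + y          ≡⟨ +-identityˡ y ⟩
    y               ∎

  Assumptions : ∀ {n} → List (Expr n × Equation n) → Vec Carrier n → Set
  Assumptions [] ρ = ⊤
  Assumptions ((_ , e) ∷ []) ρ = Holds e ρ
  Assumptions ((_ , e) ∷ hs@(_ ∷ _)) ρ = Holds e ρ × Assumptions hs ρ

  difference-sound : ∀ {n} (l r : Expr n) hs ρ → Assumptions hs ρ →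
    ⟦ difference ((l := r) , hs) ⟧ ρ ≡ ⟦ l ⟧ ρ - ⟦ r ⟧ ρ
  difference-sound l r [] ρ _ = refl
  difference-sound l r ((c , (l′ := r′)) ∷ hs) ρ as = begin
    d - ⟦ c ⟧ ρ * (⟦ l′ ⟧ ρ - ⟦ r′ ⟧ ρ)   ≡⟨ cong (λ z → d - ⟦ c ⟧ ρ * (z - ⟦ r′ ⟧ ρ)) (here hs as) ⟩
    d - ⟦ c ⟧ ρ * (⟦ r′ ⟧ ρ - ⟦ r′ ⟧ ρ)   ≡⟨ cong (λ z → d - ⟦ c ⟧ ρ * z) (-‿inverseʳ _) ⟩
    d - ⟦ c ⟧ ρ * 0#                      ≡⟨ cong (λ z → d - z) (zeroʳ _) ⟩
    d - 0#                                ≡⟨ trans (cong (_+_ d) -0#≈0#) (+-identityʳ d) ⟩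
    d                                     ≡⟨ difference-sound l r hs ρ (rest hs as) ⟩
    ⟦ l ⟧ ρ - ⟦ r ⟧ ρ                     ∎
    where
    d = ⟦ difference ((l := r) , hs) ⟧ ρ
    here : ∀ hs → Assumptions ((c , (l′ := r′)) ∷ hs) ρ → ⟦ l′ ⟧ ρ ≡ ⟦ r′ ⟧ ρ
    here [] a = a
    here (_ ∷ _) (a , _) = a
    rest : ∀ hs → Assumptions ((c , (l′ := r′)) ∷ hs) ρ → Assumptions hs ρ
    rest [] _ = tt
    rest (_ ∷ _) (_ , as) = as

  -- The last hypothesis is a computation on syntax alone, independent of `ρ`, so each use
  -- discharges it by `refl`.
  solveGoal : ∀ {n} (ρ : Vec Carrier n) (Γ : Rules n) → Valid Γ ρ →
    (g : Goal n) → Assumptions (proj₂ g) ρ → checks Γ g ≡ true → Holds (proj₁ g) ρ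
  solveGoal ρ Γ v g@((l := r) , hs) as c = x-y≡0⇒x≡y (begin
    ⟦ l ⟧ ρ - ⟦ r ⟧ ρ                        ≡⟨ sym (difference-sound l r hs ρ as) ⟩
    ⟦ difference g ⟧ ρ                       ≡⟨ sym (normalise-sound (difference g) ρ) ⟩
    ⟦ normalise (difference g) ⟧ᵖ ρ          ≡⟨ sym (reduce-sound Γ _ ρ v) ⟩
    ⟦ reduce Γ (normalise (difference g)) ⟧ᵖ ρ ≡⟨ isZero-sound (reduce Γ (normalise (difference g))) ρ c ⟩
    0#                                       ∎)

  freeRules : ∀ {n} → Rules n
  freeRules {zero} = []
  freeRules {suc n} = free freeRules

  freeRules-valid : ∀ {n} (ρ : Vec Carrier n) → Valid freeRules ρ
  freeRules-valid [] = tt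
  freeRules-valid (x ∷ ρ) = freeRules-valid ρ

  ring : ∀ {n} (ρ : Vec Carrier n) (e : Vec (Expr n) n → Equation n) →
    checks freeRules (e vars , []) ≡ true → Holds (e vars) ρ
  ring ρ e c = solveGoal ρ freeRules (freeRules-valid ρ) (e vars , []) tt c

  combine : ∀ {n} (ρ : Vec Carrier n) (g : Vec (Expr n) n → Goal n) →
    Assumptions (proj₂ (g vars)) ρ → checks freeRules (g vars) ≡ true → Holds (proj₁ (g vars)) ρ
  combine ρ g as c = solveGoal ρ freeRules (freeRules-valid ρ) (g vars) as c

-- Fields with decidable equality

record ≡-Field : Set₁ where
  field
    ≡-commutativeRing : ≡-CommutativeRing
  open ≡-CommutativeRing ≡-commutativeRing public
  infix 4 _≟_
  field
    _≟_ : DecidableEquality Carrier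
    inv : Carrier → Carrier
    *-inverseʳ : ∀ {x} → x ≢ 0# → x * inv x ≡ 1#
    1≢0 : 1# ≢ 0#

module FieldProperties (F : ≡-Field) where
  open ≡-Field F
  open Solver ≡-commutativeRing
  open ≡-Reasoning

  infixl 7 _÷_
  _÷_ : Carrier → Carrier → Carrier
  x ÷ y = x * inv y

  ÷-* : ∀ x {y} → y ≢ 0# → x ÷ y * y ≡ x
  ÷-* x {y} y≢0 = combine (x ∷ y ∷ inv y ∷ []) (λ { (x ∷ y ∷ i ∷ []) → (x :* i :* y := x) , (x , (y :* i := lit (+ 1))) ∷ [] })
    (*-inverseʳ y≢0) refl

  *-cancelʳ : ∀ {x y} z → z ≢ 0# → x * z ≡ y * z → x ≡ y
  *-cancelʳ {x} {y} z z≢0 e = combine (x ∷ y ∷ z ∷ inv z ∷ [])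
    (λ { (x ∷ y ∷ z ∷ i ∷ []) → (x := y) , (i , (x :* z := y :* z)) ∷ (:- (x :- y) , (z :* i := lit (+ 1))) ∷ [] })
    (e , *-inverseʳ z≢0) refl

  *-nonzero : ∀ {x y} → x ≢ 0# → y ≢ 0# → x * y ≢ 0#
  *-nonzero {x} {y} x≢0 y≢0 e = x≢0 (*-cancelʳ y y≢0 (trans e (sym (zeroˡ y))))

  *-nonzeroˡ : ∀ {x y} → x * y ≢ 0# → x ≢ 0#
  *-nonzeroˡ {x} {y} h e = h (trans (cong (_* y) e) (zeroˡ y))

  *-nonzeroʳ : ∀ {x y} → x * y ≢ 0# → y ≢ 0#
  *-nonzeroʳ {x} {y} h e = h (trans (cong (x *_) e) (zeroʳ x))

  *-zero-split : ∀ x y → x * y ≡ 0# → x ≡ 0# ⊎ y ≡ 0#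
  *-zero-split x y e with x ≟ 0#
  ... | yes x≡0 = inj₁ x≡0
  ... | no x≢0 with y ≟ 0#
  ... | yes y≡0 = inj₂ y≡0
  ... | no y≢0 = ⊥-elim (*-nonzero x≢0 y≢0 e)

  ÷-unique : ∀ {x y z} → z ≢ 0# → y * z ≡ x → y ≡ x ÷ z
  ÷-unique {x} {y} {z} z≢0 e = *-cancelʳ z z≢0 (trans e (sym (÷-* x z≢0)))

-- The group law on the intersection of quadrics

-- The curve v² = 1 + p u², w² = 1 + q u². It has no rational points at infinity and its
-- addition law below has no exceptions, since pq is not a square.
module Jacobi (F : ≡-Field) (p q : ≡-Field.Carrier F)
  (pq-nonsquare : ∀ x → ≡-Field._*_ F (≡-Field._*_ F p q) (≡-Field._*_ F x x) ≢ ≡-Field.1# F) where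

  open ≡-Field F
  open Solver ≡-commutativeRing
  open FieldProperties F
  open ≡-Reasoning

  -- The equations are irrelevant fields, so points with equal coordinates are equal. Decidability
  -- of equality makes the proofs available again.
  record J : Set where
    constructor pt
    field
      u v w : Carrier
      .v²-irr : v * v ≡ 1# + p * (u * u)
      .w²-irr : w * w ≡ 1# + q * (u * u)

  open J public using (u; v; w)

  v² : ∀ P → v P * v P ≡ 1# + p * (u P * u P)
  v² (pt u v w e _) = recompute (v * v ≟ (1# + p * (u * u))) e

  w² : ∀ P → w P * w P ≡ 1# + q * (u P * u P)
  w² (pt u v w _ e) = recompute (w * w ≟ (1# + q * (u * u))) e

  J-≡ : ∀ {P Q : J} → u P ≡ u Q → v P ≡ v Q → w P ≡ w Q → P ≡ Q
  J-≡ refl refl refl = refl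

  private
    𝟙 : ∀ {n} → Expr n
    𝟙 = lit (+ 1)

    den : Carrier → Carrier → Carrier
    den u₁ u₂ = 1# - p * q * (u₁ * u₂ * (u₁ * u₂))

    denᵉ : ∀ {n} (p q u₁ u₂ : Expr n) → Expr n
    denᵉ p q u₁ u₂ = 𝟙 :- p :* q :* (u₁ :* u₂ :* (u₁ :* u₂))

    -- The addition theorem of the Jacobi elliptic functions: `v` and `w` play the roles of cn and
    -- dn, and `u` is sn up to a constant, with modulus `k² = q / p`. The formulas for `v` and `w`
    -- are exchanged together with `p` and `q`.
    numᵘ : Carrier → Carrier → Carrier → Carrier → Carrier → Carrier → Carrier
    numᵘ u₁ v₁ w₁ u₂ v₂ w₂ = u₁ * (v₂ * w₂) + u₂ * (v₁ * w₁)

    numᵘᵉ : ∀ {n} (u₁ v₁ w₁ u₂ v₂ w₂ : Expr n) → Expr n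
    numᵘᵉ u₁ v₁ w₁ u₂ v₂ w₂ = u₁ :* (v₂ :* w₂) :+ u₂ :* (v₁ :* w₁)

    numᵛ : Carrier → Carrier → Carrier → Carrier → Carrier → Carrier → Carrier → Carrier
    numᵛ p u₁ v₁ w₁ u₂ v₂ w₂ = v₁ * v₂ + p * (u₁ * w₁ * (u₂ * w₂))

    numᵛᵉ : ∀ {n} (p u₁ v₁ w₁ u₂ v₂ w₂ : Expr n) → Expr n
    numᵛᵉ p u₁ v₁ w₁ u₂ v₂ w₂ = v₁ :* v₂ :+ p :* (u₁ :* w₁ :* (u₂ :* w₂))

    rules₁ : Rules 5
    rules₁ = square (λ { (w ∷ u ∷ p ∷ q ∷ []) → 𝟙 :+ p :* (u :* u) })
            (square (λ { (u ∷ p ∷ q ∷ []) → 𝟙 :+ q :* (u :* u) })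
            (free (free (free []))))

    rules₂ : Rules 8
    rules₂ = square (λ { (w₁ ∷ v₂ ∷ w₂ ∷ u₁ ∷ u₂ ∷ p ∷ q ∷ []) → 𝟙 :+ p :* (u₁ :* u₁) })
            (square (λ { (v₂ ∷ w₂ ∷ u₁ ∷ u₂ ∷ p ∷ q ∷ []) → 𝟙 :+ q :* (u₁ :* u₁) })
            (square (λ { (w₂ ∷ u₁ ∷ u₂ ∷ p ∷ q ∷ []) → 𝟙 :+ p :* (u₂ :* u₂) })
            (square (λ { (u₁ ∷ u₂ ∷ p ∷ q ∷ []) → 𝟙 :+ q :* (u₂ :* u₂) })
            (free (free (free (free [])))))))

    rules₃ : Rules 11
    rules₃ = square (λ { (w₁ ∷ v₂ ∷ w₂ ∷ v₃ ∷ w₃ ∷ u₁ ∷ u₂ ∷ u₃ ∷ p ∷ q ∷ []) → 𝟙 :+ p :* (u₁ :* u₁) })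
            (square (λ { (v₂ ∷ w₂ ∷ v₃ ∷ w₃ ∷ u₁ ∷ u₂ ∷ u₃ ∷ p ∷ q ∷ []) → 𝟙 :+ q :* (u₁ :* u₁) })
            (square (λ { (w₂ ∷ v₃ ∷ w₃ ∷ u₁ ∷ u₂ ∷ u₃ ∷ p ∷ q ∷ []) → 𝟙 :+ p :* (u₂ :* u₂) })
            (square (λ { (v₃ ∷ w₃ ∷ u₁ ∷ u₂ ∷ u₃ ∷ p ∷ q ∷ []) → 𝟙 :+ q :* (u₂ :* u₂) })
            (square (λ { (w₃ ∷ u₁ ∷ u₂ ∷ u₃ ∷ p ∷ q ∷ []) → 𝟙 :+ p :* (u₃ :* u₃) })
            (square (λ { (u₁ ∷ u₂ ∷ u₃ ∷ p ∷ q ∷ []) → 𝟙 :+ q :* (u₃ :* u₃) })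
            (free (free (free (free (free []))))))))))

  solve₁ : ∀ (P : J) (g : Vec (Expr 5) 5 → Equation 5) →
    checks rules₁ (g vars , []) ≡ true → Holds (g vars) (v P ∷ w P ∷ u P ∷ p ∷ q ∷ [])
  solve₁ P g = solveGoal _ rules₁ (v² P , w² P , tt) (g vars , []) tt

  solve₂ : ∀ (P Q : J) (g : Vec (Expr 8) 8 → Equation 8) →
    checks rules₂ (g vars , []) ≡ true → Holds (g vars) (v P ∷ w P ∷ v Q ∷ w Q ∷ u P ∷ u Q ∷ p ∷ q ∷ [])
  solve₂ P Q g = solveGoal _ rules₂ (v² P , w² P , v² Q , w² Q , tt) (g vars , []) tt

  solve₃ : ∀ (P Q R : J) (g : Vec (Expr 11) 11 → Equation 11) →
    checks rules₃ (g vars , []) ≡ true → Holds (g vars) (v P ∷ w P ∷ v Q ∷ w Q ∷ v R ∷ w R ∷ u P ∷ u Q ∷ u R ∷ p ∷ q ∷ [])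
  solve₃ P Q R g = solveGoal _ rules₃
    (v² P , w² P , v² Q , w² Q , v² R , w² R , tt) (g vars , []) tt

  D Nᵘ Nᵛ Nʷ : J → J → Carrier
  D P Q = den (u P) (u Q)
  Nᵘ P Q = numᵘ (u P) (v P) (w P) (u Q) (v Q) (w Q)
  Nᵛ P Q = numᵛ p (u P) (v P) (w P) (u Q) (v Q) (w Q)
  Nʷ P Q = numᵛ q (u P) (w P) (v P) (u Q) (w Q) (v Q)

  D≢0 : ∀ P Q → D P Q ≢ 0#
  D≢0 P Q e = pq-nonsquare (u P * u Q) (sym (x-y≡0⇒x≡y e))

  private
    on-curve : ∀ P Q p′ (N M : Carrier) → M * M ≡ D P Q * D P Q + p′ * (N * N) →
      M ÷ D P Q * (M ÷ D P Q) ≡ 1# + p′ * (N ÷ D P Q * (N ÷ D P Q))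
    on-curve P Q p′ N M e = combine (M ∷ N ∷ p′ ∷ D P Q ∷ inv (D P Q) ∷ [])
      (λ { (M ∷ N ∷ p ∷ D ∷ i ∷ []) → (M :* i :* (M :* i) := 𝟙 :+ p :* (N :* i :* (N :* i))) ,
         (i :* i , (M :* M := D :* D :+ p :* (N :* N))) ∷ (i :* D :+ 𝟙 , (D :* i := 𝟙)) ∷ [] })
      (e , *-inverseʳ (D≢0 P Q)) refl

    ⊕-v² : ∀ P Q → Nᵛ P Q ÷ D P Q * (Nᵛ P Q ÷ D P Q) ≡ 1# + p * (Nᵘ P Q ÷ D P Q * (Nᵘ P Q ÷ D P Q))
    ⊕-v² P Q = on-curve P Q p (Nᵘ P Q) (Nᵛ P Q) (solve₂ P Q
      (λ { (v₁ ∷ w₁ ∷ v₂ ∷ w₂ ∷ u₁ ∷ u₂ ∷ p ∷ q ∷ []) →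
        numᵛᵉ p u₁ v₁ w₁ u₂ v₂ w₂ :* numᵛᵉ p u₁ v₁ w₁ u₂ v₂ w₂ :=
        denᵉ p q u₁ u₂ :* denᵉ p q u₁ u₂ :+ p :* (numᵘᵉ u₁ v₁ w₁ u₂ v₂ w₂ :* numᵘᵉ u₁ v₁ w₁ u₂ v₂ w₂) }) refl)

    ⊕-w² : ∀ P Q → Nʷ P Q ÷ D P Q * (Nʷ P Q ÷ D P Q) ≡ 1# + q * (Nᵘ P Q ÷ D P Q * (Nᵘ P Q ÷ D P Q))
    ⊕-w² P Q = on-curve P Q q (Nᵘ P Q) (Nʷ P Q) (solve₂ P Q
      (λ { (v₁ ∷ w₁ ∷ v₂ ∷ w₂ ∷ u₁ ∷ u₂ ∷ p ∷ q ∷ []) →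
        numᵛᵉ q u₁ w₁ v₁ u₂ w₂ v₂ :* numᵛᵉ q u₁ w₁ v₁ u₂ w₂ v₂ :=
        denᵉ p q u₁ u₂ :* denᵉ p q u₁ u₂ :+ q :* (numᵘᵉ u₁ v₁ w₁ u₂ v₂ w₂ :* numᵘᵉ u₁ v₁ w₁ u₂ v₂ w₂) }) refl)

    𝟘-eq : ∀ p → 1# * 1# ≡ 1# + p * (0# * 0#)
    𝟘-eq p = ring (p ∷ []) (λ { (p ∷ []) → 𝟙 :* 𝟙 := 𝟙 :+ p :* (lit (+ 0) :* lit (+ 0)) }) refl

    ⊖-eq : ∀ u p x → x ≡ 1# + p * (u * u) → x ≡ 1# + p * (- u * - u)
    ⊖-eq u p x e = trans e (ring (u ∷ p ∷ []) (λ { (u ∷ p ∷ []) → 𝟙 :+ p :* (u :* u) := 𝟙 :+ p :* (:- u :* :- u) }) refl)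

  infixl 6 _⊕_

  -- The coordinates of a sum are quotients of large polynomials, so conversion checking must not unfold them.
  abstract
    _⊕_ : J → J → J
    P ⊕ Q = pt (Nᵘ P Q ÷ D P Q) (Nᵛ P Q ÷ D P Q) (Nʷ P Q ÷ D P Q) (⊕-v² P Q) (⊕-w² P Q)

    u-⊕ : ∀ P Q → u (P ⊕ Q) * D P Q ≡ Nᵘ P Q
    u-⊕ P Q = ÷-* (Nᵘ P Q) (D≢0 P Q)

    v-⊕ : ∀ P Q → v (P ⊕ Q) * D P Q ≡ Nᵛ P Q
    v-⊕ P Q = ÷-* (Nᵛ P Q) (D≢0 P Q)

    w-⊕ : ∀ P Q → w (P ⊕ Q) * D P Q ≡ Nʷ P Q
    w-⊕ P Q = ÷-* (Nʷ P Q) (D≢0 P Q)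

    ⊕-unique : ∀ P Q {R} → u R * D P Q ≡ Nᵘ P Q → v R * D P Q ≡ Nᵛ P Q → w R * D P Q ≡ Nʷ P Q → R ≡ P ⊕ Q
    ⊕-unique P Q eᵘ eᵛ eʷ = J-≡ (÷-unique (D≢0 P Q) eᵘ) (÷-unique (D≢0 P Q) eᵛ) (÷-unique (D≢0 P Q) eʷ)

  𝟘 : J
  𝟘 = pt 0# 1# 1# (𝟘-eq p) (𝟘-eq q)

  infix 8 ⊖_

  ⊖_ : J → J
  ⊖ P = pt (- u P) (v P) (w P) (⊖-eq (u P) p _ (v² P)) (⊖-eq (u P) q _ (w² P))

  ⊕-comm : ∀ P Q → P ⊕ Q ≡ Q ⊕ P
  ⊕-comm P Q = ⊕-unique Q P (flip₂ (ring ρ (λ { (u₁ ∷ v₁ ∷ w₁ ∷ u₂ ∷ v₂ ∷ w₂ ∷ p ∷ q ∷ []) → numᵘᵉ u₁ v₁ w₁ u₂ v₂ w₂ := numᵘᵉ u₂ v₂ w₂ u₁ v₁ w₁ }) refl) (u-⊕ P Q))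
                        (flip₂ (ring ρ (λ { (u₁ ∷ v₁ ∷ w₁ ∷ u₂ ∷ v₂ ∷ w₂ ∷ p ∷ q ∷ []) → numᵛᵉ p u₁ v₁ w₁ u₂ v₂ w₂ := numᵛᵉ p u₂ v₂ w₂ u₁ v₁ w₁ }) refl) (v-⊕ P Q))
                        (flip₂ (ring ρ (λ { (u₁ ∷ v₁ ∷ w₁ ∷ u₂ ∷ v₂ ∷ w₂ ∷ p ∷ q ∷ []) → numᵛᵉ q u₁ w₁ v₁ u₂ w₂ v₂ := numᵛᵉ q u₂ w₂ v₂ u₁ w₁ v₁ }) refl) (w-⊕ P Q))
    where
    ρ = u P ∷ v P ∷ w P ∷ u Q ∷ v Q ∷ w Q ∷ p ∷ q ∷ []
    flip₂ : ∀ {x N M} → N ≡ M → x * D P Q ≡ N → x * D Q P ≡ M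
    flip₂ {x} e h = trans (cong (x *_) (ring ρ (λ { (u₁ ∷ v₁ ∷ w₁ ∷ u₂ ∷ v₂ ∷ w₂ ∷ p ∷ q ∷ []) → denᵉ p q u₂ u₁ := denᵉ p q u₁ u₂ }) refl)) (trans h e)

  ⊕-identityˡ : ∀ P → 𝟘 ⊕ P ≡ P
  ⊕-identityˡ P = sym (⊕-unique 𝟘 P
    (ring ρ (λ { (u ∷ v ∷ w ∷ p ∷ q ∷ []) → u :* denᵉ p q (lit (+ 0)) u := numᵘᵉ (lit (+ 0)) 𝟙 𝟙 u v w }) refl)
    (ring ρ (λ { (u ∷ v ∷ w ∷ p ∷ q ∷ []) → v :* denᵉ p q (lit (+ 0)) u := numᵛᵉ p (lit (+ 0)) 𝟙 𝟙 u v w }) refl)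
    (ring ρ (λ { (u ∷ v ∷ w ∷ p ∷ q ∷ []) → w :* denᵉ p q (lit (+ 0)) u := numᵛᵉ q (lit (+ 0)) 𝟙 𝟙 u w v }) refl))
    where ρ = u P ∷ v P ∷ w P ∷ p ∷ q ∷ []

  ⊕-inverseˡ : ∀ P → ⊖ P ⊕ P ≡ 𝟘
  ⊕-inverseˡ P = sym (⊕-unique (⊖ P) P
    (solve₁ P (λ { (v ∷ w ∷ u ∷ p ∷ q ∷ []) → (lit (+ 0) :* denᵉ p q (:- u) u := numᵘᵉ (:- u) v w u v w) }) refl)
    (solve₁ P (λ { (v ∷ w ∷ u ∷ p ∷ q ∷ []) → (𝟙 :* denᵉ p q (:- u) u := numᵛᵉ p (:- u) v w u v w) }) refl)
    (solve₁ P (λ { (v ∷ w ∷ u ∷ p ∷ q ∷ []) → (𝟙 :* denᵉ p q (:- u) u := numᵛᵉ q (:- u) w v u w v) }) refl))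

  private
    -- Clearing the inner denominator `D` of a threefold sum leaves one denominator
    -- `D² - p q N² u₃²`, polynomial in the original coordinates; `N` is the inner numerator of `u`.
    den₃ : Carrier → Carrier → Carrier → Carrier
    den₃ D N u₃ = D * D - p * q * (N * u₃ * (N * u₃))

    den₃ᵉ : ∀ {n} (p q D N u₃ : Expr n) → Expr n
    den₃ᵉ p q D N u₃ = D :* D :- p :* q :* (N :* u₃ :* (N :* u₃))

    numᵘ₃ᵉ : ∀ {n} (D U V W u₃ v₃ w₃ : Expr n) → Expr n
    numᵘ₃ᵉ D U V W u₃ v₃ w₃ = U :* D :* (v₃ :* w₃) :+ u₃ :* (V :* W)

    numᵛ₃ᵉ : ∀ {n} (p D U V W u₃ v₃ w₃ : Expr n) → Expr n
    numᵛ₃ᵉ p D U V W u₃ v₃ w₃ = V :* D :* v₃ :+ p :* (U :* W :* (u₃ :* w₃))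

    Den₃ : J → J → J → Carrier
    Den₃ P Q R = den₃ (D P Q) (Nᵘ P Q) (u R)

    Den₃≢0 : ∀ P Q R → Den₃ P Q R ≢ 0#
    Den₃≢0 P Q R = subst (_≢ 0#)
      (combine (u (P ⊕ Q) ∷ u R ∷ D P Q ∷ Nᵘ P Q ∷ p ∷ q ∷ [])
        (λ { (u ∷ u₃ ∷ D ∷ N ∷ p ∷ q ∷ []) → (D :* D :* denᵉ p q u u₃ := den₃ᵉ p q D N u₃) ,
           (:- (p :* q :* (u₃ :* u₃) :* (u :* D :+ N)) , (u :* D := N)) ∷ [] })
        (u-⊕ P Q) refl)
      (*-nonzero (*-nonzero (D≢0 P Q) (D≢0 P Q)) (D≢0 (P ⊕ Q) R))

    u-⊕₃ : ∀ P Q R → u ((P ⊕ Q) ⊕ R) * Den₃ P Q R ≡ Nᵘ P Q * D P Q * (v R * w R) + u R * (Nᵛ P Q * Nʷ P Q)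
    u-⊕₃ P Q R = combine (u ((P ⊕ Q) ⊕ R) ∷ u (P ⊕ Q) ∷ v (P ⊕ Q) ∷ w (P ⊕ Q) ∷ D P Q ∷ Nᵘ P Q ∷ Nᵛ P Q ∷ Nʷ P Q ∷ u R ∷ v R ∷ w R ∷ p ∷ q ∷ [])
      (λ { (x ∷ u ∷ v ∷ w ∷ D ∷ U ∷ V ∷ W ∷ u₃ ∷ v₃ ∷ w₃ ∷ p ∷ q ∷ []) →
        (x :* den₃ᵉ p q D U u₃ := numᵘ₃ᵉ D U V W u₃ v₃ w₃) ,
        (D :* D , (x :* denᵉ p q u u₃ := numᵘᵉ u v w u₃ v₃ w₃)) ∷
        (x :* p :* q :* (u₃ :* u₃) :* (u :* D :+ U) :+ v₃ :* w₃ :* D , (u :* D := U)) ∷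
        (u₃ :* w :* D , (v :* D := V)) ∷ (u₃ :* V , (w :* D := W)) ∷ [] })
      (u-⊕ (P ⊕ Q) R , u-⊕ P Q , v-⊕ P Q , w-⊕ P Q) refl

    v-⊕₃ : ∀ P Q R → v ((P ⊕ Q) ⊕ R) * Den₃ P Q R ≡ Nᵛ P Q * D P Q * v R + p * (Nᵘ P Q * Nʷ P Q * (u R * w R))
    v-⊕₃ P Q R = combine (v ((P ⊕ Q) ⊕ R) ∷ u (P ⊕ Q) ∷ v (P ⊕ Q) ∷ w (P ⊕ Q) ∷ D P Q ∷ Nᵘ P Q ∷ Nᵛ P Q ∷ Nʷ P Q ∷ u R ∷ v R ∷ w R ∷ p ∷ q ∷ [])
      (λ { (x ∷ u ∷ v ∷ w ∷ D ∷ U ∷ V ∷ W ∷ u₃ ∷ v₃ ∷ w₃ ∷ p ∷ q ∷ []) →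
        (x :* den₃ᵉ p q D U u₃ := numᵛ₃ᵉ p D U V W u₃ v₃ w₃) ,
        (D :* D , (x :* denᵉ p q u u₃ := numᵛᵉ p u v w u₃ v₃ w₃)) ∷
        (x :* p :* q :* (u₃ :* u₃) :* (u :* D :+ U) :+ p :* w :* u₃ :* w₃ :* D , (u :* D := U)) ∷
        (v₃ :* D , (v :* D := V)) ∷ (p :* U :* u₃ :* w₃ , (w :* D := W)) ∷ [] })
      (v-⊕ (P ⊕ Q) R , u-⊕ P Q , v-⊕ P Q , w-⊕ P Q) refl

    w-⊕₃ : ∀ P Q R → w ((P ⊕ Q) ⊕ R) * Den₃ P Q R ≡ Nʷ P Q * D P Q * w R + q * (Nᵘ P Q * Nᵛ P Q * (u R * v R))
    w-⊕₃ P Q R = combine (w ((P ⊕ Q) ⊕ R) ∷ u (P ⊕ Q) ∷ v (P ⊕ Q) ∷ w (P ⊕ Q) ∷ D P Q ∷ Nᵘ P Q ∷ Nᵛ P Q ∷ Nʷ P Q ∷ u R ∷ v R ∷ w R ∷ p ∷ q ∷ [])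
      (λ { (x ∷ u ∷ v ∷ w ∷ D ∷ U ∷ V ∷ W ∷ u₃ ∷ v₃ ∷ w₃ ∷ p ∷ q ∷ []) →
        (x :* den₃ᵉ p q D U u₃ := numᵛ₃ᵉ q D U W V u₃ w₃ v₃) ,
        (D :* D , (x :* denᵉ p q u u₃ := numᵛᵉ q u w v u₃ w₃ v₃)) ∷
        (x :* p :* q :* (u₃ :* u₃) :* (u :* D :+ U) :+ q :* v :* u₃ :* v₃ :* D , (u :* D := U)) ∷
        (q :* U :* u₃ :* v₃ , (v :* D := V)) ∷ (w₃ :* D , (w :* D := W)) ∷ [] })
      (w-⊕ (P ⊕ Q) R , u-⊕ P Q , v-⊕ P Q , w-⊕ P Q) refl

    cross : ∀ {x y a b c d} → a ≢ 0# → b ≢ 0# → x * a ≡ c → y * b ≡ d → c * b ≡ d * a → x ≡ y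
    cross {x} {y} {a} {b} {c} {d} a≢0 b≢0 e f g = *-cancelʳ (a * b) (*-nonzero a≢0 b≢0)
      (combine (x ∷ y ∷ a ∷ b ∷ c ∷ d ∷ []) (λ { (x ∷ y ∷ a ∷ b ∷ c ∷ d ∷ []) → (x :* (a :* b) := y :* (a :* b)) ,
        (b , (x :* a := c)) ∷ (:- a , (y :* b := d)) ∷ (𝟙 , (c :* b := d :* a)) ∷ [] }) (e , f , g) refl)

  -- Both sides are nested to the left, so the same formulas for threefold sums apply to each, and
  -- cross-multiplication leaves polynomial identities. Commutativity turns the rotation into
  -- associativity.
  ⊕-rotate : ∀ P Q R → (P ⊕ Q) ⊕ R ≡ (Q ⊕ R) ⊕ P
  ⊕-rotate P Q R = J-≡
    (cross (Den₃≢0 P Q R) (Den₃≢0 Q R P) (u-⊕₃ P Q R) (u-⊕₃ Q R P)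
      (solve₃ P Q R (λ { (v₁ ∷ w₁ ∷ v₂ ∷ w₂ ∷ v₃ ∷ w₃ ∷ u₁ ∷ u₂ ∷ u₃ ∷ p ∷ q ∷ []) →
        numᵘ₃ᵉ (denᵉ p q u₁ u₂) (numᵘᵉ u₁ v₁ w₁ u₂ v₂ w₂) (numᵛᵉ p u₁ v₁ w₁ u₂ v₂ w₂) (numᵛᵉ q u₁ w₁ v₁ u₂ w₂ v₂) u₃ v₃ w₃
          :* den₃ᵉ p q (denᵉ p q u₂ u₃) (numᵘᵉ u₂ v₂ w₂ u₃ v₃ w₃) u₁ :=
        numᵘ₃ᵉ (denᵉ p q u₂ u₃) (numᵘᵉ u₂ v₂ w₂ u₃ v₃ w₃) (numᵛᵉ p u₂ v₂ w₂ u₃ v₃ w₃) (numᵛᵉ q u₂ w₂ v₂ u₃ w₃ v₃) u₁ v₁ w₁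
          :* den₃ᵉ p q (denᵉ p q u₁ u₂) (numᵘᵉ u₁ v₁ w₁ u₂ v₂ w₂) u₃ }) refl))
    (cross (Den₃≢0 P Q R) (Den₃≢0 Q R P) (v-⊕₃ P Q R) (v-⊕₃ Q R P)
      (solve₃ P Q R (λ { (v₁ ∷ w₁ ∷ v₂ ∷ w₂ ∷ v₃ ∷ w₃ ∷ u₁ ∷ u₂ ∷ u₃ ∷ p ∷ q ∷ []) →
        numᵛ₃ᵉ p (denᵉ p q u₁ u₂) (numᵘᵉ u₁ v₁ w₁ u₂ v₂ w₂) (numᵛᵉ p u₁ v₁ w₁ u₂ v₂ w₂) (numᵛᵉ q u₁ w₁ v₁ u₂ w₂ v₂) u₃ v₃ w₃
          :* den₃ᵉ p q (denᵉ p q u₂ u₃) (numᵘᵉ u₂ v₂ w₂ u₃ v₃ w₃) u₁ :=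
        numᵛ₃ᵉ p (denᵉ p q u₂ u₃) (numᵘᵉ u₂ v₂ w₂ u₃ v₃ w₃) (numᵛᵉ p u₂ v₂ w₂ u₃ v₃ w₃) (numᵛᵉ q u₂ w₂ v₂ u₃ w₃ v₃) u₁ v₁ w₁
          :* den₃ᵉ p q (denᵉ p q u₁ u₂) (numᵘᵉ u₁ v₁ w₁ u₂ v₂ w₂) u₃ }) refl))
    (cross (Den₃≢0 P Q R) (Den₃≢0 Q R P) (w-⊕₃ P Q R) (w-⊕₃ Q R P)
      (solve₃ P Q R (λ { (v₁ ∷ w₁ ∷ v₂ ∷ w₂ ∷ v₃ ∷ w₃ ∷ u₁ ∷ u₂ ∷ u₃ ∷ p ∷ q ∷ []) →
        numᵛ₃ᵉ q (denᵉ p q u₁ u₂) (numᵘᵉ u₁ v₁ w₁ u₂ v₂ w₂) (numᵛᵉ q u₁ w₁ v₁ u₂ w₂ v₂) (numᵛᵉ p u₁ v₁ w₁ u₂ v₂ w₂) u₃ w₃ v₃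
          :* den₃ᵉ p q (denᵉ p q u₂ u₃) (numᵘᵉ u₂ v₂ w₂ u₃ v₃ w₃) u₁ :=
        numᵛ₃ᵉ q (denᵉ p q u₂ u₃) (numᵘᵉ u₂ v₂ w₂ u₃ v₃ w₃) (numᵛᵉ q u₂ w₂ v₂ u₃ w₃ v₃) (numᵛᵉ p u₂ v₂ w₂ u₃ v₃ w₃) u₁ w₁ v₁
          :* den₃ᵉ p q (denᵉ p q u₁ u₂) (numᵘᵉ u₁ v₁ w₁ u₂ v₂ w₂) u₃ }) refl))

  ⊕-assoc : ∀ P Q R → (P ⊕ Q) ⊕ R ≡ P ⊕ (Q ⊕ R)
  ⊕-assoc P Q R = trans (⊕-rotate P Q R) (⊕-comm (Q ⊕ R) P)

  abelianGroup : AbelianGroup _ _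
  abelianGroup = record
    { Carrier = J ; _≈_ = _≡_ ; _∙_ = _⊕_ ; ε = 𝟘 ; _⁻¹ = ⊖_
    ; isAbelianGroup = record
      { isGroup = record
        { isMonoid = record
          { isSemigroup = record
            { isMagma = record { isEquivalence = isEquivalence ; ∙-cong = cong₂ _⊕_ }
            ; assoc = ⊕-assoc }
          ; identity = ⊕-identityˡ , λ P → trans (⊕-comm P 𝟘) (⊕-identityˡ P) }
        ; inverse = ⊕-inverseˡ , λ P → trans (⊕-comm P (⊖ P)) (⊕-inverseˡ P)
        ; ⁻¹-cong = cong ⊖_ }
      ; comm = ⊕-comm } }

-- Common denominators, and collinear points of the elliptic curve

module Projective (F : ≡-Field) (p q : ≡-Field.Carrier F)
  (pq-nonsquare : ∀ x → ≡-Field._*_ F (≡-Field._*_ F p q) (≡-Field._*_ F x x) ≢ ≡-Field.1# F) where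

  open ≡-Field F
  open Solver ≡-commutativeRing
  open FieldProperties F
  open Jacobi F p q pq-nonsquare
  open ≡-Reasoning

  record Coordinates (P : J) (T U V W : Carrier) : Set where
    constructor coordinates
    field
      T≢0 : T ≢ 0#
      uT : u P * T ≡ U
      vT : v P * T ≡ V
      wT : w P * T ≡ W

  coordinates-unique : ∀ {P Q T U V W T′ U′ V′ W′} → Coordinates P T U V W → Coordinates Q T′ U′ V′ W′ →
    U * T′ ≡ U′ * T → V * T′ ≡ V′ * T → W * T′ ≡ W′ * T → P ≡ Q
  coordinates-unique {P} {Q} {T} {T′ = T′} (coordinates T≢0 uT vT wT) (coordinates T′≢0 uT′ vT′ wT′) eᵘ eᵛ eʷ =
    J-≡ (go uT uT′ eᵘ) (go vT vT′ eᵛ) (go wT wT′ eʷ)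
    where
    go : ∀ {x y X Y} → x * T ≡ X → y * T′ ≡ Y → X * T′ ≡ Y * T → x ≡ y
    go {x} {y} {X} {Y} a b c = *-cancelʳ (T * T′) (*-nonzero T≢0 T′≢0)
      (combine (x ∷ y ∷ X ∷ Y ∷ T ∷ T′ ∷ []) (λ { (x ∷ y ∷ X ∷ Y ∷ T ∷ T′ ∷ []) → (x :* (T :* T′) := y :* (T :* T′)) ,
        (T′ , (x :* T := X)) ∷ (:- T , (y :* T′ := Y)) ∷ (lit (+ 1) , (X :* T′ := Y :* T)) ∷ [] }) (a , b , c) refl)

  module _ {P Q T₁ U₁ V₁ W₁ T₂ U₂ V₂ W₂} (cP : Coordinates P T₁ U₁ V₁ W₁) (cQ : Coordinates Q T₂ U₂ V₂ W₂) where
    private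
      module P = Coordinates cP
      module Q = Coordinates cQ
      ρ : Vec Carrier 10
      ρ = u P ∷ v P ∷ w P ∷ T₁ ∷ u Q ∷ v Q ∷ w Q ∷ T₂ ∷ p ∷ q ∷ []

      scaled : ∀ {x n m} → x * D P Q ≡ n → (T₁ * T₂) * (T₁ * T₂) * n ≡ m →
        x * (T₁ * T₂ * (T₁ * T₂) - p * q * (U₁ * U₂ * (U₁ * U₂))) ≡ m
      scaled {x} {n} {m} e f = begin
        x * (T₁ * T₂ * (T₁ * T₂) - p * q * (U₁ * U₂ * (U₁ * U₂)))
          ≡⟨ cong₂ (λ a b → x * (T₁ * T₂ * (T₁ * T₂) - p * q * (a * b * (a * b)))) (sym P.uT) (sym Q.uT) ⟩
        x * (T₁ * T₂ * (T₁ * T₂) - p * q * (u P * T₁ * (u Q * T₂) * (u P * T₁ * (u Q * T₂))))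
          ≡⟨ ring (x ∷ ρ) (λ { (x ∷ u₁ ∷ v₁ ∷ w₁ ∷ T₁ ∷ u₂ ∷ v₂ ∷ w₂ ∷ T₂ ∷ p ∷ q ∷ []) →
             x :* (T₁ :* T₂ :* (T₁ :* T₂) :- p :* q :* (u₁ :* T₁ :* (u₂ :* T₂) :* (u₁ :* T₁ :* (u₂ :* T₂)))) :=
             T₁ :* T₂ :* (T₁ :* T₂) :* (x :* (lit (+ 1) :- p :* q :* (u₁ :* u₂ :* (u₁ :* u₂)))) }) refl ⟩
        T₁ * T₂ * (T₁ * T₂) * (x * D P Q)
          ≡⟨ cong (T₁ * T₂ * (T₁ * T₂) *_) e ⟩
        T₁ * T₂ * (T₁ * T₂) * n
          ≡⟨ f ⟩
        m ∎

    -- These are the affine formulas multiplied by `(T₁ T₂)²`; the new denominator is that multiple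
    -- of `D P Q`, hence nonzero.
    ⊕-coordinates : Coordinates (P ⊕ Q)
      (T₁ * T₂ * (T₁ * T₂) - p * q * (U₁ * U₂ * (U₁ * U₂)))
      (U₁ * T₁ * (V₂ * W₂) + U₂ * T₂ * (V₁ * W₁))
      (T₁ * V₁ * (T₂ * V₂) + p * (U₁ * W₁ * (U₂ * W₂)))
      (T₁ * W₁ * (T₂ * W₂) + q * (U₁ * V₁ * (U₂ * V₂)))
    ⊕-coordinates = coordinates
      (λ e → *-nonzero (*-nonzero (*-nonzero P.T≢0 Q.T≢0) (*-nonzero P.T≢0 Q.T≢0)) (D≢0 P Q)
        (begin
          T₁ * T₂ * (T₁ * T₂) * D P Q     ≡⟨ cong (T₁ * T₂ * (T₁ * T₂) *_) (sym (*-identityˡ _)) ⟩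
          T₁ * T₂ * (T₁ * T₂) * (1# * D P Q) ≡⟨ sym (scaled refl refl) ⟩
          1# * (T₁ * T₂ * (T₁ * T₂) - p * q * (U₁ * U₂ * (U₁ * U₂))) ≡⟨ trans (*-identityˡ _) e ⟩
          0# ∎))
      (scaled (u-⊕ P Q) (trans (ring ρ (λ { (u₁ ∷ v₁ ∷ w₁ ∷ T₁ ∷ u₂ ∷ v₂ ∷ w₂ ∷ T₂ ∷ p ∷ q ∷ []) →
        T₁ :* T₂ :* (T₁ :* T₂) :* (u₁ :* (v₂ :* w₂) :+ u₂ :* (v₁ :* w₁)) :=
        u₁ :* T₁ :* T₁ :* (v₂ :* T₂ :* (w₂ :* T₂)) :+ u₂ :* T₂ :* T₂ :* (v₁ :* T₁ :* (w₁ :* T₁)) }) refl)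
        (cong₂ _+_ (cong₂ (λ a b → a * T₁ * b) P.uT (cong₂ _*_ Q.vT Q.wT)) (cong₂ (λ a b → a * T₂ * b) Q.uT (cong₂ _*_ P.vT P.wT)))))
      (scaled (v-⊕ P Q) (trans (ring ρ (λ { (u₁ ∷ v₁ ∷ w₁ ∷ T₁ ∷ u₂ ∷ v₂ ∷ w₂ ∷ T₂ ∷ p ∷ q ∷ []) →
        T₁ :* T₂ :* (T₁ :* T₂) :* (v₁ :* v₂ :+ p :* (u₁ :* w₁ :* (u₂ :* w₂))) :=
        T₁ :* (v₁ :* T₁) :* (T₂ :* (v₂ :* T₂)) :+ p :* (u₁ :* T₁ :* (w₁ :* T₁) :* (u₂ :* T₂ :* (w₂ :* T₂))) }) refl)
        (cong₂ _+_ (cong₂ (λ a b → T₁ * a * (T₂ * b)) P.vT Q.vT) (cong (p *_) (cong₂ _*_ (cong₂ _*_ P.uT P.wT) (cong₂ _*_ Q.uT Q.wT))))))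
      (scaled (w-⊕ P Q) (trans (ring ρ (λ { (u₁ ∷ v₁ ∷ w₁ ∷ T₁ ∷ u₂ ∷ v₂ ∷ w₂ ∷ T₂ ∷ p ∷ q ∷ []) →
        T₁ :* T₂ :* (T₁ :* T₂) :* (w₁ :* w₂ :+ q :* (u₁ :* v₁ :* (u₂ :* v₂))) :=
        T₁ :* (w₁ :* T₁) :* (T₂ :* (w₂ :* T₂)) :+ q :* (u₁ :* T₁ :* (v₁ :* T₁) :* (u₂ :* T₂ :* (v₂ :* T₂))) }) refl)
        (cong₂ _+_ (cong₂ (λ a b → T₁ * a * (T₂ * b)) P.wT Q.wT) (cong (q *_) (cong₂ _*_ (cong₂ _*_ P.uT P.vT) (cong₂ _*_ Q.uT Q.vT))))))

  OnE : Carrier → Carrier → Set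
  OnE x y = y * y ≡ x * (x + p) * (x + q)

  private
    T′ V′ W′ : Carrier → Carrier → Carrier
    T′ q x = x * x - p * q
    V′ q x = x * x + (p + p) * x + p * q
    W′ q x = x * x + (q + q) * x + p * q

  -- Together with `U = 2y` these are the coordinates of the image of `(x , y)`. Indeed
  -- `V - T = 2p (x + q)` and `V + T = 2x (x + p)`, so `V² - T² = p (2y)²`, and likewise
  -- `W² - T² = q (2y)²`.
  Tᴱ Vᴱ Wᴱ : Carrier → Carrier
  Tᴱ = T′ q
  Vᴱ = V′ q
  Wᴱ = W′ q

  -- A line y = l x + m meeting the curve in points with abscissas x₁, x₂, x₃.
  record Line (x₁ x₂ x₃ l m : Carrier) : Set where
    constructor line
    field
      e₁ : x₁ + x₂ + x₃ + p + q ≡ l * l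
      e₂ : p * q ≡ x₁ * x₂ + (x₁ + x₂) * x₃ + (l + l) * m
      e₃ : m * m ≡ x₁ * x₂ * x₃

  -- The fields of `Line` are Vieta's relations for the cubic `x (x + p) (x + q) - (l x + m)²`. Once
  -- two of its coefficients agree with those of `(x - x₁) (x - x₂) (x - x₃)`, the known root `x₁`
  -- forces the constant terms to agree too.
  line-e₃ : ∀ {x₁ x₂ x₃ l m y₁} → OnE x₁ y₁ → y₁ ≡ l * x₁ + m → x₁ + x₂ + x₃ + p + q ≡ l * l →
    p * q ≡ x₁ * x₂ + (x₁ + x₂) * x₃ + (l + l) * m → m * m ≡ x₁ * x₂ * x₃
  line-e₃ {x₁} {x₂} {x₃} {l} {m} o refl e₁ e₂ = combine (x₁ ∷ x₂ ∷ x₃ ∷ l ∷ m ∷ p ∷ q ∷ [])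
    (λ { (x₁ ∷ x₂ ∷ x₃ ∷ l ∷ m ∷ p ∷ q ∷ []) → (m :* m := x₁ :* x₂ :* x₃) ,
      (lit (+ 1) , ((l :* x₁ :+ m) :* (l :* x₁ :+ m) := x₁ :* (x₁ :+ p) :* (x₁ :+ q))) ∷
      (x₁ , (p :* q := x₁ :* x₂ :+ (x₁ :+ x₂) :* x₃ :+ (l :+ l) :* m)) ∷
      (x₁ :* x₁ , (x₁ :+ x₂ :+ x₃ :+ p :+ q := l :* l)) ∷ [] }) (o , e₂ , e₁) refl

  line-third : ∀ {x₁ x₂ x₃ l m y₃} → Line x₁ x₂ x₃ l m → y₃ ≡ - (l * x₃ + m) → OnE x₃ y₃
  line-third {x₁} {x₂} {x₃} {l} {m} (line e₁ e₂ e₃) refl = combine (x₁ ∷ x₂ ∷ x₃ ∷ l ∷ m ∷ p ∷ q ∷ [])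
    (λ { (x₁ ∷ x₂ ∷ x₃ ∷ l ∷ m ∷ p ∷ q ∷ []) → (:- (l :* x₃ :+ m) :* :- (l :* x₃ :+ m) := x₃ :* (x₃ :+ p) :* (x₃ :+ q)) ,
      (lit (+ 1) , (m :* m := x₁ :* x₂ :* x₃)) ∷
      (:- x₃ , (p :* q := x₁ :* x₂ :+ (x₁ :+ x₂) :* x₃ :+ (l :+ l) :* m)) ∷
      (:- (x₃ :* x₃) , (x₁ :+ x₂ :+ x₃ :+ p :+ q := l :* l)) ∷ [] }) (e₃ , e₂ , e₁) refl

  private
    -- Vieta's relations are made into rewriting rules by reading them backwards: they give `p + q`
    -- and `p q` in terms of the line and the abscissas, so `q` is eliminated and `p` is a root of a
    -- quadratic over the remaining variables, while `m²` is the product of the abscissas.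
    line-rules : Rules 6
    line-rules =
      quad (λ { (m ∷ x₁ ∷ x₂ ∷ x₃ ∷ l ∷ []) → :- (x₁ :* x₂ :+ (x₁ :+ x₂) :* x₃ :+ (l :+ l) :* m) , l :* l :- (x₁ :+ x₂ :+ x₃) })
      (square (λ { (x₁ ∷ x₂ ∷ x₃ ∷ l ∷ []) → x₁ :* x₂ :* x₃ })
      (free (free (free (free [])))))

    line-rules-valid : ∀ {x₁ x₂ x₃ l m} → Line x₁ x₂ x₃ l m → Valid line-rules (p ∷ m ∷ x₁ ∷ x₂ ∷ x₃ ∷ l ∷ [])
    line-rules-valid {x₁} {x₂} {x₃} {l} {m} (line e₁ e₂ e₃) = combine (x₁ ∷ x₂ ∷ x₃ ∷ l ∷ m ∷ p ∷ q ∷ [])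
      (λ { (x₁ ∷ x₂ ∷ x₃ ∷ l ∷ m ∷ p ∷ q ∷ []) →
        (p :* p := :- (x₁ :* x₂ :+ (x₁ :+ x₂) :* x₃ :+ (l :+ l) :* m) :+ (l :* l :- (x₁ :+ x₂ :+ x₃)) :* p) ,
        (:- (lit (+ 1)) , (p :* q := x₁ :* x₂ :+ (x₁ :+ x₂) :* x₃ :+ (l :+ l) :* m)) ∷
        (p , (x₁ :+ x₂ :+ x₃ :+ p :+ q := l :* l)) ∷ [] }) (e₂ , e₁) refl , e₃ , tt

    q-from-line : ∀ {x₁ x₂ x₃ l m} → Line x₁ x₂ x₃ l m → q ≡ l * l - (x₁ + x₂ + x₃) - p
    q-from-line {x₁} {x₂} {x₃} {l} {m} (line e₁ _ _) = combine (x₁ ∷ x₂ ∷ x₃ ∷ l ∷ p ∷ q ∷ [])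
      (λ { (x₁ ∷ x₂ ∷ x₃ ∷ l ∷ p ∷ q ∷ []) → (q := l :* l :- (x₁ :+ x₂ :+ x₃) :- p) ,
         (lit (+ 1) , (x₁ :+ x₂ :+ x₃ :+ p :+ q := l :* l)) ∷ [] }) e₁ refl

    solve-line : ∀ {x₁ x₂ x₃ l m} → Line x₁ x₂ x₃ l m → (g : Vec (Expr 6) 6 → Equation 6) →
      checks line-rules (g vars , []) ≡ true → Holds (g vars) (p ∷ m ∷ x₁ ∷ x₂ ∷ x₃ ∷ l ∷ [])
    solve-line L g = solveGoal _ line-rules (line-rules-valid L) (g vars , []) tt

    Tᵉ Vᵉ Wᵉ : ∀ {n} (p q x : Expr n) → Expr n
    Tᵉ p q x = x :* x :- p :* q
    Vᵉ p q x = x :* x :+ (p :+ p) :* x :+ p :* q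
    Wᵉ p q x = x :* x :+ (q :+ q) :* x :+ p :* q

    Dᵉ : ∀ {n} (p q x₁ U₁ x₂ U₂ : Expr n) → Expr n
    Dᵉ p q x₁ U₁ x₂ U₂ = Tᵉ p q x₁ :* Tᵉ p q x₂ :* (Tᵉ p q x₁ :* Tᵉ p q x₂) :- p :* q :* (U₁ :* U₂ :* (U₁ :* U₂))

  -- Chord and tangent are treated at once: the identities use nothing but Vieta's relations and
  -- remain true when abscissas coincide. They are checked with `q` eliminated and then transported
  -- back to the given `q`.
  sum-on-line : ∀ {x₁ x₂ x₃ l m P Q R} → Line x₁ x₂ x₃ l m →
    (let y₁ = l * x₁ + m ; y₂ = l * x₂ + m ; y₃ = - (l * x₃ + m)) →
    Coordinates P (Tᴱ x₁) (y₁ + y₁) (Vᴱ x₁) (Wᴱ x₁) →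
    Coordinates Q (Tᴱ x₂) (y₂ + y₂) (Vᴱ x₂) (Wᴱ x₂) →
    Coordinates R (Tᴱ x₃) (y₃ + y₃) (Vᴱ x₃) (Wᴱ x₃) →
    R ≡ P ⊕ Q
  sum-on-line {x₁} {x₂} {x₃} {l} {m} L cP cQ cR = coordinates-unique cR (⊕-coordinates cP cQ)
    (subst (λ q → 
        U₃ * (T′ q x₁ * T′ q x₂ * (T′ q x₁ * T′ q x₂) - p * q * (U₁ * U₂ * (U₁ * U₂))) ≡
        (U₁ * T′ q x₁ * (V′ q x₂ * W′ q x₂) + U₂ * T′ q x₂ * (V′ q x₁ * W′ q x₁)) * T′ q x₃) q≡
      (solve-line L (λ { (p ∷ m ∷ x₁ ∷ x₂ ∷ x₃ ∷ l ∷ []) →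
        let q = l :* l :- (x₁ :+ x₂ :+ x₃) :- p
            U₁ = l :* x₁ :+ m :+ (l :* x₁ :+ m)
            U₂ = l :* x₂ :+ m :+ (l :* x₂ :+ m)
            U₃ = :- (l :* x₃ :+ m) :+ :- (l :* x₃ :+ m)
        in U₃ :* Dᵉ p q x₁ U₁ x₂ U₂ :=
           (U₁ :* Tᵉ p q x₁ :* (Vᵉ p q x₂ :* Wᵉ p q x₂) :+ U₂ :* Tᵉ p q x₂ :* (Vᵉ p q x₁ :* Wᵉ p q x₁)) :* Tᵉ p q x₃ }) refl))
    (subst (λ q → 
        V′ q x₃ * (T′ q x₁ * T′ q x₂ * (T′ q x₁ * T′ q x₂) - p * q * (U₁ * U₂ * (U₁ * U₂))) ≡
        (T′ q x₁ * V′ q x₁ * (T′ q x₂ * V′ q x₂) + p * (U₁ * W′ q x₁ * (U₂ * W′ q x₂))) * T′ q x₃) q≡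
      (solve-line L (λ { (p ∷ m ∷ x₁ ∷ x₂ ∷ x₃ ∷ l ∷ []) →
        let q = l :* l :- (x₁ :+ x₂ :+ x₃) :- p
            U₁ = l :* x₁ :+ m :+ (l :* x₁ :+ m)
            U₂ = l :* x₂ :+ m :+ (l :* x₂ :+ m)
        in Vᵉ p q x₃ :* Dᵉ p q x₁ U₁ x₂ U₂ :=
           (Tᵉ p q x₁ :* Vᵉ p q x₁ :* (Tᵉ p q x₂ :* Vᵉ p q x₂) :+ p :* (U₁ :* Wᵉ p q x₁ :* (U₂ :* Wᵉ p q x₂))) :* Tᵉ p q x₃ }) refl))
    (subst (λ q → 
        W′ q x₃ * (T′ q x₁ * T′ q x₂ * (T′ q x₁ * T′ q x₂) - p * q * (U₁ * U₂ * (U₁ * U₂))) ≡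
        (T′ q x₁ * W′ q x₁ * (T′ q x₂ * W′ q x₂) + q * (U₁ * V′ q x₁ * (U₂ * V′ q x₂))) * T′ q x₃) q≡
      (solve-line L (λ { (p ∷ m ∷ x₁ ∷ x₂ ∷ x₃ ∷ l ∷ []) →
        let q = l :* l :- (x₁ :+ x₂ :+ x₃) :- p
            U₁ = l :* x₁ :+ m :+ (l :* x₁ :+ m)
            U₂ = l :* x₂ :+ m :+ (l :* x₂ :+ m)
        in Wᵉ p q x₃ :* Dᵉ p q x₁ U₁ x₂ U₂ :=
           (Tᵉ p q x₁ :* Wᵉ p q x₁ :* (Tᵉ p q x₂ :* Wᵉ p q x₂) :+ q :* (U₁ :* Vᵉ p q x₁ :* (U₂ :* Vᵉ p q x₂))) :* Tᵉ p q x₃ }) refl))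
    where
    q≡ = sym (q-from-line L)
    U₁ = l * x₁ + m + (l * x₁ + m)
    U₂ = l * x₂ + m + (l * x₂ + m)
    U₃ = - (l * x₃ + m) + - (l * x₃ + m)

  collinear-sum : ∀ {x₁ y₁ x₂ y₂ x₃ y₃ l m P Q R} → Line x₁ x₂ x₃ l m →
    y₁ ≡ l * x₁ + m → y₂ ≡ l * x₂ + m → y₃ ≡ - (l * x₃ + m) →
    Coordinates P (Tᴱ x₁) (y₁ + y₁) (Vᴱ x₁) (Wᴱ x₁) →
    Coordinates Q (Tᴱ x₂) (y₂ + y₂) (Vᴱ x₂) (Wᴱ x₂) →
    Coordinates R (Tᴱ x₃) (y₃ + y₃) (Vᴱ x₃) (Wᴱ x₃) →
    R ≡ P ⊕ Q
  collinear-sum L refl refl refl = sum-on-line L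

  chord-line : ∀ {x₁ y₁ x₂ y₂ x₃ l} → OnE x₁ y₁ → OnE x₂ y₂ → x₂ - x₁ ≢ 0# → (x₂ - x₁) * l ≡ y₂ - y₁ →
    x₁ + x₂ + x₃ + p + q ≡ l * l → Line x₁ x₂ x₃ l (y₁ - l * x₁)
  chord-line {x₁} {y₁} {x₂} {y₂} {x₃} {l} o₁ o₂ x₁≢x₂ s e₁ = line e₁ e₂ (line-e₃ o₁ y₁≡ e₁ e₂)
    where
    y₁≡ : y₁ ≡ l * x₁ + (y₁ - l * x₁)
    y₁≡ = ring (x₁ ∷ y₁ ∷ l ∷ []) (λ { (x ∷ y ∷ l ∷ []) → y := l :* x :+ (y :- l :* x) }) refl
    e₂ : p * q ≡ x₁ * x₂ + (x₁ + x₂) * x₃ + (l + l) * (y₁ - l * x₁)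
    -- The difference of the two curve equations is `x₂ - x₁` times the wanted relation, once the
    -- slope and the sum of the roots are substituted.
    e₂ = *-cancelʳ (x₂ - x₁) x₁≢x₂ (combine (x₁ ∷ y₁ ∷ x₂ ∷ y₂ ∷ x₃ ∷ l ∷ p ∷ q ∷ [])
      (λ { (x₁ ∷ y₁ ∷ x₂ ∷ y₂ ∷ x₃ ∷ l ∷ p ∷ q ∷ []) →
        (p :* q :* (x₂ :- x₁) := (x₁ :* x₂ :+ (x₁ :+ x₂) :* x₃ :+ (l :+ l) :* (y₁ :- l :* x₁)) :* (x₂ :- x₁)) ,
        (lit (+ 1) , (y₁ :* y₁ := x₁ :* (x₁ :+ p) :* (x₁ :+ q))) ∷
        (:- lit (+ 1) , (y₂ :* y₂ := x₂ :* (x₂ :+ p) :* (x₂ :+ q))) ∷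
        (:- (y₂ :+ y₁ :+ l :* (x₂ :- x₁)) , ((x₂ :- x₁) :* l := y₂ :- y₁)) ∷
        (:- ((x₁ :+ x₂) :* (x₂ :- x₁)) , (x₁ :+ x₂ :+ x₃ :+ p :+ q := l :* l)) ∷ [] }) (o₁ , o₂ , s , e₁) refl)

  -- For a double root the slope condition is the vanishing of the derivative of the cubic, which
  -- combined with the sum of the roots is already the middle relation of Vieta.
  tangent-line : ∀ {x y x₃ l} → OnE x y → (1# + 1#) * y * l ≡ (1# + 1# + 1#) * x * x + (1# + 1#) * (p + q) * x + p * q →
    x + x + x₃ + p + q ≡ l * l → Line x x x₃ l (y - l * x)
  tangent-line {x} {y} {x₃} {l} o s e₁ = line e₁ e₂ (line-e₃ o y≡ e₁ e₂)
    where
    y≡ : y ≡ l * x + (y - l * x)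
    y≡ = ring (x ∷ y ∷ l ∷ []) (λ { (x ∷ y ∷ l ∷ []) → y := l :* x :+ (y :- l :* x) }) refl
    e₂ : p * q ≡ x * x + (x + x) * x₃ + (l + l) * (y - l * x)
    e₂ = combine (x ∷ y ∷ x₃ ∷ l ∷ p ∷ q ∷ []) (λ { (x ∷ y ∷ x₃ ∷ l ∷ p ∷ q ∷ []) →
      (p :* q := x :* x :+ (x :+ x) :* x₃ :+ (l :+ l) :* (y :- l :* x)) ,
      (:- lit (+ 1) , ((lit (+ 1) :+ lit (+ 1)) :* y :* l :=
        (lit (+ 1) :+ lit (+ 1) :+ lit (+ 1)) :* x :* x :+ (lit (+ 1) :+ lit (+ 1)) :* (p :+ q) :* x :+ p :* q)) ∷
      (:- (x :+ x) , (x :+ x :+ x₃ :+ p :+ q := l :* l)) ∷ [] }) (s , e₁) refl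

-- Halving points and the descent map

module Halving (F : ≡-Field) (p q : ≡-Field.Carrier F)
  (pq-nonsquare : ∀ x → ≡-Field._*_ F (≡-Field._*_ F p q) (≡-Field._*_ F x x) ≢ ≡-Field.1# F) where

  open ≡-Field F
  open Solver ≡-commutativeRing
  open FieldProperties F
  open Jacobi F p q pq-nonsquare
  open Projective F p q pq-nonsquare
  open ≡-Reasoning

  private
    𝟙 : ∀ {n} → Expr n
    𝟙 = lit (+ 1)

    normalised : ∀ {T U V p} → T ≢ 0# → V * V ≡ T * T + p * (U * U) → V ÷ T * (V ÷ T) ≡ 1# + p * (U ÷ T * (U ÷ T))
    normalised {T} {U} {V} {p} T≢0 e = combine (V ∷ U ∷ p ∷ T ∷ inv T ∷ [])
      (λ { (V ∷ U ∷ p ∷ T ∷ i ∷ []) → (V :* i :* (V :* i) := 𝟙 :+ p :* (U :* i :* (U :* i))) ,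
         (i :* i , (V :* V := T :* T :+ p :* (U :* U))) ∷ (i :* T :+ 𝟙 , (T :* i := 𝟙)) ∷ [] })
      (e , *-inverseʳ T≢0) refl

  module _ {T U V W : Carrier} (T≢0 : T ≢ 0#) (eᵛ : V * V ≡ T * T + p * (U * U)) (eʷ : W * W ≡ T * T + q * (U * U)) where
    point : J
    point = pt (U ÷ T) (V ÷ T) (W ÷ T) (normalised T≢0 eᵛ) (normalised T≢0 eʷ)

    point-coordinates : Coordinates point T U V W
    point-coordinates = coordinates T≢0 (÷-* U T≢0) (÷-* V T≢0) (÷-* W T≢0)

  affine-coordinates : ∀ P → Coordinates P 1# (u P) (v P) (w P)
  affine-coordinates P = coordinates 1≢0 (*-identityʳ _) (*-identityʳ _) (*-identityʳ _)

  δ : J → Carrier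
  δ P = (1# + v P) * (1# + w P)

  -- The halves are found by solving (1 + v) D = 2v′², (1 + w) D = 2w′², (v + w) D = 2v′²w′²,
  -- which hold for (u , v , w) = 2 (u′ , v′ , w′).
  halve : ∀ P r s → r ≢ 0# → r * r ≡ δ P → s * s ≡ (1# + w P) * (v P + w P) → ∃ λ R → R ⊕ R ≡ P
  halve P r s r≢0 er es = R , coordinates-unique (⊕-coordinates R-coordinates R-coordinates) (affine-coordinates P)
      (solve-half (λ { (r ∷ s ∷ v ∷ w ∷ u ∷ p ∷ q ∷ []) → let T = r :* (𝟙 :+ w) ; U = u :* (𝟙 :+ w) ; V = s :* r ; W = s :* (𝟙 :+ w) in
        (U :* T :* (V :* W) :+ U :* T :* (V :* W)) :* 𝟙 := u :* (T :* T :* (T :* T) :- p :* q :* (U :* U :* (U :* U))) }) refl)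
      (solve-half (λ { (r ∷ s ∷ v ∷ w ∷ u ∷ p ∷ q ∷ []) → let T = r :* (𝟙 :+ w) ; U = u :* (𝟙 :+ w) ; V = s :* r ; W = s :* (𝟙 :+ w) in
        (T :* V :* (T :* V) :+ p :* (U :* W :* (U :* W))) :* 𝟙 := v :* (T :* T :* (T :* T) :- p :* q :* (U :* U :* (U :* U))) }) refl)
      (solve-half (λ { (r ∷ s ∷ v ∷ w ∷ u ∷ p ∷ q ∷ []) → let T = r :* (𝟙 :+ w) ; U = u :* (𝟙 :+ w) ; V = s :* r ; W = s :* (𝟙 :+ w) in
        (T :* W :* (T :* W) :+ q :* (U :* V :* (U :* V))) :* 𝟙 := w :* (T :* T :* (T :* T) :- p :* q :* (U :* U :* (U :* U))) }) refl)
    where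
    half-rules : Rules 7
    half-rules =
      square (λ { (s ∷ v ∷ w ∷ u ∷ p ∷ q ∷ []) → (𝟙 :+ v) :* (𝟙 :+ w) })
      (square (λ { (v ∷ w ∷ u ∷ p ∷ q ∷ []) → (𝟙 :+ w) :* (v :+ w) })
      (square (λ { (w ∷ u ∷ p ∷ q ∷ []) → 𝟙 :+ p :* (u :* u) })
      (square (λ { (u ∷ p ∷ q ∷ []) → 𝟙 :+ q :* (u :* u) })
      (free (free (free []))))))
    solve-half : (g : Vec (Expr 7) 7 → Equation 7) → checks half-rules (g vars , []) ≡ true →
      Holds (g vars) (r ∷ s ∷ v P ∷ w P ∷ u P ∷ p ∷ q ∷ [])
    solve-half g = solveGoal _ half-rules (er , es , v² P , w² P , tt) (g vars , []) tt
    1+w≢0 : 1# + w P ≢ 0#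
    1+w≢0 = *-nonzeroʳ (subst (_≢ 0#) er (*-nonzero r≢0 r≢0))
    eᵛ : (s * r) * (s * r) ≡ (r * (1# + w P)) * (r * (1# + w P)) + p * ((u P * (1# + w P)) * (u P * (1# + w P)))
    eᵛ = solve-half (λ { (r ∷ s ∷ v ∷ w ∷ u ∷ p ∷ q ∷ []) →
      (s :* r) :* (s :* r) := (r :* (𝟙 :+ w)) :* (r :* (𝟙 :+ w)) :+ p :* ((u :* (𝟙 :+ w)) :* (u :* (𝟙 :+ w))) }) refl
    eʷ : (s * (1# + w P)) * (s * (1# + w P)) ≡ (r * (1# + w P)) * (r * (1# + w P)) + q * ((u P * (1# + w P)) * (u P * (1# + w P)))
    eʷ = solve-half (λ { (r ∷ s ∷ v ∷ w ∷ u ∷ p ∷ q ∷ []) →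
      (s :* (𝟙 :+ w)) :* (s :* (𝟙 :+ w)) := (r :* (𝟙 :+ w)) :* (r :* (𝟙 :+ w)) :+ q :* ((u :* (𝟙 :+ w)) :* (u :* (𝟙 :+ w))) }) refl
    R : J
    R = point (*-nonzero r≢0 1+w≢0) eᵛ eʷ
    R-coordinates : Coordinates R (r * (1# + w P)) (u P * (1# + w P)) (s * r) (s * (1# + w P))
    R-coordinates = point-coordinates (*-nonzero r≢0 1+w≢0) eᵛ eʷ

  2δ-root : J → J → Carrier
  2δ-root P Q =
    (1# + v₁) * (1# + w₁) * (1# + v₂) * (1# + w₂)
    + u₁ * u₂ * (p * ((1# + w₁) * (1# + w₂)) + q * ((1# + v₁) * (1# + v₂)))
    + p * q * (u₁ * u₂) * (u₁ * u₁ * ((1# + v₂) * (1# + w₂)) + u₂ * u₂ * ((1# + v₁) * (1# + w₁)))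
    - p * q * (u₁ * u₁ * (u₂ * u₂)) * (1# + v₁ + w₁ + v₂ + w₂ + v₁ * w₂ + w₁ * v₂)
    where
    u₁ = u P ; v₁ = v P ; w₁ = w P ; u₂ = u Q ; v₂ = v Q ; w₂ = w Q

  -- On the elliptic curve δ is the abscissa up to squares, and a square root of the product of
  -- the abscissas of three collinear points is the intercept of their line.
  δ-⊕ : ∀ P Q → 2δ-root P Q * 2δ-root P Q ≡ ((D P Q + D P Q) * (D P Q + D P Q)) * (δ (P ⊕ Q) * (δ P * δ Q))
  δ-⊕ P Q = begin
    2δ-root P Q * 2δ-root P Q
      ≡⟨ solve₂ P Q (λ { (v₁ ∷ w₁ ∷ v₂ ∷ w₂ ∷ u₁ ∷ u₂ ∷ p ∷ q ∷ []) →
         let S = (𝟙 :+ v₁) :* (𝟙 :+ w₁) :* (𝟙 :+ v₂) :* (𝟙 :+ w₂)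
                 :+ u₁ :* u₂ :* (p :* ((𝟙 :+ w₁) :* (𝟙 :+ w₂)) :+ q :* ((𝟙 :+ v₁) :* (𝟙 :+ v₂)))
                 :+ p :* q :* (u₁ :* u₂) :* (u₁ :* u₁ :* ((𝟙 :+ v₂) :* (𝟙 :+ w₂)) :+ u₂ :* u₂ :* ((𝟙 :+ v₁) :* (𝟙 :+ w₁)))
                 :- p :* q :* (u₁ :* u₁ :* (u₂ :* u₂)) :* (𝟙 :+ v₁ :+ w₁ :+ v₂ :+ w₂ :+ v₁ :* w₂ :+ w₁ :* v₂)
             D = 𝟙 :- p :* q :* (u₁ :* u₂ :* (u₁ :* u₂))
         in S :* S := lit (+ 4) :* ((D :+ (v₁ :* v₂ :+ p :* (u₁ :* w₁ :* (u₂ :* w₂)))) :* (D :+ (w₁ :* w₂ :+ q :* (u₁ :* v₁ :* (u₂ :* v₂))))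
                      :* ((𝟙 :+ v₁) :* (𝟙 :+ w₁) :* ((𝟙 :+ v₂) :* (𝟙 :+ w₂)))) }) refl ⟩
    ι (+ 4) * ((D P Q + Nᵛ P Q) * (D P Q + Nʷ P Q) * (δ P * δ Q))
      ≡⟨ cong₂ (λ a b → ι (+ 4) * ((D P Q + a) * (D P Q + b) * (δ P * δ Q))) (sym (v-⊕ P Q)) (sym (w-⊕ P Q)) ⟩
    ι (+ 4) * ((D P Q + v (P ⊕ Q) * D P Q) * (D P Q + w (P ⊕ Q) * D P Q) * (δ P * δ Q))
      ≡⟨ ring (D P Q ∷ v (P ⊕ Q) ∷ w (P ⊕ Q) ∷ δ P ∷ δ Q ∷ []) (λ { (D ∷ v ∷ w ∷ a ∷ b ∷ []) →
         lit (+ 4) :* ((D :+ v :* D) :* (D :+ w :* D) :* (a :* b)) := ((D :+ D) :* (D :+ D)) :* ((𝟙 :+ v) :* (𝟙 :+ w) :* (a :* b)) }) refl ⟩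
    ((D P Q + D P Q) * (D P Q + D P Q)) * (δ (P ⊕ Q) * (δ P * δ Q)) ∎

  -- By `δ-⊕` the map `δ` is multiplicative modulo squares, so equal classes `k` cancel in the sum.
  δ-⊕-square : 1# + 1# ≢ 0# → ∀ P Q {a b k} → a ≢ 0# → b ≢ 0# → k ≢ 0# → δ P ≡ k * (a * a) → δ Q ≡ k * (b * b) →
    ∃ λ r → r * r ≡ δ (P ⊕ Q)
  δ-⊕-square 2≢0 P Q {a} {b} {k} a≢0 b≢0 k≢0 eP eQ = 2δ-root P Q ÷ z ,
    *-cancelʳ (z * z) (*-nonzero z≢0 z≢0) (begin
      2δ-root P Q ÷ z * (2δ-root P Q ÷ z) * (z * z)
        ≡⟨ ring (2δ-root P Q ÷ z ∷ z ∷ []) (λ { (y ∷ z ∷ []) → y :* y :* (z :* z) := y :* z :* (y :* z) }) refl ⟩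
      2δ-root P Q ÷ z * z * (2δ-root P Q ÷ z * z)
        ≡⟨ cong₂ _*_ (÷-* _ z≢0) (÷-* _ z≢0) ⟩
      2δ-root P Q * 2δ-root P Q
        ≡⟨ trans (δ-⊕ P Q) (cong₂ (λ x y → ((d + d) * (d + d)) * (δ (P ⊕ Q) * (x * y))) eP eQ) ⟩
      ((d + d) * (d + d)) * (δ (P ⊕ Q) * (k * (a * a) * (k * (b * b))))
        ≡⟨ ring (d ∷ δ (P ⊕ Q) ∷ k ∷ a ∷ b ∷ []) (λ { (d ∷ e ∷ k ∷ a ∷ b ∷ []) →
           ((d :+ d) :* (d :+ d)) :* (e :* (k :* (a :* a) :* (k :* (b :* b)))) := e :* ((𝟙 :+ 𝟙) :* d :* (k :* (a :* b)) :* ((𝟙 :+ 𝟙) :* d :* (k :* (a :* b)))) }) refl ⟩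
      δ (P ⊕ Q) * (z * z) ∎)
    where
    d = D P Q
    z = (1# + 1#) * d * (k * (a * b))
    z≢0 : z ≢ 0#
    z≢0 = *-nonzero (*-nonzero 2≢0 (D≢0 P Q)) (*-nonzero k≢0 (*-nonzero a≢0 b≢0))

  sign : ∀ {x} → x * x ≡ 1# → x ≡ 1# ⊎ x ≡ - 1#
  sign {x} e with *-zero-split (x - 1#) (x + 1#) (combine (x ∷ []) (λ { (x ∷ []) → ((x :- 𝟙) :* (x :+ 𝟙) := lit (+ 0)) , (𝟙 , (x :* x := 𝟙)) ∷ [] }) e refl)
  ... | inj₁ h = inj₁ (x-y≡0⇒x≡y h)
  ... | inj₂ h = inj₂ (combine (x ∷ []) (λ { (x ∷ []) → (x := :- 𝟙) , (𝟙 , (x :+ 𝟙 := lit (+ 0))) ∷ [] }) h refl)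

  module _ {τ : J} (uτ : u τ ≡ 0#) where
    private
      at-torsion : ∀ k x → x ≡ 1# + k * (u τ * u τ) → x ≡ 1#
      at-torsion k x e = combine (x ∷ k ∷ u τ ∷ []) (λ { (x ∷ k ∷ u ∷ []) → (x := 𝟙) ,
        (𝟙 , (x := 𝟙 :+ k :* (u :* u))) ∷ (k :* u , (u := lit (+ 0))) ∷ [] }) (e , uτ) refl

    torsion-v² : v τ * v τ ≡ 1#
    torsion-v² = at-torsion p _ (v² τ)

    torsion-w² : w τ * w τ ≡ 1#
    torsion-w² = at-torsion q _ (w² τ)

    torsion-v : v τ ≡ 1# ⊎ v τ ≡ - 1#
    torsion-v = sign torsion-v²

    torsion-w : w τ ≡ 1# ⊎ w τ ≡ - 1#
    torsion-w = sign torsion-w²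

    -- With a trivial denominator, translation by `τ` merely multiplies the coordinates by signs.
    D-torsion : ∀ P → D P τ ≡ 1#
    D-torsion P = combine (u P ∷ u τ ∷ p ∷ q ∷ []) (λ { (u ∷ t ∷ p ∷ q ∷ []) → (𝟙 :- p :* q :* (u :* t :* (u :* t)) := 𝟙) ,
      (:- (p :* q :* (u :* u :* t)) , (t := lit (+ 0))) ∷ [] }) uτ refl

    private
      shift : ∀ P {x n m} → x * D P τ ≡ n → n ≡ m → x ≡ m
      shift P e f = trans (sym (*-identityʳ _)) (trans (cong (_ *_) (sym (D-torsion P))) (trans e f))

    u-⊕-torsion : ∀ P → u (P ⊕ τ) ≡ v τ * w τ * u P
    u-⊕-torsion P = shift P (u-⊕ P τ) (combine (u P ∷ v P ∷ w P ∷ u τ ∷ v τ ∷ w τ ∷ [])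
      (λ { (u ∷ v ∷ w ∷ t ∷ a ∷ b ∷ []) → (u :* (a :* b) :+ t :* (v :* w) := a :* b :* u) , (v :* w , (t := lit (+ 0))) ∷ [] }) uτ refl)

    v-⊕-torsion : ∀ P → v (P ⊕ τ) ≡ v τ * v P
    v-⊕-torsion P = shift P (v-⊕ P τ) (combine (u P ∷ v P ∷ w P ∷ u τ ∷ v τ ∷ w τ ∷ p ∷ [])
      (λ { (u ∷ v ∷ w ∷ t ∷ a ∷ b ∷ p ∷ []) → (v :* a :+ p :* (u :* w :* (t :* b)) := a :* v) , (p :* (u :* w :* b) , (t := lit (+ 0))) ∷ [] }) uτ refl)

    w-⊕-torsion : ∀ P → w (P ⊕ τ) ≡ w τ * w P
    w-⊕-torsion P = shift P (w-⊕ P τ) (combine (u P ∷ v P ∷ w P ∷ u τ ∷ v τ ∷ w τ ∷ q ∷ [])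
      (λ { (u ∷ v ∷ w ∷ t ∷ a ∷ b ∷ q ∷ []) → (w :* b :+ q :* (u :* v :* (t :* a)) := b :* w) , (q :* (u :* v :* a) , (t := lit (+ 0))) ∷ [] }) uτ refl)

    torsion-double : τ ⊕ τ ≡ 𝟘
    torsion-double = J-≡ (trans (u-⊕-torsion τ) (trans (cong (_*_ _) uτ) (zeroʳ _)))
      (trans (v-⊕-torsion τ) torsion-v²) (trans (w-⊕-torsion τ) torsion-w²)

  -- The values of δ, up to squares, at the points of order dividing two.
  data Torsion-δ : Carrier → Set where
    δ-1  : Torsion-δ 1#
    δ-pq : Torsion-δ (p * q)
    δ--p : Torsion-δ (- p)
    δ--q : Torsion-δ (- q)

  -- Changing the sign of `v` produces the factor `(1 + v) (1 - v) = - p u²`, changing that of `w`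
  -- the factor `- q u²`; a coordinate whose sign is kept contributes a square.
  δ-torsion : ∀ P {τ} → u τ ≡ 0# → ∃ λ k → ∃ λ z → Torsion-δ k × δ P * δ (P ⊕ τ) ≡ k * (z * z)
  δ-torsion P {τ} uτ = go (torsion-v {τ} uτ) (torsion-w {τ} uτ)
    where
    translate : ∀ {x y z} → v τ ≡ x → w τ ≡ y → δ P * ((1# + x * v P) * (1# + y * w P)) ≡ z → δ P * δ (P ⊕ τ) ≡ z
    translate a b e = trans (cong₂ (λ x y → δ P * ((1# + x) * (1# + y)))
      (trans (v-⊕-torsion {τ} uτ P) (cong (_* v P) a)) (trans (w-⊕-torsion {τ} uτ P) (cong (_* w P) b))) e
    go : v τ ≡ 1# ⊎ v τ ≡ - 1# → w τ ≡ 1# ⊎ w τ ≡ - 1# → ∃ λ k → ∃ λ z → Torsion-δ k × δ P * δ (P ⊕ τ) ≡ k * (z * z)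
    go (inj₁ a) (inj₁ b) = 1# , δ P , δ-1 , translate a b
      (solve₁ P (λ { (v ∷ w ∷ u ∷ p ∷ q ∷ []) → (𝟙 :+ v) :* (𝟙 :+ w) :* ((𝟙 :+ 𝟙 :* v) :* (𝟙 :+ 𝟙 :* w)) :=
        𝟙 :* ((𝟙 :+ v) :* (𝟙 :+ w) :* ((𝟙 :+ v) :* (𝟙 :+ w))) }) refl)
    go (inj₂ a) (inj₂ b) = p * q , u P * u P , δ-pq , translate a b
      (solve₁ P (λ { (v ∷ w ∷ u ∷ p ∷ q ∷ []) → (𝟙 :+ v) :* (𝟙 :+ w) :* ((𝟙 :+ :- 𝟙 :* v) :* (𝟙 :+ :- 𝟙 :* w)) :=
        p :* q :* (u :* u :* (u :* u)) }) refl)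
    go (inj₂ a) (inj₁ b) = - p , u P * (1# + w P) , δ--p , translate a b
      (solve₁ P (λ { (v ∷ w ∷ u ∷ p ∷ q ∷ []) → (𝟙 :+ v) :* (𝟙 :+ w) :* ((𝟙 :+ :- 𝟙 :* v) :* (𝟙 :+ 𝟙 :* w)) :=
        :- p :* (u :* (𝟙 :+ w) :* (u :* (𝟙 :+ w))) }) refl)
    go (inj₁ a) (inj₂ b) = - q , u P * (1# + v P) , δ--q , translate a b
      (solve₁ P (λ { (v ∷ w ∷ u ∷ p ∷ q ∷ []) → (𝟙 :+ v) :* (𝟙 :+ w) :* ((𝟙 :+ 𝟙 :* v) :* (𝟙 :+ :- 𝟙 :* w)) :=
        :- q :* (u :* (𝟙 :+ v) :* (u :* (𝟙 :+ v))) }) refl)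

  -- For the sum of `R` with itself, denominator plus numerator is `2v²` for the second coordinate
  -- and `2w²` for the third.
  δ-double : ∀ R → δ (R ⊕ R) * (D R R * D R R) ≡ (v R * w R + v R * w R) * (v R * w R + v R * w R)
  δ-double R = begin
    δ (R ⊕ R) * (D R R * D R R)
      ≡⟨ ring (v (R ⊕ R) ∷ w (R ⊕ R) ∷ D R R ∷ []) (λ { (v ∷ w ∷ D ∷ []) →
         (𝟙 :+ v) :* (𝟙 :+ w) :* (D :* D) := (D :+ v :* D) :* (D :+ w :* D) }) refl ⟩
    (D R R + v (R ⊕ R) * D R R) * (D R R + w (R ⊕ R) * D R R)
      ≡⟨ cong₂ (λ a b → (D R R + a) * (D R R + b)) (v-⊕ R R) (w-⊕ R R) ⟩
    (D R R + Nᵛ R R) * (D R R + Nʷ R R)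
      ≡⟨ solve₁ R (λ { (v ∷ w ∷ u ∷ p ∷ q ∷ []) → let D = 𝟙 :- p :* q :* (u :* u :* (u :* u)) in
         (D :+ (v :* v :+ p :* (u :* w :* (u :* w)))) :* (D :+ (w :* w :+ q :* (u :* v :* (u :* v)))) :=
         (v :* w :+ v :* w) :* (v :* w :+ v :* w) }) refl ⟩
    (v R * w R + v R * w R) * (v R * w R + v R * w R) ∎

  private
    D-⊖ : ∀ P Q → D P (⊖ Q) ≡ D P Q
    D-⊖ P Q = ring (u P ∷ u Q ∷ p ∷ q ∷ []) (λ { (u ∷ t ∷ p ∷ q ∷ []) →
      𝟙 :- p :* q :* (u :* :- t :* (u :* :- t)) := 𝟙 :- p :* q :* (u :* t :* (u :* t)) }) refl

  w-⊕-sum : ∀ P Q → (w (P ⊕ Q) + w (P ⊕ ⊖ Q)) * D P Q ≡ w P * w Q + w P * w Q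
  w-⊕-sum P Q = begin
    (w (P ⊕ Q) + w (P ⊕ ⊖ Q)) * D P Q
      ≡⟨ distribʳ _ _ _ ⟩
    w (P ⊕ Q) * D P Q + w (P ⊕ ⊖ Q) * D P Q
      ≡⟨ cong₂ _+_ (w-⊕ P Q) (trans (cong (w (P ⊕ ⊖ Q) *_) (sym (D-⊖ P Q))) (w-⊕ P (⊖ Q))) ⟩
    Nʷ P Q + Nʷ P (⊖ Q)
      ≡⟨ solve₂ P Q (λ { (v₁ ∷ w₁ ∷ v₂ ∷ w₂ ∷ u₁ ∷ u₂ ∷ p ∷ q ∷ []) →
         w₁ :* w₂ :+ q :* (u₁ :* v₁ :* (u₂ :* v₂)) :+ (w₁ :* w₂ :+ q :* (u₁ :* v₁ :* (:- u₂ :* v₂))) := w₁ :* w₂ :+ w₁ :* w₂ }) refl ⟩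
    w P * w Q + w P * w Q ∎

  -- The product of the two numerators is divisible by `D`. With `w-⊕-sum` this makes `w (P ± Q)`
  -- the roots of a quadratic with leading coefficient `D` instead of `D²`, which is what gives the
  -- height inequality its exponents.
  w-⊕-product : ∀ P Q → w (P ⊕ Q) * w (P ⊕ ⊖ Q) * D P Q ≡ 1# + q * (u P * u P + u Q * u Q) + p * q * (u P * u Q * (u P * u Q))
  w-⊕-product P Q = *-cancelʳ (D P Q) (D≢0 P Q) (begin
    w (P ⊕ Q) * w (P ⊕ ⊖ Q) * D P Q * D P Q
      ≡⟨ ring (w (P ⊕ Q) ∷ w (P ⊕ ⊖ Q) ∷ D P Q ∷ []) (λ { (a ∷ b ∷ d ∷ []) → a :* b :* d :* d := a :* d :* (b :* d) }) refl ⟩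
    w (P ⊕ Q) * D P Q * (w (P ⊕ ⊖ Q) * D P Q)
      ≡⟨ cong₂ _*_ (w-⊕ P Q) (trans (cong (w (P ⊕ ⊖ Q) *_) (sym (D-⊖ P Q))) (w-⊕ P (⊖ Q))) ⟩
    Nʷ P Q * Nʷ P (⊖ Q)
      ≡⟨ solve₂ P Q (λ { (v₁ ∷ w₁ ∷ v₂ ∷ w₂ ∷ u₁ ∷ u₂ ∷ p ∷ q ∷ []) →
         (w₁ :* w₂ :+ q :* (u₁ :* v₁ :* (u₂ :* v₂))) :* (w₁ :* w₂ :+ q :* (u₁ :* v₁ :* (:- u₂ :* v₂))) :=
         (𝟙 :+ q :* (u₁ :* u₁ :+ u₂ :* u₂) :+ p :* q :* (u₁ :* u₂ :* (u₁ :* u₂))) :* (𝟙 :- p :* q :* (u₁ :* u₂ :* (u₁ :* u₂))) }) refl ⟩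
    (1# + q * (u P * u P + u Q * u Q) + p * q * (u P * u Q * (u P * u Q))) * D P Q ∎)

-- Integer multiples and refinements of pairs in an abelian group

module Multiples {A : Set} {_∙_ : A → A → A} {ε : A} {_⁻¹ : A → A} (isAbelianGroup : IsAbelianGroup _≡_ _∙_ ε _⁻¹) where
  private
    G : AbelianGroup _ _
    G = record { isAbelianGroup = isAbelianGroup }
    M : CommutativeMonoid _ _
    M = AbelianGroup.commutativeMonoid G
    module G = AbelianGroup G
  open import Algebra.Definitions.RawMonoid (CommutativeMonoid.rawMonoid M) public using () renaming (_×_ to _×ⁿ_)
  open import Algebra.Properties.Monoid.Mult (CommutativeMonoid.monoid M) using (×-homo-+)
  open import Algebra.Properties.CommutativeMonoid.Mult M using (×-distrib-+)
  open import Algebra.Properties.AbelianGroup G using (⁻¹-∙-comm; ⁻¹-involutive; ε⁻¹≈ε)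
  open import Algebra.Properties.CommutativeSemigroup (CommutativeMonoid.commutativeSemigroup M) using (interchange)
  open ≡-Reasoning

  infixr 7 _·_

  _·_ : ℤ → A → A
  + n · x = n ×ⁿ x
  -[1+ n ] · x = (suc n ×ⁿ x) ⁻¹

  ·-⊖ : ∀ m n x → (m ℤ.⊖ n) · x ≡ (m ×ⁿ x) ∙ ((n ×ⁿ x) ⁻¹)
  ·-⊖ m zero x = sym (trans (cong ((m ×ⁿ x) ∙_) ε⁻¹≈ε) (G.identityʳ _))
  ·-⊖ zero (suc n) x = sym (G.identityˡ _)
  ·-⊖ (suc m) (suc n) x = begin
    (suc m ℤ.⊖ suc n) · x                            ≡⟨ cong (_· x) (ℤₚ.[1+m]⊖[1+n]≡m⊖n m n) ⟩
    (m ℤ.⊖ n) · x                                    ≡⟨ ·-⊖ m n x ⟩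
    (m ×ⁿ x) ∙ ((n ×ⁿ x) ⁻¹)                         ≡⟨ sym (G.identityˡ _) ⟩
    ε ∙ ((m ×ⁿ x) ∙ ((n ×ⁿ x) ⁻¹))                   ≡⟨ cong (_∙ ((m ×ⁿ x) ∙ ((n ×ⁿ x) ⁻¹))) (sym (G.inverseʳ x)) ⟩
    (x ∙ (x ⁻¹)) ∙ ((m ×ⁿ x) ∙ ((n ×ⁿ x) ⁻¹))        ≡⟨ interchange x (x ⁻¹) (m ×ⁿ x) ((n ×ⁿ x) ⁻¹) ⟩
    (x ∙ (m ×ⁿ x)) ∙ ((x ⁻¹) ∙ ((n ×ⁿ x) ⁻¹))        ≡⟨ cong ((x ∙ (m ×ⁿ x)) ∙_) (⁻¹-∙-comm x (n ×ⁿ x)) ⟩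
    (x ∙ (m ×ⁿ x)) ∙ ((x ∙ (n ×ⁿ x)) ⁻¹)             ∎

  ·-neg : ∀ i x → (ℤ.- i) · x ≡ (i · x) ⁻¹
  ·-neg (+ zero) x = sym ε⁻¹≈ε
  ·-neg (+ suc n) x = refl
  ·-neg -[1+ n ] x = sym (⁻¹-involutive _)

  ·-+ : ∀ i j x → (i ℤ.+ j) · x ≡ (i · x) ∙ (j · x)
  ·-+ (+ m) (+ n) x = ×-homo-+ x m n
  ·-+ (+ m) -[1+ n ] x = ·-⊖ m (suc n) x
  ·-+ -[1+ m ] (+ n) x = trans (·-⊖ n (suc m) x) (G.comm _ _)
  ·-+ -[1+ m ] -[1+ n ] x = begin
    (suc (suc (m ℕ.+ n)) ×ⁿ x) ⁻¹                   ≡⟨ cong (λ k → (suc k ×ⁿ x) ⁻¹) (sym (ℕₚ.+-suc m n)) ⟩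
    ((suc m ℕ.+ suc n) ×ⁿ x) ⁻¹                     ≡⟨ cong _⁻¹ (×-homo-+ x (suc m) (suc n)) ⟩
    ((suc m ×ⁿ x) ∙ (suc n ×ⁿ x)) ⁻¹                ≡⟨ sym (⁻¹-∙-comm _ _) ⟩
    ((suc m ×ⁿ x) ⁻¹) ∙ ((suc n ×ⁿ x) ⁻¹)           ∎

  ·-∙ : ∀ i x y → i · (x ∙ y) ≡ (i · x) ∙ (i · y)
  ·-∙ (+ n) x y = ×-distrib-+ x y n
  ·-∙ -[1+ n ] x y = trans (cong _⁻¹ (×-distrib-+ x y (suc n))) (sym (⁻¹-∙-comm _ _))

  ·-* : ∀ i j x → (i ℤ.* j) · x ≡ i · (j · x)
  ·-* (+ m) j x = go m
    where
    go : ∀ m → (+ m ℤ.* j) · x ≡ m ×ⁿ (j · x)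
    go zero = refl
    go (suc m) = begin
      (+ suc m ℤ.* j) · x              ≡⟨ cong (_· x) (ℤₚ.suc-* (+ m) j) ⟩
      (j ℤ.+ + m ℤ.* j) · x            ≡⟨ ·-+ j (+ m ℤ.* j) x ⟩
      (j · x) ∙ ((+ m ℤ.* j) · x)      ≡⟨ cong ((j · x) ∙_) (go m) ⟩
      (j · x) ∙ (m ×ⁿ (j · x))         ∎
  ·-* -[1+ m ] j x = begin
    (-[1+ m ] ℤ.* j) · x               ≡⟨ cong (_· x) (sym (ℤₚ.neg-distribˡ-* (+ suc m) j)) ⟩
    (ℤ.- (+ suc m ℤ.* j)) · x          ≡⟨ ·-neg (+ suc m ℤ.* j) x ⟩
    ((+ suc m ℤ.* j) · x) ⁻¹           ≡⟨ cong _⁻¹ (·-* (+ suc m) j x) ⟩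
    (suc m ×ⁿ (j · x)) ⁻¹              ∎

  ·-one : ∀ x → + 1 · x ≡ x
  ·-one = G.identityʳ

  ·-two : ∀ x → + 2 · x ≡ x ∙ x
  ·-two x = cong (x ∙_) (G.identityʳ x)

  Independent₂ : A → A → Set
  Independent₂ x y = ∀ m n → (m · x) ∙ (n · y) ≡ ε → m ≡ + 0 × n ≡ + 0

  Span : A → A → A → Set
  Span x y z = ∃ λ m → ∃ λ n → z ≡ (m · x) ∙ (n · y)

  span-left : ∀ x y → Span x y x
  span-left x y = + 1 , + 0 , sym (trans (G.identityʳ _) (·-one x))

  span-right : ∀ x y → Span x y y
  span-right x y = + 0 , + 1 , sym (trans (G.identityˡ _) (·-one y))

  span-∙ : ∀ {x y z w} → Span x y z → Span x y w → Span x y (z ∙ w)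
  span-∙ {x} {y} (m , n , refl) (m′ , n′ , refl) = m ℤ.+ m′ , n ℤ.+ n′ ,
    trans (interchange (m · x) (n · y) (m′ · x) (n′ · y)) (sym (cong₂ _∙_ (·-+ m m′ x) (·-+ n n′ y)))

  span-· : ∀ {x y z} i → Span x y z → Span x y (i · z)
  span-· {x} {y} i (m , n , refl) = i ℤ.* m , i ℤ.* n ,
    trans (·-∙ i (m · x) (n · y)) (sym (cong₂ _∙_ (·-* i m x) (·-* i n y)))

  span-trans : ∀ {x y x′ y′ z} → Span x′ y′ x → Span x′ y′ y → Span x y z → Span x′ y′ z
  span-trans sx sy (m , n , refl) = span-∙ (span-· m sx) (span-· n sy)

  independent-unique : ∀ {x y} a b c d → Independent₂ x y → (a · x) ∙ (b · y) ≡ (c · x) ∙ (d · y) → a ≡ c × b ≡ d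
  independent-unique {x} {y} a b c d ind e = cancel (proj₁ zeros) , cancel (proj₂ zeros)
    where
    difference-zero : ((a ℤ.- c) · x) ∙ ((b ℤ.- d) · y) ≡ ε
    difference-zero = begin
      ((a ℤ.- c) · x) ∙ ((b ℤ.- d) · y)
        ≡⟨ cong₂ _∙_ (trans (·-+ a (ℤ.- c) x) (cong ((a · x) ∙_) (·-neg c x))) (trans (·-+ b (ℤ.- d) y) (cong ((b · y) ∙_) (·-neg d y))) ⟩
      ((a · x) ∙ ((c · x) ⁻¹)) ∙ ((b · y) ∙ ((d · y) ⁻¹))
        ≡⟨ interchange _ _ _ _ ⟩
      ((a · x) ∙ (b · y)) ∙ (((c · x) ⁻¹) ∙ ((d · y) ⁻¹))
        ≡⟨ cong₂ _∙_ e (⁻¹-∙-comm _ _) ⟩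
      ((c · x) ∙ (d · y)) ∙ (((c · x) ∙ (d · y)) ⁻¹)
        ≡⟨ G.inverseʳ _ ⟩
      ε ∎
    zeros = ind (a ℤ.- c) (b ℤ.- d) difference-zero
    cancel : ∀ {i j} → i ℤ.- j ≡ + 0 → i ≡ j
    cancel = ℤₚ.i-j≡0⇒i≡j _ _

  -- The new pair spans the old one with index two.
  data Refines : A → A → A → A → Set where
    left  : ∀ {x y x′} k → x ∙ (k · y) ≡ x′ ∙ x′ → Refines x y x′ y
    right : ∀ {x y y′} → y ≡ y′ ∙ y′ → Refines x y x y′

  refines-span : ∀ {x y x′ y′} → Refines x y x′ y′ → Span x′ y′ x × Span x′ y′ y
  refines-span {x} {y} {x′} (left k e) = (+ 2 , ℤ.- k , sym (begin
      (+ 2 · x′) ∙ ((ℤ.- k) · y)            ≡⟨ cong₂ _∙_ (trans (·-two x′) (sym e)) (·-neg k y) ⟩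
      (x ∙ (k · y)) ∙ ((k · y) ⁻¹)          ≡⟨ G.assoc x (k · y) _ ⟩
      x ∙ ((k · y) ∙ ((k · y) ⁻¹))          ≡⟨ cong (x ∙_) (G.inverseʳ (k · y)) ⟩
      x ∙ ε                                 ≡⟨ G.identityʳ x ⟩
      x                                     ∎)) , span-right x′ y
  refines-span {x} {y} {y′ = y′} (right e) = span-left x y′ ,
    (+ 0 , + 2 , trans e (sym (trans (G.identityˡ _) (·-two y′))))

  private
    double-zero : ∀ n → + 2 ℤ.* n ≡ + 0 → n ≡ + 0
    double-zero n e with ℤₚ.i*j≡0⇒i≡0∨j≡0 (+ 2) e
    ... | inj₂ n≡0 = n≡0

  -- Twice a relation of the new pair is a relation of the old one.
  refines-independent : ∀ {x y x′ y′} → Refines x y x′ y′ → Independent₂ x y → Independent₂ x′ y′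
  refines-independent {x} {y} {x′} (left k e) ind m n h = m≡0 , double-zero n (begin
      + 2 ℤ.* n                       ≡⟨ sym (ℤₚ.+-identityˡ (+ 2 ℤ.* n)) ⟩
      + 0 ℤ.* k ℤ.+ + 2 ℤ.* n         ≡⟨ cong (λ m → m ℤ.* k ℤ.+ + 2 ℤ.* n) (sym m≡0) ⟩
      m ℤ.* k ℤ.+ + 2 ℤ.* n           ≡⟨ proj₂ zeros ⟩
      + 0                             ∎)
    where
    relation : (m · x) ∙ ((m ℤ.* k ℤ.+ + 2 ℤ.* n) · y) ≡ ε
    relation = begin
      (m · x) ∙ ((m ℤ.* k ℤ.+ + 2 ℤ.* n) · y)
        ≡⟨ cong ((m · x) ∙_) (trans (·-+ (m ℤ.* k) (+ 2 ℤ.* n) y) (cong₂ _∙_ (·-* m k y) (trans (·-* (+ 2) n y) (·-two (n · y))))) ⟩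
      (m · x) ∙ ((m · (k · y)) ∙ ((n · y) ∙ (n · y)))
        ≡⟨ sym (G.assoc _ _ _) ⟩
      ((m · x) ∙ (m · (k · y))) ∙ ((n · y) ∙ (n · y))
        ≡⟨ cong (_∙ ((n · y) ∙ (n · y))) (trans (sym (·-∙ m x (k · y))) (trans (cong (m ·_) e) (·-∙ m x′ x′))) ⟩
      ((m · x′) ∙ (m · x′)) ∙ ((n · y) ∙ (n · y))
        ≡⟨ interchange _ _ _ _ ⟩
      ((m · x′) ∙ (n · y)) ∙ ((m · x′) ∙ (n · y))
        ≡⟨ trans (cong₂ _∙_ h h) (G.identityˡ ε) ⟩
      ε ∎
    zeros = ind m (m ℤ.* k ℤ.+ + 2 ℤ.* n) relation
    m≡0 = proj₁ zeros
  refines-independent {x} {y} {y′ = y′} (right e) ind m n h = double-zero m (proj₁ zeros) , proj₂ zeros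
    where
    relation : ((+ 2 ℤ.* m) · x) ∙ (n · y) ≡ ε
    relation = begin
      ((+ 2 ℤ.* m) · x) ∙ (n · y)
        ≡⟨ cong₂ _∙_ (trans (·-* (+ 2) m x) (·-two (m · x))) (trans (cong (n ·_) e) (·-∙ n y′ y′)) ⟩
      ((m · x) ∙ (m · x)) ∙ ((n · y′) ∙ (n · y′))
        ≡⟨ interchange _ _ _ _ ⟩
      ((m · x) ∙ (n · y′)) ∙ ((m · x) ∙ (n · y′))
        ≡⟨ trans (cong₂ _∙_ h h) (G.identityˡ ε) ⟩
      ε ∎
    zeros = ind (+ 2 ℤ.* m) n relation

  -- If the halved element were in the old span, doubling and comparing coefficients would make `1`
  -- even.
  refines-proper : ∀ {x y x′ y′} → Refines x y x′ y′ → Independent₂ x y → Span x y x′ → Span x y y′ → ⊥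
  refines-proper {x} {y} {x′} (left k e) ind (m , n , eq) _ = odd≢even m (proj₁ (independent-unique (+ 1) k (m ℤ.+ m) (n ℤ.+ n) ind (begin
      (+ 1 · x) ∙ (k · y)                     ≡⟨ cong (_∙ (k · y)) (·-one x) ⟩
      x ∙ (k · y)                             ≡⟨ trans e (cong₂ _∙_ eq eq) ⟩
      ((m · x) ∙ (n · y)) ∙ ((m · x) ∙ (n · y)) ≡⟨ trans (interchange _ _ _ _) (sym (cong₂ _∙_ (·-+ m m x) (·-+ n n y))) ⟩
      ((m ℤ.+ m) · x) ∙ ((n ℤ.+ n) · y)       ∎)))
    where
    odd≢even : ∀ m → + 1 ≢ m ℤ.+ m
    odd≢even (+ suc m) h = ℕₚ.0≢1+n (trans (ℕₚ.suc-injective (ℤₚ.+-injective h)) (ℕₚ.+-suc m m))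
  refines-proper {x} {y} {y′ = y′} (right e) ind _ (m , n , eq) = odd≢even n (proj₂ (independent-unique (+ 0) (+ 1) (m ℤ.+ m) (n ℤ.+ n) ind (begin
      (+ 0 · x) ∙ (+ 1 · y)                   ≡⟨ trans (G.identityˡ _) (·-one y) ⟩
      y                                       ≡⟨ trans e (cong₂ _∙_ eq eq) ⟩
      ((m · x) ∙ (n · y)) ∙ ((m · x) ∙ (n · y)) ≡⟨ trans (interchange _ _ _ _) (sym (cong₂ _∙_ (·-+ m m x) (·-+ n n y))) ⟩
      ((m ℤ.+ m) · x) ∙ ((n ℤ.+ n) · y)       ∎)))
    where
    odd≢even : ∀ m → + 1 ≢ m ℤ.+ m
    odd≢even (+ suc m) h = ℕₚ.0≢1+n (trans (ℕₚ.suc-injective (ℤₚ.+-injective h)) (ℕₚ.+-suc m m))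

-- Coprime factorisations, two as a quadratic nonresidue, and the descent

module Arithmetic where
  open import Data.Nat using (_+_; _*_; _∸_; _≤_; _<_; z≤n; s≤s)
  open ≡-Reasoning

  coprime-∣ : ∀ {d m n} → d ∣ m → Coprime m n → Coprime d n
  coprime-∣ d∣m c (e∣d , e∣n) = c (∣-trans e∣d d∣m , e∣n)

  coprime-* : ∀ {m n o} → Coprime m n → Coprime m o → Coprime m (n * o)
  coprime-* c c′ (d∣m , d∣no) = c′ (d∣m , coprime-divisor (coprime-∣ d∣m c) d∣no)

  coprime-squares : ∀ {m n} → Coprime m n → Coprime (m * m) (n * n)
  coprime-squares c = Coprimality.sym (coprime-* c′ c′)
    where c′ = Coprimality.sym (coprime-* c c)

  prime-coprime : ∀ {p n} → Prime p → ¬ p ∣ n → Coprime p n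
  prime-coprime pp p∤n (d∣p , d∣n) with prime⇒irreducible pp d∣p
  ... | inj₁ d≡1 = d≡1
  ... | inj₂ refl = ⊥-elim (p∤n d∣n)

  prime-∣-square : ∀ {p} n → Prime p → p ∣ n * n → p ∣ n
  prime-∣-square n pp h with euclidsLemma n n pp h
  ... | inj₁ a = a
  ... | inj₂ a = a

  -- The root is `d = gcd x z`. As `x` divides `x z` and `z²`, it divides `d z`, hence also `d²`;
  -- conversely `d²` divides `x²` and `x y`, hence `x` by coprimality.
  coprime-square-factor : ∀ {x y z} → Coprime x y → x * y ≡ z * z → ∃ λ r → x ≡ r * r
  coprime-square-factor {x} {y} {z} c e = d , ∣-antisym x∣dd dd∣x
    where
    d = gcd x z
    d∣x = gcd[m,n]∣m x z
    d∣z = gcd[m,n]∣n x z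
    x∣dz : x ∣ d * z
    x∣dz = subst (x ∣_) (trans (sym (c*gcd[m,n]≡gcd[cm,cn] z x z)) (ℕₚ.*-comm z d))
      (gcd-greatest (n∣m*n z) (subst (x ∣_) e (m∣m*n y)))
    x∣dd : x ∣ d * d
    x∣dd = subst (x ∣_) (sym (c*gcd[m,n]≡gcd[cm,cn] d x z)) (gcd-greatest (n∣m*n d) x∣dz)
    dd∣x : d * d ∣ x
    dd∣x = coprime-factors c (*-pres-∣ d∣x d∣x ,
      subst (d * d ∣_) (trans (sym e) (ℕₚ.*-comm x y)) (*-pres-∣ d∣z d∣z))

  coprime-prime-split : ∀ {ℓ x y z} → Prime ℓ → Coprime x y → x * y ≡ ℓ * (z * z) →
    ∃ λ r → ∃ λ s → (x ≡ ℓ * (r * r) × y ≡ s * s) ⊎ (x ≡ r * r × y ≡ ℓ * (s * s))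
  coprime-prime-split {ℓ} {x} {y} {z} pℓ c e with euclidsLemma x y pℓ (subst (ℓ ∣_) (sym e) (m∣m*n (z * z)))
  ... | inj₁ (divides k refl) =
    let instance _ = prime⇒nonZero pℓ
        ky≡zz = ℕₚ.*-cancelˡ-≡ (k * y) (z * z) ℓ (trans (assoc′ ℓ k y) e)
        c′ = coprime-∣ (m∣m*n ℓ) c
        (r , k≡rr) = coprime-square-factor {z = z} c′ ky≡zz
        (s , y≡ss) = coprime-square-factor {z = z} (Coprimality.sym c′) (trans (ℕₚ.*-comm y k) ky≡zz)
    in r , s , inj₁ (trans (ℕₚ.*-comm k ℓ) (cong (ℓ *_) k≡rr) , y≡ss)
    where
    assoc′ : ∀ ℓ k y → ℓ * (k * y) ≡ k * ℓ * y
    assoc′ = solve-∀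
  ... | inj₂ (divides k refl) =
    let instance _ = prime⇒nonZero pℓ
        xk≡zz = ℕₚ.*-cancelˡ-≡ (x * k) (z * z) ℓ (trans (assoc′ ℓ x k) e)
        c′ = Coprimality.sym (coprime-∣ (m∣m*n ℓ) (Coprimality.sym c))
        (r , x≡rr) = coprime-square-factor {z = z} c′ xk≡zz
        (s , k≡ss) = coprime-square-factor {z = z} (Coprimality.sym c′) (trans (ℕₚ.*-comm k x) xk≡zz)
    in r , s , inj₂ (x≡rr , trans (ℕₚ.*-comm k ℓ) (cong (ℓ *_) k≡ss))
    where
    assoc′ : ∀ ℓ x k → ℓ * (x * k) ≡ x * (k * ℓ)
    assoc′ = solve-∀

  -- Coprimality reduces the divisibility to `d² ∣ ℓ`, and primes are squarefree.
  square-divisor-trivial : ∀ {ℓ d n} → Prime ℓ → Coprime d n → d * d ∣ ℓ * (n * n) → d ≡ 1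
  square-divisor-trivial {ℓ} {d} {n} pℓ c h with prime⇒irreducible pℓ (∣-trans (m∣m*n d) dd∣ℓ)
    where
    dd∣ℓ : d * d ∣ ℓ
    dd∣ℓ = coprime-divisor (coprime-squares c) (subst (d * d ∣_) (ℕₚ.*-comm ℓ (n * n)) h)
  ... | inj₁ d≡1 = d≡1
  ... | inj₂ refl = ∣1⇒≡1 (∣.*-cancelˡ-∣ d (subst (d * d ∣_) (sym (ℕₚ.*-identityʳ d)) dd∣d))
    where
    instance _ = prime⇒nonZero pℓ
    dd∣d : d * d ∣ d
    dd∣d = coprime-divisor (coprime-squares c) (subst (d * d ∣_) (ℕₚ.*-comm d (n * n)) h)

  private
    residue-cases : ∀ {ℓ} {A : Set ℓ} r → r < 8 → (r ≡ 0 → A) → (r ≡ 1 → A) → (r ≡ 2 → A) → (r ≡ 3 → A) →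
      (r ≡ 4 → A) → (r ≡ 5 → A) → (r ≡ 6 → A) → (r ≡ 7 → A) → A
    residue-cases 0 _ a _ _ _ _ _ _ _ = a refl
    residue-cases 1 _ _ a _ _ _ _ _ _ = a refl
    residue-cases 2 _ _ _ a _ _ _ _ _ = a refl
    residue-cases 3 _ _ _ _ a _ _ _ _ = a refl
    residue-cases 4 _ _ _ _ _ a _ _ _ = a refl
    residue-cases 5 _ _ _ _ _ _ a _ _ = a refl
    residue-cases 6 _ _ _ _ _ _ _ a _ = a refl
    residue-cases 7 _ _ _ _ _ _ _ _ a = a refl
    residue-cases (suc (suc (suc (suc (suc (suc (suc (suc r)))))))) (s≤s (s≤s (s≤s (s≤s (s≤s (s≤s (s≤s (s≤s ())))))))) _ _ _ _ _ _ _ _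

  *-mod : ∀ m n {r s} → m % 8 ≡ r → n % 8 ≡ s → (m * n) % 8 ≡ (r * s) % 8
  *-mod m n e f = trans (%-distribˡ-* m n 8) (cong₂ (λ r s → (r * s) % 8) e f)

  +-mod : ∀ m n {r s} → m % 8 ≡ r → n % 8 ≡ s → (m + n) % 8 ≡ (r + s) % 8
  +-mod m n e f = trans (%-distribˡ-+ m n 8) (cong₂ (λ r s → (r + s) % 8) e f)

  data SquareMod8 (n : ℕ) : Set where
    odd  : (n * n) % 8 ≡ 1 → SquareMod8 n
    zero : 2 ∣ n → (n * n) % 8 ≡ 0 → SquareMod8 n
    four : 2 ∣ n → (n * n) % 8 ≡ 4 → SquareMod8 n

  squareMod8 : ∀ n → SquareMod8 n
  squareMod8 n = residue-cases (n % 8) (m%n<n n 8)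
    (λ e → zero (even 0 e) (*-mod n n e e)) (λ e → odd (*-mod n n e e))
    (λ e → four (even 1 e) (*-mod n n e e)) (λ e → odd (*-mod n n e e))
    (λ e → zero (even 2 e) (*-mod n n e e)) (λ e → odd (*-mod n n e e))
    (λ e → four (even 3 e) (*-mod n n e e)) (λ e → odd (*-mod n n e e))
    where
    even : ∀ k → n % 8 ≡ k * 2 → 2 ∣ n
    even k e = divides (k + n / 8 * 4) (trans (m≡m%n+[m/n]*n n 8) (trans (cong (_+ n / 8 * 8) e) (distrib k (n / 8))))
      where
      distrib : ∀ k m → k * 2 + m * 8 ≡ (k + m * 4) * 2
      distrib = solve-∀

  -- Gauss's descent: if n ≡ ±3 (mod 8) divides t² − 2, then t may be taken odd and less than n,
  -- and the cofactor is again ±3 modulo 8 and smaller than n.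
  2-nonsquare-mod : ∀ n → (n % 8 ≡ 3 ⊎ n % 8 ≡ 5) → ∀ t k l → t * t + k * n ≡ 2 + l * n → ⊥
  2-nonsquare-mod n h t k l e = go n (<-wellFounded n) h t (k , l , e)
    where
    Root : ℕ → ℕ → Set
    Root n t = ∃ λ k → ∃ λ l → t * t + k * n ≡ 2 + l * n

    -- Here `f n ≡ 7`, and modulo 8 the only such products with a factor 3 or 5 are `5 · 3` and
    -- `3 · 5`.
    cofactor-mod : ∀ n f → (n % 8 ≡ 3 ⊎ n % 8 ≡ 5) → (2 + f * n) % 8 ≡ 1 → f % 8 ≡ 3 ⊎ f % 8 ≡ 5
    cofactor-mod n f h e = residue-cases (f % 8) (m%n<n f 8)
      (bad h (λ ()) (λ ())) (bad h (λ ()) (λ ())) (bad h (λ ()) (λ ())) inj₁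
      (bad h (λ ()) (λ ())) inj₂ (bad h (λ ()) (λ ())) (bad h (λ ()) (λ ()))
      where
      value : ∀ {r s} → f % 8 ≡ r → n % 8 ≡ s → (2 + (r * s) % 8) % 8 ≡ 1
      value {r} {s} a b = trans (sym (trans (%-distribˡ-+ 2 (f * n) 8) (cong (λ z → (2 + z) % 8) (*-mod f n a b)))) e
      bad : (n % 8 ≡ 3 ⊎ n % 8 ≡ 5) → ∀ {r} {A : Set} → (2 + (r * 3) % 8) % 8 ≢ 1 → (2 + (r * 5) % 8) % 8 ≢ 1 → f % 8 ≡ r → A
      bad (inj₁ x) b _ y = ⊥-elim (b (value y x))
      bad (inj₂ x) _ b y = ⊥-elim (b (value y x))

    3≤ : ∀ n → (n % 8 ≡ 3 ⊎ n % 8 ≡ 5) → 3 ≤ n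
    3≤ n (inj₁ e) = subst (_≤ n) e (m%n≤m n 8)
    3≤ n (inj₂ e) = ℕₚ.≤-trans (s≤s (s≤s (s≤s z≤n))) (subst (_≤ n) e (m%n≤m n 8))

    odd-of : ∀ n → (n % 8 ≡ 3 ⊎ n % 8 ≡ 5) → ¬ 2 ∣ n
    odd-of n (inj₁ e) d = from-no (2 ∣.∣? 3) (subst (2 ∣_) e (∣.%-presˡ-∣ d (divides 4 refl)))
    odd-of n (inj₂ e) d = from-no (2 ∣.∣? 5) (subst (2 ∣_) e (∣.%-presˡ-∣ d (divides 4 refl)))

    odd-square : ∀ n → ¬ 2 ∣ n → (n * n) % 8 ≡ 1
    odd-square n h = go (squareMod8 n)
      where
      go : SquareMod8 n → (n * n) % 8 ≡ 1
      go (odd e) = e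
      go (zero d _) = ⊥-elim (h d)
      go (four d _) = ⊥-elim (h d)

    -- Since `n` is odd, one of `t % n` and `n ∸ t % n` is odd, and both are roots.
    small-odd : ∀ n .{{_ : ℕ.NonZero n}} → ¬ 2 ∣ n → ∀ t → Root n t → ∃ λ s → s ≤ n × ¬ 2 ∣ s × Root n s
    small-odd n n-odd t (k , l , e) with 2 ∣.∣? (t % n)
    ... | no h = t % n , m%n≤n t n , h ,
      t % n * (t / n) + t % n * (t / n) + t / n * (t / n) * n + k , l , reduced
      where
      reduced : t % n * (t % n) + (t % n * (t / n) + t % n * (t / n) + t / n * (t / n) * n + k) * n ≡ 2 + l * n
      reduced = trans (expand (t % n) (t / n) n k) (trans (cong (λ x → x * x + k * n) (sym (m≡m%n+[m/n]*n t n))) e)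
        where
        expand : ∀ r m n k → r * r + (r * m + r * m + m * m * n + k) * n ≡ (r + m * n) * (r + m * n) + k * n
        expand = solve-∀
    ... | yes h = s , ℕₚ.m∸n≤m n r , s-odd , r + K , s + l , reflected
      where
      r = t % n
      s = n ∸ r
      r+s≡n : r + s ≡ n
      r+s≡n = ℕₚ.m+[n∸m]≡n (m%n≤n t n)
      s-odd : ¬ 2 ∣ s
      s-odd d = n-odd (subst (2 ∣_) r+s≡n (∣m∣n⇒∣m+n h d))
      K = r * (t / n) + r * (t / n) + t / n * (t / n) * n + k
      reflected : s * s + (r + K) * n ≡ 2 + (s + l) * n
      reflected = begin
        s * s + (r + K) * n                ≡⟨ cong (λ n → s * s + (r + K) * n) (sym r+s≡n) ⟩
        s * s + (r + K) * (r + s)          ≡⟨ swap r s K ⟩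
        s * (r + s) + (r * r + K * (r + s)) ≡⟨ cong (λ n → s * n + (r * r + K * n)) r+s≡n ⟩
        s * n + (r * r + K * n)            ≡⟨ cong (_+_ (s * n)) (trans (expand r (t / n) n k) (trans (cong (λ x → x * x + k * n) (sym (m≡m%n+[m/n]*n t n))) e)) ⟩
        s * n + (2 + l * n)                ≡⟨ collect s l n ⟩
        2 + (s + l) * n                    ∎
        where
        expand : ∀ r m n k → r * r + (r * m + r * m + m * m * n + k) * n ≡ (r + m * n) * (r + m * n) + k * n
        expand = solve-∀
        swap : ∀ r s K → s * s + (r + K) * (r + s) ≡ s * (r + s) + (r * r + K * (r + s))
        swap = solve-∀
        collect : ∀ s l n → s * n + (2 + l * n) ≡ 2 + (s + l) * n
        collect = solve-∀

    -- The difference `s² - 2` has to be nonnegative: `s = 0` is not odd, `s = 1` would make `n`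
    -- divide 1, and larger `s` have `s² > 2`.
    cofactor : ∀ n s → 3 ≤ n → ¬ 2 ∣ s → Root n s → ∃ λ f → s * s ≡ 2 + f * n
    cofactor n 0 _ h _ = ⊥-elim (h (divides 0 refl))
    cofactor n 1 n≥3 _ (k , l , e) = ⊥-elim (ℕₚ.<⇒≱ (ℕₚ.<-≤-trans (s≤s (s≤s z≤n)) n≥3)
      (∣.∣⇒≤ (∣m+n∣m⇒∣n (subst (n ∣_) (trans (ℕₚ.suc-injective e) (ℕₚ.+-comm 1 (l * n))) (n∣m*n k)) (n∣m*n l))))
    cofactor n (suc (suc s)) n≥3 _ (k , l , e) with ℕₚ.≤-total k l
    ... | inj₁ k≤l = l ∸ k , ℕₚ.+-cancelʳ-≡ (k * n) _ _ (begin
        suc (suc s) * suc (suc s) + k * n  ≡⟨ e ⟩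
        2 + l * n                          ≡⟨ cong (λ x → 2 + x * n) (sym (ℕₚ.m∸n+n≡m k≤l)) ⟩
        2 + (l ∸ k + k) * n                ≡⟨ cong (_+_ 2) (ℕₚ.*-distribʳ-+ n (l ∸ k) k) ⟩
        2 + (l ∸ k) * n + k * n            ∎)
    ... | inj₂ l≤k = ⊥-elim (ℕₚ.<-irrefl (sym e) (ℕₚ.+-mono-<-≤ {2} {suc (suc s) * suc (suc s)}
        (s≤s (s≤s (ℕₚ.≤-trans (s≤s z≤n) (ℕₚ.m≤n+m (suc (suc s) + s * suc (suc s)) s)))) (ℕₚ.*-monoˡ-≤ n l≤k)))

    go : ∀ n → Acc _<_ n → (n % 8 ≡ 3 ⊎ n % 8 ≡ 5) → ∀ t → Root n t → ⊥
    go n (acc rs) h t r with small-odd n {{ℕ.>-nonZero (ℕₚ.<-≤-trans (s≤s z≤n) (3≤ n h))}} (odd-of n h) t r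
    ... | s , s≤n , s-odd , r′ with cofactor n s (3≤ n h) s-odd r′
    ... | f , e = go f (rs f<n) (cofactor-mod n f h (trans (cong (_% 8) (sym e)) (odd-square s s-odd))) s
        (0 , n , trans (ℕₚ.+-identityʳ (s * s)) (trans e (cong (_+_ 2) (ℕₚ.*-comm f n))))
      where
      f<n : f < n
      f<n = ℕₚ.*-cancelʳ-< n f n (ℕₚ.<-≤-trans (subst (f * n <_) (sym e) (s≤s (ℕₚ.n≤1+n (f * n)))) (ℕₚ.*-mono-≤ s≤n s≤n))

  -- If `p` did not divide `y`, multiplication by an inverse of `y` would exhibit 2 as a square
  -- modulo `p`. The multiples of `p` on both sides express the congruence without subtraction.
  2-nonresidue : ∀ {p} → Prime p → p % 8 ≡ 3 → ∀ x y k l → x * x + k * p ≡ 2 * (y * y) + l * p → p ∣ x × p ∣ y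
  2-nonresidue {p} pp p3 x y k l e with p ∣.∣? y
  ... | yes p∣y = prime-∣-square x pp (∣m+n∣m⇒∣n
      (subst (p ∣_) (trans (sym e) (ℕₚ.+-comm (x * x) (k * p))) (∣m∣n⇒∣m+n (∣n⇒∣m*n 2 (∣m⇒∣m*n y p∣y)) (n∣m*n l))) (n∣m*n k)) , p∣y
  ... | no p∤y = ⊥-elim (contradiction (inverse (coprime-Bézout (prime-coprime pp p∤y))))
    where
    -- Over the natural numbers Bézout gives `z y ≡ 1` or `z y ≡ - 1`; squaring removes the sign.
    inverse : Bézout.Identity 1 p y → ∃ λ z → ∃ λ a → ∃ λ b → (z * y) * (z * y) + a * p ≡ 1 + b * p
    inverse (Bézout.+- m z eq) = z , m + m , m * m * p , (begin
      (z * y) * (z * y) + (m + m) * p                    ≡⟨ double (z * y) m p ⟩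
      (z * y) * (z * y) + (m * p + m * p)                ≡⟨ cong (λ w → (z * y) * (z * y) + (w + w)) (sym eq) ⟩
      (z * y) * (z * y) + ((1 + z * y) + (1 + z * y))    ≡⟨ complete (z * y) ⟩
      1 + (1 + z * y) * (1 + z * y)                      ≡⟨ cong (λ w → 1 + w * w) eq ⟩
      1 + m * p * (m * p)                                ≡⟨ collect m p ⟩
      1 + m * m * p * p                                  ∎)
      where
      double : ∀ w m p → w * w + (m + m) * p ≡ w * w + (m * p + m * p)
      double = solve-∀
      complete : ∀ w → w * w + ((1 + w) + (1 + w)) ≡ 1 + (1 + w) * (1 + w)
      complete = solve-∀
      collect : ∀ m p → 1 + m * p * (m * p) ≡ 1 + m * m * p * p
      collect = solve-∀
    inverse (Bézout.-+ m z eq) = z , 0 , m + m + m * m * p , (begin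
      (z * y) * (z * y) + 0                  ≡⟨ cong (λ w → w * w + 0) (sym eq) ⟩
      (1 + m * p) * (1 + m * p) + 0          ≡⟨ expand m p ⟩
      1 + (m + m + m * m * p) * p            ∎)
      where
      expand : ∀ m p → (1 + m * p) * (1 + m * p) + 0 ≡ 1 + (m + m + m * m * p) * p
      expand = solve-∀
    contradiction : (∃ λ z → ∃ λ a → ∃ λ b → (z * y) * (z * y) + a * p ≡ 1 + b * p) → ⊥
    contradiction (z , a , b , h) = 2-nonsquare-mod p (inj₁ p3) (x * z) (k * (z * z) + 2 * a) (2 * b + l * (z * z)) (begin
      x * z * (x * z) + (k * (z * z) + 2 * a) * p              ≡⟨ left x z k a p ⟩
      (x * x + k * p) * (z * z) + 2 * (a * p)                  ≡⟨ cong (λ w → w * (z * z) + 2 * (a * p)) e ⟩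
      (2 * (y * y) + l * p) * (z * z) + 2 * (a * p)            ≡⟨ middle y l p z a ⟩
      2 * (z * y * (z * y) + a * p) + l * (z * z) * p          ≡⟨ cong (λ w → 2 * w + l * (z * z) * p) h ⟩
      2 * (1 + b * p) + l * (z * z) * p                        ≡⟨ right b l z p ⟩
      2 + (2 * b + l * (z * z)) * p                            ∎)
      where
      left : ∀ x z k a p → x * z * (x * z) + (k * (z * z) + 2 * a) * p ≡ (x * x + k * p) * (z * z) + 2 * (a * p)
      left = solve-∀
      middle : ∀ y l p z a → (2 * (y * y) + l * p) * (z * z) + 2 * (a * p) ≡ 2 * (z * y * (z * y) + a * p) + l * (z * z) * p
      middle = solve-∀
      right : ∀ b l z p → 2 * (1 + b * p) + l * (z * z) * p ≡ 2 + (2 * b + l * (z * z)) * p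
      right = solve-∀

  -- With `T = t`, `V = t + 2a` and `W = t + 2a + 2c`, the half sums are `t + a`, `t + a + c`,
  -- `t + 2a + c` and the half differences `a`, `a + c`, `c`. In `halvable₁` the numbers `1 + v`,
  -- `1 + w` and `v + w` are all `2 / T` times squares, as halving requires; in `unhalvable₁` their
  -- first two multiply to `p` times a square. The second constructors say the same of the translate
  -- by `(0 , - 1 , - 1)`, up to a sign.
  data Descent (p q t a c : ℕ) : Set where
    halvable₁ : ∀ A B C → t + a ≡ A * A → t + a + c ≡ B * B → t + a + a + c ≡ C * C → Descent p q t a c
    halvable₂ : ∀ A B C → a ≡ A * A → a + c ≡ B * B → t + a + a + c ≡ C * C → Descent p q t a c
    unhalvable₁ : ∀ A B → t + a ≡ p * (A * A) → t + a + c ≡ B * B → Descent p q t a c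
    unhalvable₂ : ∀ A B → a ≡ p * (A * A) → a + c ≡ B * B → Descent p q t a c

  private
    split : ∀ p x → (p + 2) * x ≡ 2 * x + x * p
    split = solve-∀

    flip : ∀ p x y → p * x + y ≡ y + x * p
    flip = solve-∀

    -- Modulo `p` the first equation is `B² ≡ 2 C²`, so `p` divides `B` and `C`. As `q ≡ 2`, the
    -- second then becomes `A′² ≡ 2 B′²`.
    divides-both₁ : ∀ {p} → Prime p → p % 8 ≡ 3 → ∀ A B C A′ B′ →
      B * B ≡ p * (A * A) + 2 * (C * C) → (p + 2) * (B′ * B′) ≡ A′ * A′ + 2 * (C * C) → p ∣ B × p ∣ B′
    divides-both₁ {p} pp p3 A B C A′ B′ e e′ =
      let (p∣B , p∣C) = 2-nonresidue pp p3 B C 0 (A * A) (trans (ℕₚ.+-identityʳ (B * B)) (trans e (flip p (A * A) (2 * (C * C)))))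
      in p∣B , second p∣C e′
      where
      gather : ∀ x k p → x + 2 * (k * k) * p * p ≡ x + 2 * (k * p * (k * p))
      gather = solve-∀
      second : ∀ {C} → p ∣ C → (p + 2) * (B′ * B′) ≡ A′ * A′ + 2 * (C * C) → p ∣ B′
      second (divides k refl) e = proj₂ (2-nonresidue pp p3 A′ B′ (2 * (k * k) * p) (B′ * B′)
        (trans (gather (A′ * A′) k p) (trans (sym e) (split p (B′ * B′)))))

    divides-both₂ : ∀ {p} → Prime p → p % 8 ≡ 3 → ∀ A B C B′ C′ →
      B * B + p * (A * A) ≡ 2 * (C * C) → (p + 2) * (B′ * B′) ≡ p * (A * A) + C′ * C′ → p ∣ B × p ∣ B′
    divides-both₂ {p} pp p3 A B C B′ C′ e e′ =
      proj₁ (2-nonresidue pp p3 B C (A * A) 0 (trans (cong (_+_ (B * B)) (ℕₚ.*-comm (A * A) p)) (trans e (sym (ℕₚ.+-identityʳ (2 * (C * C))))))) ,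
      proj₂ (2-nonresidue pp p3 C′ B′ (A * A) (B′ * B′) (trans (sym (flip p (A * A) (C′ * C′))) (trans (sym e′) (split p (B′ * B′)))))

    no-common-prime : ∀ {p} → Prime p → ∀ {b b′ B B′} → Coprime b b′ → p ∣ B × p ∣ B′ → B ∣ b → B′ ∣ b′ → ⊥
    no-common-prime pp c (d , d′) e e′ = ¬prime[1] (subst Prime (c (∣-trans d e , ∣-trans d′ e′)) pp)

    ∣-square : ∀ {b} B → b ≡ B * B → B ∣ b
    ∣-square B refl = m∣m*n B

    ∣-multiple : ∀ {b} ℓ B → b ≡ ℓ * (B * B) → B ∣ b
    ∣-multiple ℓ B refl = ∣n⇒∣m*n ℓ (m∣m*n B)

  descent : ∀ {p} → Prime p → Prime (p + 2) → p % 8 ≡ 3 → ∀ {t a c n} →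
    Coprime (t + a) a → Coprime (t + a + c) (a + c) → Coprime (t + a + a + c) c →
    (t + a) * a ≡ p * (n * n) → (t + a + c) * (a + c) ≡ (p + 2) * (n * n) → (t + a + a + c) * c ≡ 2 * (n * n) →
    Descent p (p + 2) t a c
  descent {p} pp pq p3 {t} {a} {c} {n} c₁ c₂ c₃ e₁ e₂ e₃
    with coprime-prime-split {z = n} pp c₁ e₁ | coprime-prime-split {z = n} pq c₂ e₂ | coprime-prime-split {z = n} prime[2] c₃ e₃
  ... | A , A′ , inj₂ (α , α′) | B , B′ , inj₂ (β , β′) | C , C′ , inj₂ (γ , γ′) = halvable₁ A B C α β γ
  ... | A , A′ , inj₁ (α , α′) | B , B′ , inj₁ (β , β′) | C , C′ , inj₂ (γ , γ′) = halvable₂ A′ B′ C α′ β′ γ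
  ... | A , A′ , inj₁ (α , α′) | B , B′ , inj₂ (β , β′) | C , C′ , inj₁ (γ , γ′) = unhalvable₁ A B α β
  ... | A , A′ , inj₂ (α , α′) | B , B′ , inj₁ (β , β′) | C , C′ , inj₁ (γ , γ′) = unhalvable₂ A′ B′ α′ β′
  ... | A , A′ , inj₁ (α , α′) | B , B′ , inj₂ (β , β′) | C , C′ , inj₂ (γ , γ′) =
    ⊥-elim (no-common-prime pp c₂ (divides-both₁ pp p3 A B C′ A′ B′ (trans (sym β) (cong₂ _+_ α γ′)) (trans (sym β′) (cong₂ _+_ α′ γ′)))
      (∣-square B β) (∣-multiple (p + 2) B′ β′))
  ... | A , A′ , inj₂ (α , α′) | B , B′ , inj₁ (β , β′) | C , C′ , inj₂ (γ , γ′) =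
    ⊥-elim (no-common-prime pp (Coprimality.sym c₂) (divides-both₁ pp p3 A′ B′ C′ A B (trans (sym β′) (cong₂ _+_ α′ γ′)) (trans (sym β) (cong₂ _+_ α γ′)))
      (∣-square B′ β′) (∣-multiple (p + 2) B β))
  ... | A , A′ , inj₂ (α , α′) | B , B′ , inj₂ (β , β′) | C , C′ , inj₁ (γ , γ′) =
    ⊥-elim (no-common-prime pp c₂ (divides-both₂ pp p3 A′ B C B′ C′
        (trans (cong₂ _+_ (sym β) (sym α′)) (trans (rearrange t a c) γ)) (trans (sym β′) (cong₂ _+_ α′ γ′)))
      (∣-square B β) (∣-multiple (p + 2) B′ β′))
    where
    rearrange : ∀ t a c → t + a + c + a ≡ t + a + a + c
    rearrange = solve-∀
  ... | A , A′ , inj₁ (α , α′) | B , B′ , inj₁ (β , β′) | C , C′ , inj₁ (γ , γ′) =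
    ⊥-elim (no-common-prime pp (Coprimality.sym c₂) (divides-both₂ pp p3 A B′ C B C′
        (trans (cong₂ _+_ (sym β′) (sym α)) (trans (rearrange t a c) γ)) (trans (sym β) (cong₂ _+_ α γ′)))
      (∣-square B′ β′) (∣-multiple (p + 2) B β))
    where
    rearrange : ∀ t a c → a + c + (t + a) ≡ t + a + a + c
    rearrange = solve-∀

-- Concordant forms in integers

module ConcordantForms where
  open import Data.Nat using (_+_; _*_; _∸_; _≤_; _<_; z≤n; s≤s)
  open ≡-Reasoning
  open Arithmetic

  module _ {ℓ X Y U} (pℓ : Prime ℓ) (e : X * X + ℓ * (U * U) ≡ Y * Y) where
    -- A common divisor `d` of `X` and `Y` has `d² ∣ ℓ U²` and is coprime to `U`.
    norm-coprime : Coprime X U → Coprime X Y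
    norm-coprime c {d} (d∣X , d∣Y) = square-divisor-trivial pℓ (coprime-∣ d∣X c)
      (∣m+n∣m⇒∣n (subst (d * d ∣_) (sym e) (*-pres-∣ d∣Y d∣Y)) (*-pres-∣ d∣X d∣X))

    norm-coprime′ : Coprime X U → Coprime Y U
    norm-coprime′ c {d} (d∣Y , d∣U) = c (d∣X , d∣U)
      where
      d∣XX : d ∣ X * X
      d∣XX = ∣m+n∣m⇒∣n (subst (d ∣_) (trans (sym e) (ℕₚ.+-comm (X * X) _)) (∣m⇒∣m*n Y d∣Y)) (∣n⇒∣m*n ℓ (∣m⇒∣m*n U d∣U))
      d∣X : d ∣ X
      d∣X = coprime-divisor (coprime-∣ d∣U (Coprimality.sym c)) d∣XX

    norm-≤ : X ≤ Y
    norm-≤ with ℕₚ.≤-<-connex X Y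
    ... | inj₁ X≤Y = X≤Y
    ... | inj₂ Y<X = ⊥-elim (ℕₚ.<-irrefl refl (ℕₚ.<-≤-trans (ℕₚ.*-mono-< Y<X Y<X) (subst (X * X ≤_) e (ℕₚ.m≤m+n _ _))))

    -- The difference `k = Y - X` satisfies `k² + 2 X k = 4 ℓ n²`, so it is even, and its half
    -- solves the equation divided by 4.
    norm-half : ∀ {n} → U ≡ n + n → ∃ λ a → Y ≡ X + (a + a) × (X + a) * a ≡ ℓ * (n * n)
    norm-half {n} refl = half (prime-∣-square k prime[2] 2∣kk)
      where
      k = Y ∸ X
      Y≡X+k : Y ≡ X + k
      Y≡X+k = sym (ℕₚ.m+[n∸m]≡n norm-≤)
      key : k * k + 2 * (X * k) ≡ 2 * (2 * (ℓ * (n * n)))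
      key = ℕₚ.+-cancelˡ-≡ (X * X) _ _ (begin
        X * X + (k * k + 2 * (X * k))         ≡⟨ expand X k ⟩
        (X + k) * (X + k)                     ≡⟨ trans (cong₂ _*_ (sym Y≡X+k) (sym Y≡X+k)) (sym e) ⟩
        X * X + ℓ * ((n + n) * (n + n))       ≡⟨ cong (_+_ (X * X)) (double ℓ n) ⟩
        X * X + 2 * (2 * (ℓ * (n * n)))       ∎)
        where
        expand : ∀ X k → X * X + (k * k + 2 * (X * k)) ≡ (X + k) * (X + k)
        expand = solve-∀
        double : ∀ ℓ n → ℓ * ((n + n) * (n + n)) ≡ 2 * (2 * (ℓ * (n * n)))
        double = solve-∀
      2∣kk : 2 ∣ k * k
      2∣kk = ∣m+n∣m⇒∣n (subst (2 ∣_) (trans (sym key) (ℕₚ.+-comm (k * k) _)) (m∣m*n (2 * (ℓ * (n * n))))) (m∣m*n (X * k))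
      half : 2 ∣ k → _
      half (divides a k≡) = a , trans Y≡X+k (cong (_+_ X) (trans k≡ (twice a))) ,
        ℕₚ.*-cancelˡ-≡ _ _ 4 (trans (expand X a) (trans (cong (λ k → k * k + 2 * (X * k)) (sym k≡)) (trans key (quadruple (ℓ * (n * n))))))
        where
        twice : ∀ a → a * 2 ≡ a + a
        twice = solve-∀
        expand : ∀ X a → 4 * ((X + a) * a) ≡ (a * 2) * (a * 2) + 2 * (X * (a * 2))
        expand = solve-∀
        quadruple : ∀ y → 2 * (2 * y) ≡ 4 * y
        quadruple = solve-∀

  -- Euler's problem of making `T² + p U²` and `T² + q U²` squares simultaneously. As `q - p = 2`, a
  -- third equation `V² + 2 U² = W²` of the same shape follows, so one set of lemmas serves the
  -- three primes.
  record Concordant (p T U V W : ℕ) : Set where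
    constructor concordant
    field
      coprime-TU : Coprime T U
      norm-p : T * T + p * (U * U) ≡ V * V
      norm-q : T * T + (p + 2) * (U * U) ≡ W * W

    norm-2 : V * V + 2 * (U * U) ≡ W * W
    norm-2 = trans (cong (_+ 2 * (U * U)) (sym norm-p)) (trans (regroup (T * T) p (U * U)) norm-q)
      where
      regroup : ∀ x p u → x + p * u + 2 * u ≡ x + (p + 2) * u
      regroup = solve-∀

  -- Let `U` be odd. Modulo 8, an odd `T` would give `W² ≡ 6`, and an even `T` would give `V² ≡ 3`
  -- or `V² ≡ 7`; none of these is a square.
  concordant-even : ∀ {p T U V W} → p % 8 ≡ 3 → Concordant p T U V W → 2 ∣ U
  concordant-even {p} {T} {U} {V} {W} p3 C = go (squareMod8 U) (squareMod8 T) (squareMod8 V) (squareMod8 W)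
    where
    open Concordant C
    q5 : (p + 2) % 8 ≡ 5
    q5 = +-mod p 2 p3 refl
    V-mod : ∀ {r s} → (T * T) % 8 ≡ r → (V * V) % 8 ≡ s → (U * U) % 8 ≡ 1 → (r + 3) % 8 ≡ s
    V-mod a b c = trans (sym (+-mod (T * T) _ a (*-mod p _ p3 c))) (trans (cong (_% 8) norm-p) b)
    W-mod : ∀ {r s} → (T * T) % 8 ≡ r → (W * W) % 8 ≡ s → (U * U) % 8 ≡ 1 → (r + 5) % 8 ≡ s
    W-mod a b c = trans (sym (+-mod (T * T) _ a (*-mod (p + 2) _ q5 c))) (trans (cong (_% 8) norm-q) b)
    distinct : ∀ {m n} {m≢n : False (m ℕₚ.≟ n)} → m ≢ n
    distinct {m≢n = m≢n} = toWitnessFalse m≢n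
    go : SquareMod8 U → SquareMod8 T → SquareMod8 V → SquareMod8 W → 2 ∣ U
    go (zero d _) _ _ _ = d
    go (four d _) _ _ _ = d
    go (odd u) (odd t) _ (odd w) = ⊥-elim (distinct (W-mod t w u))
    go (odd u) (odd t) _ (zero _ w) = ⊥-elim (distinct (W-mod t w u))
    go (odd u) (odd t) _ (four _ w) = ⊥-elim (distinct (W-mod t w u))
    go (odd u) (zero _ t) (odd v) _ = ⊥-elim (distinct (V-mod t v u))
    go (odd u) (zero _ t) (zero _ v) _ = ⊥-elim (distinct (V-mod t v u))
    go (odd u) (zero _ t) (four _ v) _ = ⊥-elim (distinct (V-mod t v u))
    go (odd u) (four _ t) (odd v) _ = ⊥-elim (distinct (V-mod t v u))
    go (odd u) (four _ t) (zero _ v) _ = ⊥-elim (distinct (V-mod t v u))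
    go (odd u) (four _ t) (four _ v) _ = ⊥-elim (distinct (V-mod t v u))

  module _ {p T U V W} (pp : Prime p) (pq : Prime (p + 2)) (C : Concordant p T U V W) where
    open Concordant C

    coprime-TV : Coprime T V
    coprime-TV = norm-coprime {X = T} pp norm-p coprime-TU

    coprime-TW : Coprime T W
    coprime-TW = norm-coprime {X = T} pq norm-q coprime-TU

    coprime-VW : Coprime V W
    coprime-VW = norm-coprime {X = V} prime[2] norm-2 (norm-coprime′ {X = T} pp norm-p coprime-TU)

    concordant-descent : p % 8 ≡ 3 → ∃ λ a → ∃ λ c → V ≡ T + (a + a) × W ≡ T + (a + c + (a + c)) × Descent p (p + 2) T a c
    concordant-descent p3 = a , c , V≡ , W≡ , descent pp pq p3 {n = n}
      (λ { {d} (d∣x , d∣a) → let d∣T = ∣m+n∣m⇒∣n (subst (d ∣_) (ℕₚ.+-comm T a) d∣x) d∣a in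
        coprime-TV (d∣T , subst (d ∣_) (sym V≡) (∣m∣n⇒∣m+n d∣T (∣m∣n⇒∣m+n d∣a d∣a))) })
      (λ { {d} (d∣x , d∣b) → let d∣T = ∣m+n∣m⇒∣n (subst (d ∣_) (trans (ℕₚ.+-assoc T a c) (ℕₚ.+-comm T (a + c))) d∣x) d∣b in
        coprime-TW (d∣T , subst (d ∣_) (sym W≡) (∣m∣n⇒∣m+n d∣T (∣m∣n⇒∣m+n d∣b d∣b))) })
      (λ { {d} (d∣x , d∣c) → let d∣V = subst (d ∣_) (trans (ℕₚ.+-assoc T a a) (sym V≡)) (∣m+n∣m⇒∣n (subst (d ∣_) (ℕₚ.+-comm (T + a + a) c) d∣x) d∣c) in
        coprime-VW (d∣V , subst (d ∣_) (sym W≡′) (∣m∣n⇒∣m+n d∣V (∣m∣n⇒∣m+n d∣c d∣c))) })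
      e₁
      -- The equation for `q` is the sum of those for `p` and 2, as
      -- `W² - T² = (V² - T²) + (W² - V²)`.
      (trans (add T a c) (trans (cong₂ _+_ e₁ e₃′) (sym (ℕₚ.*-distribʳ-+ (n * n) p 2))))
      e₃′
      where
      2∣U = concordant-even p3 C
      n = quotient 2∣U
      U≡n+n : U ≡ n + n
      U≡n+n = trans (m∣n⇒n≡quotient*m 2∣U) (trans (ℕₚ.*-comm n 2) (cong (_+_ n) (ℕₚ.+-identityʳ n)))
      half-p = norm-half {X = T} pp norm-p {n} U≡n+n
      half-2 = norm-half {X = V} prime[2] norm-2 {n} U≡n+n
      a = proj₁ half-p
      V≡ = proj₁ (proj₂ half-p)
      e₁ = proj₂ (proj₂ half-p)
      c = proj₁ half-2
      W≡′ = proj₁ (proj₂ half-2)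
      e₃ = proj₂ (proj₂ half-2)
      W≡ : W ≡ T + (a + c + (a + c))
      W≡ = trans W≡′ (trans (cong (_+ (c + c)) V≡) (regroup T a c))
        where
        regroup : ∀ T a c → T + (a + a) + (c + c) ≡ T + (a + c + (a + c))
        regroup = solve-∀
      e₃′ : (T + a + a + c) * c ≡ 2 * (n * n)
      e₃′ = trans (cong (λ x → (x + c) * c) (trans (ℕₚ.+-assoc T a a) (sym V≡))) e₃
      add : ∀ T a c → (T + a + c) * (a + c) ≡ (T + a) * a + (T + a + a + c) * c
      add = solve-∀

-- Rational numbers and nonsquares

open import Defs

inv-ℚ : ℚ → ℚ
inv-ℚ x = 1ℚ /' x

/'-inverse : ∀ a {b} → b ≢ 0ℚ → b ℚ.* (a /' b) ≡ a
/'-inverse a {b} b≢0 with b ℚₚ.≟ 0ℚ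
... | yes b≡0 = ⊥-elim (b≢0 b≡0)
... | no _ = let instance _ = ℚ.≢-nonZero b≢0 in begin
    b ℚ.* (a ℚ.* ℚ.1/ b)   ≡⟨ cong (b ℚ.*_) (ℚₚ.*-comm a (ℚ.1/ b)) ⟩
    b ℚ.* (ℚ.1/ b ℚ.* a)   ≡⟨ sym (ℚₚ.*-assoc b (ℚ.1/ b) a) ⟩
    (b ℚ.* ℚ.1/ b) ℚ.* a   ≡⟨ cong (ℚ._* a) (ℚₚ.*-inverseʳ b) ⟩
    1ℚ ℚ.* a               ≡⟨ ℚₚ.*-identityˡ a ⟩
    a                      ∎
  where open ≡-Reasoning

ℚ-ring : ≡-CommutativeRing
ℚ-ring = record { isCommutativeRing = ℚₚ.+-*-isCommutativeRing }

ℚ-field : ≡-Field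
ℚ-field = record
  { ≡-commutativeRing = ℚ-ring
  ; _≟_ = ℚₚ._≟_
  ; inv = inv-ℚ
  ; *-inverseʳ = /'-inverse 1ℚ
  ; 1≢0 = λ () }

ℤ-ring : ≡-CommutativeRing
ℤ-ring = record { isCommutativeRing = ℤₚ.+-*-isCommutativeRing }

module RationalIntegers where
  open import Data.Rational using (_+_; _*_; -_; _-_)
  open Solver ℚ-ring public using (ι; ι-+; ι-*; ι-neg)
  open FieldProperties ℚ-field
  open ≡-Reasoning
  open Arithmetic using (coprime-squares)

  integral : ℤ → ℚ
  integral i = mkℚ i 0 (Coprimality.sym (Coprimality.1-coprimeTo _))

  /1≡integral : ∀ i → i ℚ./ 1 ≡ integral i
  /1≡integral i = ℚₚ.↥p/↧p≡p (integral i)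

  private
    ιⁿ≡integral : ∀ n → ι (+ n) ≡ integral (+ n)
    ιⁿ≡integral zero = refl
    ιⁿ≡integral (suc n) = begin
      1ℚ + ι (+ n)                               ≡⟨ cong (_+_ 1ℚ) (ιⁿ≡integral n) ⟩
      (+ 1 ℤ.* + 1 ℤ.+ + n ℤ.* + 1) ℚ./ 1        ≡⟨ cong (λ k → (+ 1 ℤ.+ k) ℚ./ 1) (ℤₚ.*-identityʳ (+ n)) ⟩
      + suc n ℚ./ 1                              ≡⟨ /1≡integral (+ suc n) ⟩
      integral (+ suc n)                         ∎

  ι≡integral : ∀ i → ι i ≡ integral i
  ι≡integral (+ n) = ιⁿ≡integral n
  ι≡integral -[1+ n ] = cong -_ (ιⁿ≡integral (suc n))

  ι-injective : ∀ {i j} → ι i ≡ ι j → i ≡ j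
  ι-injective {i} {j} e = cong ↥_ (trans (sym (ι≡integral i)) (trans e (ι≡integral j)))

  ι≢0 : ∀ {i} → i ≢ + 0 → ι i ≢ 0ℚ
  ι≢0 i≢0 e = i≢0 (ι-injective e)

  *-denominator : ∀ x → x * ι (↧ x) ≡ ι (↥ x)
  *-denominator x@(mkℚ n d _) = begin
    x * ι (↧ x)        ≡⟨ cong (x *_) (ι≡integral (↧ x)) ⟩
    x * integral (↧ x) ≡⟨ ℚₚ.toℚᵘ-injective (ℚᵘₚ.≃-trans (ℚₚ.toℚᵘ-homo-* x (integral (↧ x)))
                          (ℚᵘ.*≡* (trans (ℤₚ.*-identityʳ _) (cong (λ k → n ℤ.* + k) (sym (ℕₚ.*-identityʳ (suc d))))))) ⟩
    integral n         ≡⟨ sym (ι≡integral n) ⟩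
    ι n                ∎

  -- In lowest terms the square of the denominator divides the square of the numerator, to which it
  -- is coprime.
  integral-root : ∀ x k → x * x ≡ ι k → ∃ λ i → x ≡ ι i
  integral-root x@(mkℚ n d c) k e = n , trans (sym (trans (cong (x *_) (cong ι D≡1)) (ℚₚ.*-identityʳ x))) (*-denominator x)
    where
    D = ↧ x
    nn≡kDD : n ℤ.* n ≡ k ℤ.* (D ℤ.* D)
    nn≡kDD = ι-injective (begin
      ι (n ℤ.* n)              ≡⟨ ι-* n n ⟩
      ι n * ι n                ≡⟨ cong₂ _*_ (sym (*-denominator x)) (sym (*-denominator x)) ⟩
      x * ι D * (x * ι D)      ≡⟨ Solver.ring ℚ-ring (x ∷ ι D ∷ []) (λ { (x ∷ D ∷ []) → x :* D :* (x :* D) := x :* x :* (D :* D) }) refl ⟩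
      x * x * (ι D * ι D)      ≡⟨ cong₂ _*_ e (sym (ι-* D D)) ⟩
      ι k * ι (D ℤ.* D)        ≡⟨ sym (ι-* k (D ℤ.* D)) ⟩
      ι (k ℤ.* (D ℤ.* D))      ∎)
    coprime : Coprime (suc d ℕ.* suc d) (ℤ.∣ n ∣ ℕ.* ℤ.∣ n ∣)
    coprime = coprime-squares (Coprimality.sym (Coprimality.recompute c))
    DD∣nn : suc d ℕ.* suc d ∣ ℤ.∣ n ∣ ℕ.* ℤ.∣ n ∣
    DD∣nn = subst (suc d ℕ.* suc d ∣_) (sym (trans (sym (ℤₚ.abs-* n n)) (trans (cong ℤ.∣_∣ nn≡kDD) (trans (ℤₚ.abs-* k (D ℤ.* D)) (cong (ℤ.∣ k ∣ ℕ.*_) (ℤₚ.abs-* D D)))))) (n∣m*n ℤ.∣ k ∣)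
    D≡1 : D ≡ + 1
    D≡1 = cong +_ (ℕₚ.m*n≡1⇒m≡1 (suc d) (suc d) (coprime (∣-refl , DD∣nn)))

  NonSquare : ℤ → Set
  NonSquare k = ∀ i → i ℤ.* i ≢ k

  -- The homogeneous form of irrationality: contradictions arise by exhibiting a nonzero `y`, and
  -- the callers are spared a division.
  nonsquare : ∀ {k} → NonSquare k → ∀ x y → x * x ≡ ι k * (y * y) → y ≡ 0ℚ
  nonsquare {k} h x y e with y ℚₚ.≟ 0ℚ
  ... | yes y≡0 = y≡0
  ... | no y≢0 = let (i , x/y≡i) = integral-root (x ÷ y) k root in ⊥-elim (h i (ι-injective (begin
      ι (i ℤ.* i)       ≡⟨ ι-* i i ⟩
      ι i * ι i         ≡⟨ cong₂ _*_ (sym x/y≡i) (sym x/y≡i) ⟩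
      x ÷ y * (x ÷ y)   ≡⟨ root ⟩
      ι k               ∎)))
    where
    root : x ÷ y * (x ÷ y) ≡ ι k
    root = *-cancelʳ (y * y) (*-nonzero y≢0 y≢0) (begin
      x ÷ y * (x ÷ y) * (y * y)     ≡⟨ Solver.ring ℚ-ring (x ÷ y ∷ y ∷ []) (λ { (z ∷ y ∷ []) → z :* z :* (y :* y) := z :* y :* (z :* y) }) refl ⟩
      x ÷ y * y * (x ÷ y * y)       ≡⟨ cong₂ _*_ (÷-* x y≢0) (÷-* x y≢0) ⟩
      x * x                         ≡⟨ e ⟩
      ι k * (y * y)                 ∎)

  square-abs : ∀ i → i ℤ.* i ≡ + (ℤ.∣ i ∣ ℕ.* ℤ.∣ i ∣)
  square-abs (+ n) = sym (ℤₚ.pos-* n n)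
  square-abs -[1+ n ] = refl

  negative-nonsquare : ∀ {k} → NonSquare -[1+ k ]
  negative-nonsquare i e with () ← trans (sym (square-abs i)) e

  prime-nonsquare : ∀ {p} → Prime p → NonSquare (+ p)
  prime-nonsquare {p} pp i e = ¬prime[1] (subst Prime (Arithmetic.square-divisor-trivial {n = 1} pp (Coprimality.sym (Coprimality.1-coprimeTo _)) divides-p) pr)
    where
    n = ℤ.∣ i ∣
    nn≡p : n ℕ.* n ≡ p
    nn≡p = ℤₚ.+-injective (trans (sym (square-abs i)) e)
    p∣n : p ∣ n
    p∣n = Arithmetic.prime-∣-square n pp (subst (p ∣_) (sym nn≡p) ∣-refl)
    n≡p : n ≡ p
    n≡p = ∣-antisym (subst (n ∣_) nn≡p (m∣m*n n)) p∣n
    pr : Prime n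
    pr = subst Prime (sym n≡p) pp
    divides-p : n ℕ.* n ∣ p ℕ.* 1
    divides-p = subst (_∣ p ℕ.* 1) (sym nn≡p) (m∣m*n 1)

  product-nonsquare : ∀ {p q} → Prime p → Prime q → p ≢ q → NonSquare (+ (p ℕ.* q))
  product-nonsquare {p} {q} pp pq p≢q i e = p≢q (irreducible-≡ (prime⇒irreducible pq p∣q))
    where
    n = ℤ.∣ i ∣
    nn≡pq : n ℕ.* n ≡ p ℕ.* q
    nn≡pq = ℤₚ.+-injective (trans (sym (square-abs i)) e)
    p∣n : p ∣ n
    p∣n = Arithmetic.prime-∣-square n pp (subst (p ∣_) (sym nn≡pq) (m∣m*n q))
    p∣q : p ∣ q
    p∣q = let instance _ = prime⇒nonZero pp in ∣.*-cancelˡ-∣ p (subst (p ℕ.* p ∣_) nn≡pq (*-pres-∣ p∣n p∣n))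
    irreducible-≡ : p ≡ 1 ⊎ p ≡ q → p ≡ q
    irreducible-≡ (inj₁ p≡1) = ⊥-elim (¬prime[1] (subst Prime p≡1 pp))
    irreducible-≡ (inj₂ h) = h

-- Classification of points modulo doubles and torsion

module Twin (p : ℕ) (pp : Prime p) (pq : Prime (p ℕ.+ 2)) (p3 : p % 8 ≡ 3) where
  open import Data.Rational using (_+_; _*_; -_; _-_)
  open RationalIntegers
  open Arithmetic using (Descent; halvable₁; halvable₂; unhalvable₁; unhalvable₂)
  open ConcordantForms using (Concordant; concordant; concordant-descent)
  open ≡-Field ℚ-field using (1≢0)
  open FieldProperties ℚ-field
  open Solver ℚ-ring using (ring; combine)
  open ≡-Reasoning

  q : ℕ
  q = p ℕ.+ 2

  pℚ qℚ : ℚ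
  pℚ = ι (+ p)
  qℚ = ι (+ q)

  p≢q : p ≢ q
  p≢q e = ℕₚ.m≢1+m+n p {1} (trans e (ℕₚ.+-suc p 1))

  pqℚ : pℚ * qℚ ≡ ι (+ (p ℕ.* q))
  pqℚ = trans (sym (ι-* (+ p) (+ q))) (cong ι (sym (ℤₚ.pos-* p q)))

  pq-nonsquare : ∀ x → pℚ * qℚ * (x * x) ≢ 1ℚ
  pq-nonsquare x e = 1≢0 (trans (sym e) (trans (cong (λ x → pℚ * qℚ * (x * x)) x≡0) (ℚₚ.*-zeroʳ (pℚ * qℚ))))
    where
    x≡0 : x ≡ 0ℚ
    x≡0 = nonsquare (product-nonsquare pp pq p≢q) 1ℚ x (sym (trans (cong (_* (x * x)) (sym pqℚ)) e))

  open Jacobi ℚ-field pℚ qℚ pq-nonsquare public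
  open Projective ℚ-field pℚ qℚ pq-nonsquare public
  open Halving ℚ-field pℚ qℚ pq-nonsquare public

  pℚ≢0 : pℚ ≢ 0ℚ
  pℚ≢0 = ι≢0 {+ p} (λ { refl → ¬prime[0] pp })

  qℚ≢0 : qℚ ≢ 0ℚ
  qℚ≢0 = ι≢0 {+ q} (λ e → ℕₚ.m+1+n≢0 p (ℤₚ.+-injective e))

  δ≢0 : ∀ P → u P ≢ 0ℚ → δ P ≢ 0ℚ
  δ≢0 P u≢0 e = *-nonzero (*-nonzero pℚ≢0 qℚ≢0) (*-nonzero (*-nonzero u≢0 u≢0) (*-nonzero u≢0 u≢0))
    (begin
      pℚ * qℚ * (u P * u P * (u P * u P))        ≡⟨ solve₁ P (λ { (v ∷ w ∷ u ∷ p ∷ q ∷ []) → p :* q :* (u :* u :* (u :* u)) :=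
                                                    (lit (+ 1) :+ v) :* (lit (+ 1) :+ w) :* ((lit (+ 1) :- v) :* (lit (+ 1) :- w)) }) refl ⟩
      δ P * ((1ℚ - v P) * (1ℚ - w P))            ≡⟨ cong (_* ((1ℚ - v P) * (1ℚ - w P))) e ⟩
      0ℚ * ((1ℚ - v P) * (1ℚ - w P))             ≡⟨ ℚₚ.*-zeroˡ ((1ℚ - v P) * (1ℚ - w P)) ⟩
      0ℚ                                         ∎)

  record Representative (P : J) : Set where
    field
      T : ℕ
      U V W : ℤ
      coords : Coordinates P (ι (+ T)) (ι U) (ι V) (ι W)
      isConcordant : Concordant p T ℤ.∣ U ∣ ℤ.∣ V ∣ ℤ.∣ W ∣

  -- Reducing `u` alone is enough: with its denominator `T`, the squares of `v T` and `w T` are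
  -- integers, hence `v T` and `w T` are integers themselves.
  lowest-terms : ∀ P → Representative P
  lowest-terms P = record
    { T = T ; U = U ; V = V ; W = W
    ; coords = coordinates (ι≢0 {+ T} (λ ())) (*-denominator (u P)) vT wT
    ; isConcordant = concordant (Coprimality.sym (numerator-coprime (u P)))
        (norm p V (trans (sym (cong₂ _*_ vT vT)) (square-of p (v P) (v² P))))
        (norm q W (trans (sym (cong₂ _*_ wT wT)) (square-of q (w P) (w² P)))) }
    where
    T = ↧ₙ (u P)
    U = ↥ (u P)
    numerator-coprime : ∀ x → Coprime ℤ.∣ ↥ x ∣ (↧ₙ x)
    numerator-coprime (mkℚ _ _ c) = Coprimality.recompute c
    k : ℕ → ℤ
    k n = + T ℤ.* + T ℤ.+ + n ℤ.* (U ℤ.* U)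
    square-of : ∀ n x → x * x ≡ 1ℚ + ι (+ n) * (u P * u P) → x * ι (+ T) * (x * ι (+ T)) ≡ ι (k n)
    square-of n x e = begin
      x * ι (+ T) * (x * ι (+ T))
        ≡⟨ combine (x ∷ ι (+ T) ∷ ι (+ n) ∷ u P ∷ []) (λ { (x ∷ T ∷ n ∷ u ∷ []) →
           (x :* T :* (x :* T) := T :* T :+ n :* (u :* T :* (u :* T))) , (T :* T , (x :* x := lit (+ 1) :+ n :* (u :* u))) ∷ [] }) e refl ⟩
      ι (+ T) * ι (+ T) + ι (+ n) * (u P * ι (+ T) * (u P * ι (+ T)))
        ≡⟨ cong₂ (λ a b → ι (+ T) * ι (+ T) + ι (+ n) * (a * b)) (*-denominator (u P)) (*-denominator (u P)) ⟩
      ι (+ T) * ι (+ T) + ι (+ n) * (ι U * ι U)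
        ≡⟨ cong₂ _+_ (sym (ι-* (+ T) (+ T))) (trans (cong (ι (+ n) *_) (sym (ι-* U U))) (sym (ι-* (+ n) (U ℤ.* U)))) ⟩
      ι (+ T ℤ.* + T) + ι (+ n ℤ.* (U ℤ.* U))
        ≡⟨ sym (ι-+ (+ T ℤ.* + T) (+ n ℤ.* (U ℤ.* U))) ⟩
      ι (k n) ∎
    V-root = integral-root (v P * ι (+ T)) (k p) (square-of p (v P) (v² P))
    W-root = integral-root (w P * ι (+ T)) (k q) (square-of q (w P) (w² P))
    V = proj₁ V-root
    W = proj₁ W-root
    vT = proj₂ V-root
    wT = proj₂ W-root
    norm : ∀ n X → ι X * ι X ≡ ι (k n) → T ℕ.* T ℕ.+ n ℕ.* (ℤ.∣ U ∣ ℕ.* ℤ.∣ U ∣) ≡ ℤ.∣ X ∣ ℕ.* ℤ.∣ X ∣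
    norm n X e = ℤₚ.+-injective (begin
      + (T ℕ.* T ℕ.+ n ℕ.* (ℤ.∣ U ∣ ℕ.* ℤ.∣ U ∣))       ≡⟨ ℤₚ.pos-+ (T ℕ.* T) _ ⟩
      + (T ℕ.* T) ℤ.+ + (n ℕ.* (ℤ.∣ U ∣ ℕ.* ℤ.∣ U ∣))   ≡⟨ cong₂ ℤ._+_ (ℤₚ.pos-* T T) (ℤₚ.pos-* n _) ⟩
      + T ℤ.* + T ℤ.+ + n ℤ.* + (ℤ.∣ U ∣ ℕ.* ℤ.∣ U ∣)   ≡⟨ cong (λ z → + T ℤ.* + T ℤ.+ + n ℤ.* z) (sym (square-abs U)) ⟩
      k n                                              ≡⟨ ι-injective (trans (sym e) (sym (ι-* X X))) ⟩
      X ℤ.* X                                          ≡⟨ square-abs X ⟩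
      + (ℤ.∣ X ∣ ℕ.* ℤ.∣ X ∣)                           ∎)

  -- Opaque, so that conversion checking never starts to compute numerators.
  abstract
    representative : ∀ P → Representative P
    representative = lowest-terms

  Torsion : J → Set
  Torsion τ = u τ ≡ 0ℚ

  torsion-point : ∀ x y → x * x ≡ 1ℚ → y * y ≡ 1ℚ → ∃ λ τ → Torsion τ × v τ ≡ x × w τ ≡ y
  torsion-point x y ex ey = pt 0ℚ x y (at pℚ x ex) (at qℚ y ey) , refl , refl , refl
    where
    at : ∀ k x → x * x ≡ 1ℚ → x * x ≡ 1ℚ + k * (0ℚ * 0ℚ)
    at k x e = trans e (sym (trans (cong (_+_ 1ℚ) (ℚₚ.*-zeroʳ k)) (ℚₚ.+-identityʳ 1ℚ)))

  torsion-⊕ : ∀ {τ τ′} → Torsion τ → Torsion τ′ → Torsion (τ ⊕ τ′)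
  torsion-⊕ {τ} {τ′} t t′ = trans (u-⊕-torsion {τ′} t′ τ) (trans (cong (v τ′ * w τ′ *_) t) (ℚₚ.*-zeroʳ (v τ′ * w τ′)))

  ⊕-torsion-involutive : ∀ P {τ} → Torsion τ → (P ⊕ τ) ⊕ τ ≡ P
  ⊕-torsion-involutive P {τ} t = trans (⊕-assoc P τ τ) (trans (cong (P ⊕_) (torsion-double {τ} t)) (trans (⊕-comm P 𝟘) (⊕-identityˡ P)))

  Double : J → Set
  Double P = ∃ λ R → ∃ λ τ → Torsion τ × (R ⊕ R) ⊕ τ ≡ P

  -- Together with Double this covers J modulo torsion.
  Special : J → Set
  Special P = ∃ λ x → x ≢ 0ℚ × δ P ≡ pℚ * (x * x)

  double-shift : ∀ {P τ} → Torsion τ → Double (P ⊕ τ) → Double P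
  double-shift {P} {τ} t (R , τ′ , t′ , e) = R , τ′ ⊕ τ , torsion-⊕ {τ′} {τ} t′ t ,
    trans (sym (⊕-assoc (R ⊕ R) τ′ τ)) (trans (cong (_⊕ τ) e) (⊕-torsion-involutive P {τ} t))

  -- The factor `k` is 2 for a point with positive `v` and `w`, and `- 2` for its translate by
  -- `(0 , - 1 , - 1)`. The products below involve only `k² = 4`, so both cases are served at once.
  module _ (P : J) (u≢0 : u P ≢ 0ℚ) {T k α β : ℚ} (T≢0 : T ≢ 0ℚ) (k² : k * k ≡ (1ℚ + 1ℚ) * (1ℚ + 1ℚ))
    (eᵛ : (1ℚ + v P) * T ≡ k * α) (eʷ : (1ℚ + w P) * T ≡ k * β) where

    private
      product : ∀ {x y a b z c} → x * T ≡ k * a → y * T ≡ k * b → c * (z * z) ≡ a * b →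
        c * ((z + z) ÷ T * ((z + z) ÷ T)) ≡ x * y
      product {x} {y} {a} {b} {z} {c} ex ey e = *-cancelʳ (T * T) (*-nonzero T≢0 T≢0) (begin
        c * ((z + z) ÷ T * ((z + z) ÷ T)) * (T * T)
          ≡⟨ ring (c ∷ (z + z) ÷ T ∷ T ∷ []) (λ { (c ∷ r ∷ T ∷ []) → c :* (r :* r) :* (T :* T) := c :* (r :* T :* (r :* T)) }) refl ⟩
        c * ((z + z) ÷ T * T * ((z + z) ÷ T * T))
          ≡⟨ cong (c *_) (cong₂ _*_ (÷-* (z + z) T≢0) (÷-* (z + z) T≢0)) ⟩
        c * ((z + z) * (z + z))
          ≡⟨ combine (c ∷ z ∷ k ∷ a ∷ b ∷ x ∷ y ∷ T ∷ []) (λ { (c ∷ z ∷ k ∷ a ∷ b ∷ x ∷ y ∷ T ∷ []) →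
             (c :* ((z :+ z) :* (z :+ z)) := x :* y :* (T :* T)) ,
             (lit (+ 4) , (c :* (z :* z) := a :* b)) ∷
             (:- (a :* b) , (k :* k := (lit (+ 1) :+ lit (+ 1)) :* (lit (+ 1) :+ lit (+ 1)))) ∷
             (:- (y :* T) , (x :* T := k :* a)) ∷ (:- (k :* a) , (y :* T := k :* b)) ∷ [] }) (e , k² , ex , ey) refl ⟩
        x * y * (T * T) ∎)

    double-from-squares : ∀ {γ A B C} → (v P + w P) * T ≡ k * γ → α ≡ A * A → β ≡ B * B → γ ≡ C * C → Double P
    double-from-squares {γ} {A} {B} {C} e refl refl refl =
      let (R , h) = halve P r s r≢0 er es in R , 𝟘 , refl , trans (⊕-comm (R ⊕ R) 𝟘) (trans (⊕-identityˡ (R ⊕ R)) h)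
      where
      r = (A * B + A * B) ÷ T
      s = (B * C + B * C) ÷ T
      er : r * r ≡ δ P
      er = trans (sym (ℚₚ.*-identityˡ (r * r))) (product {1ℚ + v P} {1ℚ + w P} {A * A} {B * B} {A * B} {1ℚ} eᵛ eʷ (ring (A ∷ B ∷ []) (λ { (A ∷ B ∷ []) →
        lit (+ 1) :* (A :* B :* (A :* B)) := A :* A :* (B :* B) }) refl))
      es : s * s ≡ (1ℚ + w P) * (v P + w P)
      es = trans (sym (ℚₚ.*-identityˡ (s * s))) (product {1ℚ + w P} {v P + w P} {B * B} {C * C} {B * C} {1ℚ} eʷ e (ring (B ∷ C ∷ []) (λ { (A ∷ B ∷ []) →
        lit (+ 1) :* (A :* B :* (A :* B)) := A :* A :* (B :* B) }) refl))
      r≢0 : r ≢ 0ℚ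
      r≢0 = *-nonzeroˡ {r} {r} (subst (_≢ 0ℚ) (sym er) (δ≢0 P u≢0))

    special-from-squares : ∀ {A B} → α ≡ pℚ * (A * A) → β ≡ B * B → Special P
    special-from-squares {A} {B} refl refl = x , x≢0 , sym e
      where
      x = (A * B + A * B) ÷ T
      e : pℚ * (x * x) ≡ δ P
      e = product {1ℚ + v P} {1ℚ + w P} {pℚ * (A * A)} {B * B} {A * B} {pℚ} eᵛ eʷ (ring (A ∷ B ∷ pℚ ∷ []) (λ { (A ∷ B ∷ p ∷ []) →
        p :* (A :* B :* (A :* B)) := p :* (A :* A) :* (B :* B) }) refl)
      x≢0 : x ≢ 0ℚ
      x≢0 = *-nonzeroˡ {x} {x} (*-nonzeroʳ {pℚ} {x * x} (subst (_≢ 0ℚ) (sym e) (δ≢0 P u≢0)))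

  sgn : ℤ → ℚ
  sgn (+ _) = 1ℚ
  sgn -[1+ _ ] = - 1ℚ

  sgn² : ∀ i → sgn i * sgn i ≡ 1ℚ
  sgn² (+ _) = refl
  sgn² -[1+ _ ] = refl

  sgn-abs : ∀ i → sgn i * ι i ≡ ι (+ ℤ.∣ i ∣)
  sgn-abs (+ n) = ℚₚ.*-identityˡ _
  sgn-abs -[1+ n ] = ring (ι (+ suc n) ∷ []) (λ { (x ∷ []) → :- (lit (+ 1)) :* :- x := x }) refl

  ι-nat-+ : ∀ m n → ι (+ (m ℕ.+ n)) ≡ ι (+ m) + ι (+ n)
  ι-nat-+ m n = ι-+ (+ m) (+ n)

  ι-nat-* : ∀ m n → ι (+ (m ℕ.* n)) ≡ ι (+ m) * ι (+ n)
  ι-nat-* m n = trans (cong ι (ℤₚ.pos-* m n)) (ι-* (+ m) (+ n))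

  private
    square-ι : ∀ {m} n → m ≡ n ℕ.* n → ι (+ m) ≡ ι (+ n) * ι (+ n)
    square-ι n refl = ι-nat-* n n

    p-square-ι : ∀ {m} n → m ≡ p ℕ.* (n ℕ.* n) → ι (+ m) ≡ pℚ * (ι (+ n) * ι (+ n))
    p-square-ι n refl = trans (ι-nat-* p (n ℕ.* n)) (cong (pℚ *_) (ι-nat-* n n))

    shift-u : ∀ P {τ} → Torsion τ → u P ≢ 0ℚ → u (P ⊕ τ) ≢ 0ℚ
    shift-u P {τ} t h e = *-nonzero {v τ * w τ} {u P} (*-nonzero {v τ} {w τ} (unit (torsion-v² {τ} t)) (unit (torsion-w² {τ} t))) h (trans (sym (u-⊕-torsion {τ} t P)) e)
      where
      unit : ∀ {x} → x * x ≡ 1ℚ → x ≢ 0ℚ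
      unit e x≡0 = 1≢0 (trans (sym e) (cong₂ _*_ x≡0 x≡0))

  classify-positive : ∀ P {T a c} → u P ≢ 0ℚ → T ≢ 0 → v P * ι (+ T) ≡ ι (+ (T ℕ.+ (a ℕ.+ a))) →
    w P * ι (+ T) ≡ ι (+ (T ℕ.+ (a ℕ.+ c ℕ.+ (a ℕ.+ c)))) → Descent p q T a c →
    Double P ⊎ (∃ λ τ → Torsion τ × Special (P ⊕ τ))
  classify-positive P {T} {a} {c} u≢0 T≢0 eᵛ eʷ d = go d
    where
    t = ι (+ T)
    α = ι (+ a)
    κ = ι (+ c)
    t≢0 : t ≢ 0ℚ
    t≢0 = ι≢0 (λ e → T≢0 (ℤₚ.+-injective e))
    eᵛ′ : v P * t ≡ t + (α + α)
    eᵛ′ = trans eᵛ (trans (ι-nat-+ T (a ℕ.+ a)) (cong (_+_ t) (ι-nat-+ a a)))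
    eʷ′ : w P * t ≡ t + (α + κ + (α + κ))
    eʷ′ = trans eʷ (trans (ι-nat-+ T (a ℕ.+ c ℕ.+ (a ℕ.+ c))) (cong (_+_ t) (trans (ι-nat-+ (a ℕ.+ c) (a ℕ.+ c)) (cong₂ _+_ (ι-nat-+ a c) (ι-nat-+ a c)))))
    2ℚ : ℚ
    2ℚ = 1ℚ + 1ℚ
    1+v : (1ℚ + v P) * t ≡ 2ℚ * ι (+ (T ℕ.+ a))
    1+v = trans (combine (v P ∷ t ∷ α ∷ []) (λ { (v ∷ t ∷ a ∷ []) → ((lit (+ 1) :+ v) :* t := (lit (+ 1) :+ lit (+ 1)) :* (t :+ a)) ,
      (lit (+ 1) , (v :* t := t :+ (a :+ a))) ∷ [] }) eᵛ′ refl) (cong (2ℚ *_) (sym (ι-nat-+ T a)))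
    ι-TAC : ι (+ (T ℕ.+ a ℕ.+ c)) ≡ t + α + κ
    ι-TAC = trans (ι-nat-+ (T ℕ.+ a) c) (cong (_+ κ) (ι-nat-+ T a))
    ι-TAAC : ι (+ (T ℕ.+ a ℕ.+ a ℕ.+ c)) ≡ t + α + α + κ
    ι-TAAC = trans (ι-nat-+ (T ℕ.+ a ℕ.+ a) c) (cong (_+ κ) (trans (ι-nat-+ (T ℕ.+ a) a) (cong (_+ α) (ι-nat-+ T a))))
    1+w : (1ℚ + w P) * t ≡ 2ℚ * ι (+ (T ℕ.+ a ℕ.+ c))
    1+w = trans (combine (w P ∷ t ∷ α ∷ κ ∷ []) (λ { (w ∷ t ∷ a ∷ c ∷ []) → ((lit (+ 1) :+ w) :* t := (lit (+ 1) :+ lit (+ 1)) :* (t :+ a :+ c)) ,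
      (lit (+ 1) , (w :* t := t :+ (a :+ c :+ (a :+ c)))) ∷ [] }) eʷ′ refl) (cong (2ℚ *_) (sym ι-TAC))
    v+w : (v P + w P) * t ≡ 2ℚ * ι (+ (T ℕ.+ a ℕ.+ a ℕ.+ c))
    v+w = trans (combine (v P ∷ w P ∷ t ∷ α ∷ κ ∷ []) (λ { (v ∷ w ∷ t ∷ a ∷ c ∷ []) → ((v :+ w) :* t := (lit (+ 1) :+ lit (+ 1)) :* (t :+ a :+ a :+ c)) ,
      (lit (+ 1) , (v :* t := t :+ (a :+ a))) ∷ (lit (+ 1) , (w :* t := t :+ (a :+ c :+ (a :+ c)))) ∷ [] }) (eᵛ′ , eʷ′) refl) (cong (2ℚ *_) (sym ι-TAAC))
    -- Adding this point negates `v` and `w`, so half sums with `T` are exchanged for negated half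
    -- differences.
    σ-point = torsion-point (- 1ℚ) (- 1ℚ) refl refl
    σ = proj₁ σ-point
    tσ : Torsion σ
    tσ = refl
    P′ = P ⊕ σ
    v′ : v P′ ≡ - 1ℚ * v P
    v′ = v-⊕-torsion {σ} refl P
    w′ : w P′ ≡ - 1ℚ * w P
    w′ = w-⊕-torsion {σ} refl P
    1+v′ : (1ℚ + v P′) * t ≡ - 2ℚ * ι (+ a)
    1+v′ = trans (cong (λ x → (1ℚ + x) * t) v′) (combine (v P ∷ t ∷ α ∷ []) (λ { (v ∷ t ∷ a ∷ []) →
      ((lit (+ 1) :+ :- lit (+ 1) :* v) :* t := :- (lit (+ 1) :+ lit (+ 1)) :* a) , (:- lit (+ 1) , (v :* t := t :+ (a :+ a))) ∷ [] }) eᵛ′ refl)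
    1+w′ : (1ℚ + w P′) * t ≡ - 2ℚ * ι (+ (a ℕ.+ c))
    1+w′ = trans (cong (λ x → (1ℚ + x) * t) w′) (trans (combine (w P ∷ t ∷ α ∷ κ ∷ []) (λ { (w ∷ t ∷ a ∷ c ∷ []) →
      ((lit (+ 1) :+ :- lit (+ 1) :* w) :* t := :- (lit (+ 1) :+ lit (+ 1)) :* (a :+ c)) , (:- lit (+ 1) , (w :* t := t :+ (a :+ c :+ (a :+ c)))) ∷ [] }) eʷ′ refl)
      (cong (- 2ℚ *_) (sym (ι-nat-+ a c))))
    v+w′ : (v P′ + w P′) * t ≡ - 2ℚ * ι (+ (T ℕ.+ a ℕ.+ a ℕ.+ c))
    v+w′ = trans (cong₂ (λ x y → (x + y) * t) v′ w′) (trans (combine (v P ∷ w P ∷ t ∷ α ∷ κ ∷ []) (λ { (v ∷ w ∷ t ∷ a ∷ c ∷ []) →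
      ((:- lit (+ 1) :* v :+ :- lit (+ 1) :* w) :* t := :- (lit (+ 1) :+ lit (+ 1)) :* (t :+ a :+ a :+ c)) ,
      (:- lit (+ 1) , (v :* t := t :+ (a :+ a))) ∷ (:- lit (+ 1) , (w :* t := t :+ (a :+ c :+ (a :+ c)))) ∷ [] }) (eᵛ′ , eʷ′) refl)
      (cong (- 2ℚ *_) (sym ι-TAAC)))
    u′≢0 : u P′ ≢ 0ℚ
    u′≢0 = shift-u P {σ} tσ u≢0
    go : Descent p q T a c → Double P ⊎ (∃ λ τ → Torsion τ × Special (P ⊕ τ))
    go (halvable₁ A B C hA hB hC) =
      inj₁ (double-from-squares P u≢0 {t} {2ℚ} {ι (+ (T ℕ.+ a))} {ι (+ (T ℕ.+ a ℕ.+ c))} t≢0 refl 1+v 1+w {ι (+ (T ℕ.+ a ℕ.+ a ℕ.+ c))} {ι (+ A)} {ι (+ B)} {ι (+ C)} v+w (square-ι A hA) (square-ι B hB) (square-ι C hC))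
    go (halvable₂ A B C hA hB hC) =
      inj₁ (double-shift {P} {σ} tσ (double-from-squares P′ u′≢0 {t} { - 2ℚ} {ι (+ a)} {ι (+ (a ℕ.+ c))} t≢0 refl 1+v′ 1+w′ {ι (+ (T ℕ.+ a ℕ.+ a ℕ.+ c))} {ι (+ A)} {ι (+ B)} {ι (+ C)} v+w′ (square-ι A hA) (square-ι B hB) (square-ι C hC)))
    go (unhalvable₁ A B hA hB) =
      inj₂ (𝟘 , refl , subst Special (trans (sym (⊕-identityˡ P)) (⊕-comm 𝟘 P)) (special-from-squares P u≢0 {t} {2ℚ} {ι (+ (T ℕ.+ a))} {ι (+ (T ℕ.+ a ℕ.+ c))} t≢0 refl 1+v 1+w {ι (+ A)} {ι (+ B)} (p-square-ι A hA) (square-ι B hB)))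
    go (unhalvable₂ A B hA hB) =
      inj₂ (σ , tσ , special-from-squares P′ u′≢0 {t} { - 2ℚ} {ι (+ a)} {ι (+ (a ℕ.+ c))} t≢0 refl 1+v′ 1+w′ {ι (+ A)} {ι (+ B)} (p-square-ι A hA) (square-ι B hB))

  private
    -- A translate by a torsion point has v, w > 0.
    classify-representative : ∀ P → u P ≢ 0ℚ → (r : Representative P) → let open Representative r in
      (∃ λ a → ∃ λ c → ℤ.∣ V ∣ ≡ T ℕ.+ (a ℕ.+ a) × ℤ.∣ W ∣ ≡ T ℕ.+ (a ℕ.+ c ℕ.+ (a ℕ.+ c)) × Descent p q T a c) →
      Double P ⊎ (∃ λ τ → Torsion τ × Special (P ⊕ τ))
    classify-representative P u≢0 record { T = T ; V = V ; W = W ; coords = coords } (a , c , V≡ , W≡ , d) =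
      translate (torsion-point (sgn V) (sgn W) (sgn² V) (sgn² W))
      where
      back : ∀ τ → Torsion τ → Double (P ⊕ τ) ⊎ (∃ λ σ → Torsion σ × Special ((P ⊕ τ) ⊕ σ)) →
        Double P ⊎ (∃ λ τ → Torsion τ × Special (P ⊕ τ))
      back τ tτ (inj₁ D) = inj₁ (double-shift {P} {τ} tτ D)
      back τ tτ (inj₂ (σ , tσ , S)) = inj₂ (τ ⊕ σ , torsion-⊕ {τ} {σ} tτ tσ , subst Special (⊕-assoc P τ σ) S)
      absolute : ∀ {x y X n} → x * ι (+ T) ≡ ι X → y ≡ sgn X * x → ℤ.∣ X ∣ ≡ n → y * ι (+ T) ≡ ι (+ n)
      absolute {x} {X = X} e refl refl = trans (ℚₚ.*-assoc (sgn X) x (ι (+ T))) (trans (cong (sgn X *_) e) (sgn-abs X))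
      translate : (∃ λ τ → Torsion τ × v τ ≡ sgn V × w τ ≡ sgn W) → Double P ⊎ (∃ λ τ → Torsion τ × Special (P ⊕ τ))
      translate (τ , tτ , vτ , wτ) = back τ tτ (classify-positive (P ⊕ τ) {T} {a} {c} (shift-u P {τ} tτ u≢0)
        (λ { refl → Coordinates.T≢0 coords refl })
        (absolute {X = V} (Coordinates.vT coords) (trans (v-⊕-torsion {τ} tτ P) (cong (_* v P) vτ)) V≡)
        (absolute {X = W} (Coordinates.wT coords) (trans (w-⊕-torsion {τ} tτ P) (cong (_* w P) wτ)) W≡) d)

  classify : ∀ P → Double P ⊎ (∃ λ τ → Torsion τ × Special (P ⊕ τ))
  classify P = go (u P ℚₚ.≟ 0ℚ)
    where
    go : Dec (u P ≡ 0ℚ) → Double P ⊎ (∃ λ τ → Torsion τ × Special (P ⊕ τ))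
    go (yes u≡0) = inj₁ (𝟘 , P , u≡0 , trans (cong (_⊕ P) (⊕-identityˡ 𝟘)) (⊕-identityˡ P))
    go (no u≢0) = classify-representative P u≢0 (representative P)
      (concordant-descent pp pq (Representative.isConcordant (representative P)) p3)

-- The two classes are distinct, and height inequalities

module Heights (p : ℕ) (pp : Prime p) (pq : Prime (p ℕ.+ 2)) (p3 : p % 8 ≡ 3) where
  open import Data.Rational using (_+_; _*_; -_; _-_)
  open RationalIntegers
  open Arithmetic using (coprime-squares)
  open ConcordantForms
  open ≡-Field ℚ-field using (1≢0)
  open FieldProperties ℚ-field
  open Solver ℚ-ring using (ring; combine)
  open Solver ℤ-ring using () renaming (ring to ℤring; combine to ℤcombine)
  open ≡-Reasoning
  open Twin p pp pq p3

  negative-integer-nonsquare : ∀ n → n ≢ 0 → NonSquare (ℤ.- (+ n))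
  negative-integer-nonsquare zero n≢0 = ⊥-elim (n≢0 refl)
  negative-integer-nonsquare (suc n) _ = negative-nonsquare {n}

  p≢0 : p ≢ 0
  p≢0 refl = ¬prime[0] pp

  pq≢0 : p ℕ.* q ≢ 0
  pq≢0 e with ℕₚ.m*n≡0⇒m≡0∨n≡0 p e
  ... | inj₁ h = p≢0 h
  ... | inj₂ h = ℕₚ.m+1+n≢0 p h

  -pqℚ : ι (ℤ.- (+ (p ℕ.* q))) ≡ - (pℚ * qℚ)
  -pqℚ = trans (ι-neg (+ (p ℕ.* q))) (cong -_ (sym pqℚ))

  -- Otherwise `p` would be 1, `p q`, `- p` or `- q` times a square, whereas `p`, `q`, `- 1` and
  -- `- p q` are not squares.
  square-not-special : ∀ P {τ r} → Torsion τ → u P ≢ 0ℚ → r * r ≡ δ P → ¬ Special (P ⊕ τ)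
  square-not-special P {τ} {r} tτ u≢0 er (x , x≢0 , ex) = *-nonzero r≢0 x≢0 (vanishes (δ-torsion P {τ} tτ))
    where
    r≢0 : r ≢ 0ℚ
    r≢0 = *-nonzeroˡ (subst (_≢ 0ℚ) (sym er) (δ≢0 P u≢0))
    y = r * x
    product : ∀ {k z} → δ P * δ (P ⊕ τ) ≡ k * (z * z) → pℚ * (y * y) ≡ k * (z * z)
    product {k} {z} e = begin
      pℚ * (y * y)             ≡⟨ ring (pℚ ∷ r ∷ x ∷ []) (λ { (p ∷ r ∷ x ∷ []) → p :* (r :* x :* (r :* x)) := r :* r :* (p :* (x :* x)) }) refl ⟩
      r * r * (pℚ * (x * x))   ≡⟨ cong₂ _*_ er (sym ex) ⟩
      δ P * δ (P ⊕ τ)          ≡⟨ e ⟩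
      k * (z * z)              ∎
    vanishes : (∃ λ k → ∃ λ z → Torsion-δ k × δ P * δ (P ⊕ τ) ≡ k * (z * z)) → y ≡ 0ℚ
    vanishes (_ , z , δ-1 , e) = nonsquare (prime-nonsquare pp) z y
      (trans (sym (ℚₚ.*-identityˡ (z * z))) (sym (product {1ℚ} {z} e)))
    vanishes (_ , z , δ-pq , e) = nonsquare (prime-nonsquare pq) (qℚ * z) y (*-cancelʳ pℚ pℚ≢0
      (combine (pℚ ∷ qℚ ∷ y ∷ z ∷ []) (λ { (p ∷ q ∷ y ∷ z ∷ []) → (q :* z :* (q :* z) :* p := q :* (y :* y) :* p) ,
        (:- q , (p :* (y :* y) := p :* q :* (z :* z))) ∷ [] }) (product {pℚ * qℚ} {z} e) refl))
    vanishes (_ , z , δ--p , e) = nonsquare (negative-nonsquare {0}) z y (*-cancelʳ pℚ pℚ≢0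
      (combine (pℚ ∷ y ∷ z ∷ []) (λ { (p ∷ y ∷ z ∷ []) → (z :* z :* p := lit -[1+ 0 ] :* (y :* y) :* p) ,
        (lit (+ 1) , (p :* (y :* y) := :- p :* (z :* z))) ∷ [] }) (product { - pℚ} {z} e) refl))
    vanishes (_ , z , δ--q , e) = nonsquare (negative-integer-nonsquare (p ℕ.* q) pq≢0) (qℚ * z) y (trans
      (combine (pℚ ∷ qℚ ∷ y ∷ z ∷ []) (λ { (p ∷ q ∷ y ∷ z ∷ []) → (q :* z :* (q :* z) := :- (p :* q) :* (y :* y)) ,
        (q , (p :* (y :* y) := :- q :* (z :* z))) ∷ [] }) (product { - qℚ} {z} e) refl) (cong (_* (y * y)) (sym -pqℚ)))

  -- The classes of `P` and `Q` cancel, so `δ` of the sum is a square. Halving would ask for a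
  -- second square; instead, the classification leaves `Double` as the only possibility.
  special-sum : ∀ P Q → Special P → Special Q → Double (P ⊕ Q)
  special-sum P Q (x , x≢0 , ex) (y , y≢0 , ey) = go (u (P ⊕ Q) ℚₚ.≟ 0ℚ) (classify (P ⊕ Q))
    where
    root : ∃ λ r → r * r ≡ δ (P ⊕ Q)
    root = δ-⊕-square (λ ()) P Q x≢0 y≢0 pℚ≢0 ex ey
    go : Dec (u (P ⊕ Q) ≡ 0ℚ) → Double (P ⊕ Q) ⊎ (∃ λ τ → Torsion τ × Special (P ⊕ Q ⊕ τ)) → Double (P ⊕ Q)
    go _ (inj₁ D) = D
    go (yes t) (inj₂ _) = 𝟘 , P ⊕ Q , t , trans (cong (_⊕ (P ⊕ Q)) (⊕-identityˡ 𝟘)) (⊕-identityˡ (P ⊕ Q))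
    go (no u≢0) (inj₂ (τ , tτ , S)) = ⊥-elim (square-not-special (P ⊕ Q) {τ} {proj₁ root} tτ u≢0 (proj₂ root) S)

  height : J → ℕ
  height P = ℤ.∣ Representative.W (representative P) ∣

  T-nonzero : ∀ {P} (r : Representative P) → Representative.T r ≢ 0
  T-nonzero r T≡0 = Coordinates.T≢0 (Representative.coords r) (cong (λ n → ι (+ n)) T≡0)

  height≢0 : ∀ P → height P ≢ 0
  height≢0 P e = T-nonzero (representative P) (ℕₚ.m*n≡0⇒m≡0 T T {{ℕ.≢-nonZero (T-nonzero (representative P))}}
    (ℕₚ.m+n≡0⇒m≡0 (T ℕ.* T) (trans (Concordant.norm-q isConcordant) (cong (λ n → n ℕ.* n) e))))
    where open Representative (representative P)

  -- The `T` and `W` of the representative are coprime, so its `W` is the numerator of `w P` in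
  -- lowest terms and divides every other numerator.
  height-minimal : ∀ P T W → T ≢ 0 → w P * ι (+ T) ≡ ι W → height P ℕ.≤ ℤ.∣ W ∣
  height-minimal P T′ W′ T′≢0 e = ∣.∣⇒≤ {{ℕ.≢-nonZero W′≢0}} W∣W′
    where
    open Representative (representative P)
    cross : ℤ.∣ W ∣ ℕ.* T′ ≡ T ℕ.* ℤ.∣ W′ ∣
    cross = trans (sym (ℤₚ.abs-* W (+ T′))) (trans (cong ℤ.∣_∣ (ι-injective {W ℤ.* + T′} {+ T ℤ.* W′} (begin
      ι (W ℤ.* + T′)               ≡⟨ ι-* W (+ T′) ⟩
      ι W * ι (+ T′)               ≡⟨ cong (_* ι (+ T′)) (sym (Coordinates.wT coords)) ⟩
      w P * ι (+ T) * ι (+ T′)     ≡⟨ ring (w P ∷ ι (+ T) ∷ ι (+ T′) ∷ []) (λ { (w ∷ t ∷ t′ ∷ []) → w :* t :* t′ := t :* (w :* t′) }) refl ⟩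
      ι (+ T) * (w P * ι (+ T′))   ≡⟨ cong (ι (+ T) *_) e ⟩
      ι (+ T) * ι W′               ≡⟨ sym (ι-* (+ T) W′) ⟩
      ι (+ T ℤ.* W′)               ∎))) (ℤₚ.abs-* (+ T) W′))
    W∣W′ : ℤ.∣ W ∣ ∣ ℤ.∣ W′ ∣
    W∣W′ = coprime-divisor (Coprimality.sym (coprime-TW pp pq isConcordant)) (subst (ℤ.∣ W ∣ ∣_) cross (m∣m*n T′))
    W′≢0 : ℤ.∣ W′ ∣ ≢ 0
    W′≢0 h = height≢0 P (ℕₚ.m*n≡0⇒m≡0 ℤ.∣ W ∣ T′ {{ℕ.≢-nonZero T′≢0}} (trans cross (trans (cong (T ℕ.*_) h) (ℕₚ.*-zeroʳ T))))

  height-shift : ∀ P {τ} → Torsion τ → height (P ⊕ τ) ℕ.≤ height P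
  height-shift P {τ} tτ = go (torsion-w {τ} tτ)
    where
    open Representative (representative P)
    bound : ∀ W′ → w (P ⊕ τ) * ι (+ T) ≡ ι W′ → ℤ.∣ W′ ∣ ≡ height P → height (P ⊕ τ) ℕ.≤ height P
    bound W′ e h = subst (height (P ⊕ τ) ℕ.≤_) h (height-minimal (P ⊕ τ) T W′ (T-nonzero (representative P)) e)
    scaled : ∀ {x} → w τ ≡ x → w (P ⊕ τ) * ι (+ T) ≡ x * ι W
    scaled {x} e = trans (cong (_* ι (+ T)) (trans (w-⊕-torsion {τ} tτ P) (cong (_* w P) e)))
      (trans (ℚₚ.*-assoc x (w P) (ι (+ T))) (cong (x *_) (Coordinates.wT coords)))
    go : w τ ≡ 1ℚ ⊎ w τ ≡ - 1ℚ → height (P ⊕ τ) ℕ.≤ height P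
    go (inj₁ e) = bound W (trans (scaled e) (ℚₚ.*-identityˡ (ι W))) refl
    go (inj₂ e) = bound (ℤ.- W) (trans (scaled e) (trans (ring (ι W ∷ []) (λ { (x ∷ []) → :- lit (+ 1) :* x := :- x }) refl) (sym (ι-neg W)))) (ℤₚ.∣-i∣≡∣i∣ W)

  height-unshift : ∀ P {τ} → Torsion τ → height P ℕ.≤ height (P ⊕ τ)
  height-unshift P {τ} tτ = subst (λ Q → height Q ℕ.≤ height (P ⊕ τ)) (⊕-torsion-involutive P {τ} tτ) (height-shift (P ⊕ τ) {τ} tτ)

  ι-abs-square : ∀ {x} i → x ≡ ι i → ι (+ (ℤ.∣ i ∣ ℕ.* ℤ.∣ i ∣)) ≡ x * x
  ι-abs-square i refl = trans (cong ι (sym (square-abs i))) (ι-* i i)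

  private
    q-nonZero : ℕ.NonZero q
    q-nonZero = ℕ.≢-nonZero (ℕₚ.m+1+n≢0 p)

    p≤q : p ℕ.≤ q
    p≤q = ℕₚ.m≤m+n p 2

  -- The numerator `n = T² W² + q U² V²` of `w (2R)` has no cancelling terms, and `W² ≤ q V²` gives
  -- `W⁴ ≤ q n`. Little is lost on reduction to lowest terms: the sums of denominator and numerators
  -- are twice `T² V²`, `T² W²` and `V² W²`, so `n` divides `2 H(2R)` times each of these; as `T`,
  -- `V` and `W` are pairwise coprime, it divides `2 H(2R)`.
  double-height : ∀ R → (height R ℕ.* height R) ℕ.* (height R ℕ.* height R) ℕ.≤ q ℕ.* (2 ℕ.* height (R ⊕ R))
  double-height R = ℕₚ.≤-trans quartic (ℕₚ.*-monoʳ-≤ q (∣.∣⇒≤ {{ℕ.≢-nonZero 2H′≢0}} n∣2H′))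
    where
    open Representative (representative R)
    open Concordant isConcordant using (norm-p; norm-q)
    module R₂ = Representative (representative (R ⊕ R))
    H′ = height (R ⊕ R)
    x = T ℕ.* T
    y = ℤ.∣ U ∣ ℕ.* ℤ.∣ U ∣
    a = ℤ.∣ V ∣ ℕ.* ℤ.∣ V ∣
    b = ℤ.∣ W ∣ ℕ.* ℤ.∣ W ∣
    n = x ℕ.* b ℕ.+ q ℕ.* (y ℕ.* a)
    2H′≢0 : 2 ℕ.* H′ ≢ 0
    2H′≢0 e with ℕₚ.m*n≡0⇒m≡0∨n≡0 2 e
    ... | inj₂ h = height≢0 (R ⊕ R) h
    module c = Coordinates coords
    module c₂ = Coordinates R₂.coords
    b≤qa : b ℕ.≤ q ℕ.* a
    b≤qa = subst₂ ℕ._≤_ norm-q (trans (sym (ℕₚ.*-distribˡ-+ q x (p ℕ.* y))) (cong (q ℕ.*_) norm-p))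
      (ℕₚ.+-mono-≤ (ℕₚ.m≤n*m x q {{q-nonZero}}) (ℕₚ.*-monoʳ-≤ q (ℕₚ.m≤n*m y p {{ℕ.≢-nonZero p≢0}})))
    quartic : b ℕ.* b ℕ.≤ q ℕ.* n
    quartic = subst₂ ℕ._≤_ (trans (regroup x q y b) (cong (ℕ._* b) norm-q)) (sym (ℕₚ.*-distribˡ-+ q (x ℕ.* b) (q ℕ.* (y ℕ.* a))))
      (ℕₚ.+-mono-≤ (ℕₚ.m≤n*m (x ℕ.* b) q {{q-nonZero}})
        (ℕₚ.*-monoʳ-≤ q (ℕₚ.≤-trans (ℕₚ.*-monoʳ-≤ y b≤qa) (ℕₚ.≤-reflexive (swap y q a)))))
      where
      regroup : ∀ x q y b → x ℕ.* b ℕ.+ q ℕ.* (y ℕ.* b) ≡ (x ℕ.+ q ℕ.* y) ℕ.* b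
      regroup = solve-∀
      swap : ∀ y q a → y ℕ.* (q ℕ.* a) ≡ q ℕ.* (y ℕ.* a)
      swap = solve-∀
    t = ι (+ T)
    d = D R R
    nᵛ = Nᵛ R R
    nʷ = Nʷ R R
    vv = v R * v R
    ww = w R * w R
    t₂ = ι (+ R₂.T)
    v₂ = v (R ⊕ R)
    w₂ = w (R ⊕ R)
    t⁴ = t * t * (t * t)
    ι-x : ι (+ x) ≡ t * t
    ι-x = ι-nat-* T T
    ι-y : ι (+ y) ≡ u R * t * (u R * t)
    ι-y = ι-abs-square U c.uT
    ι-a : ι (+ a) ≡ v R * t * (v R * t)
    ι-a = ι-abs-square V c.vT
    ι-b : ι (+ b) ≡ w R * t * (w R * t)
    ι-b = ι-abs-square W c.wT
    ι-xa : ι (+ (x ℕ.* a)) ≡ t⁴ * vv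
    ι-xa = trans (ι-nat-* x a) (trans (cong₂ _*_ ι-x ι-a) (ring (t ∷ v R ∷ []) (λ { (t ∷ v ∷ []) → t :* t :* (v :* t :* (v :* t)) := t :* t :* (t :* t) :* (v :* v) }) refl))
    ι-xb : ι (+ (x ℕ.* b)) ≡ t⁴ * ww
    ι-xb = trans (ι-nat-* x b) (trans (cong₂ _*_ ι-x ι-b) (ring (t ∷ w R ∷ []) (λ { (t ∷ v ∷ []) → t :* t :* (v :* t :* (v :* t)) := t :* t :* (t :* t) :* (v :* v) }) refl))
    ι-ab : ι (+ (a ℕ.* b)) ≡ t⁴ * (vv * ww)
    ι-ab = trans (ι-nat-* a b) (trans (cong₂ _*_ ι-a ι-b) (ring (t ∷ v R ∷ w R ∷ []) (λ { (t ∷ v ∷ w ∷ []) →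
      v :* t :* (v :* t) :* (w :* t :* (w :* t)) := t :* t :* (t :* t) :* (v :* v :* (w :* w)) }) refl))
    ι-n : ι (+ n) ≡ t⁴ * nʷ
    ι-n = trans (ι-nat-+ (x ℕ.* b) (q ℕ.* (y ℕ.* a))) (trans (cong₂ _+_ ι-xb (trans (ι-nat-* q (y ℕ.* a)) (cong (qℚ *_) (trans (ι-nat-* y a) (cong₂ _*_ ι-y ι-a)))))
      (ring (t ∷ u R ∷ v R ∷ w R ∷ qℚ ∷ []) (λ { (t ∷ u ∷ v ∷ w ∷ q ∷ []) →
        t :* t :* (t :* t) :* (w :* w) :+ q :* (u :* t :* (u :* t) :* (v :* t :* (v :* t))) := t :* t :* (t :* t) :* (w :* w :+ q :* (u :* v :* (u :* v))) }) refl))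
    hᵛ : v₂ * d ≡ nᵛ
    hᵛ = v-⊕ R R
    hʷ : w₂ * d ≡ nʷ
    hʷ = w-⊕ R R
    h₁ : d + nᵛ ≡ vv + vv
    h₁ = solve₁ R (λ { (v ∷ w ∷ u ∷ p ∷ q ∷ []) → lit (+ 1) :- p :* q :* (u :* u :* (u :* u)) :+ (v :* v :+ p :* (u :* w :* (u :* w))) := v :* v :+ v :* v }) refl
    h₂ : d + nʷ ≡ ww + ww
    h₂ = solve₁ R (λ { (v ∷ w ∷ u ∷ p ∷ q ∷ []) → lit (+ 1) :- p :* q :* (u :* u :* (u :* u)) :+ (w :* w :+ q :* (u :* v :* (u :* v))) := w :* w :+ w :* w }) refl
    h₃ : nᵛ + nʷ ≡ vv * ww + vv * ww
    h₃ = solve₁ R (λ { (v ∷ w ∷ u ∷ p ∷ q ∷ []) → v :* v :+ p :* (u :* w :* (u :* w)) :+ (w :* w :+ q :* (u :* v :* (u :* v))) := v :* v :* (w :* w) :+ v :* v :* (w :* w) }) refl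
    divisor : ∀ z k {X Y} → ι (+ z) ≡ X → ι k ≡ Y → ι (+ 2) * (w₂ * t₂) * X ≡ Y * (t⁴ * nʷ) → n ∣ z ℕ.* (2 ℕ.* H′)
    divisor z k {X} {Y} ez ek e = divides ℤ.∣ k ∣ (begin
      z ℕ.* (2 ℕ.* H′)                 ≡⟨ ℕₚ.*-comm z (2 ℕ.* H′) ⟩
      2 ℕ.* H′ ℕ.* z                   ≡⟨ cong (ℕ._* z) (sym (ℤₚ.abs-* (+ 2) R₂.W)) ⟩
      ℤ.∣ + 2 ℤ.* R₂.W ∣ ℕ.* z         ≡⟨ sym (ℤₚ.abs-* (+ 2 ℤ.* R₂.W) (+ z)) ⟩
      ℤ.∣ + 2 ℤ.* R₂.W ℤ.* + z ∣       ≡⟨ cong ℤ.∣_∣ (ι-injective {+ 2 ℤ.* R₂.W ℤ.* + z} {k ℤ.* + n} (trans (ι-* (+ 2 ℤ.* R₂.W) (+ z)) (trans (cong₂ _*_ (trans (ι-* (+ 2) R₂.W) (cong (ι (+ 2) *_) (sym c₂.wT))) ez)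
                                          (trans e (trans (cong₂ _*_ (sym ek) (sym ι-n)) (sym (ι-* k (+ n)))))))) ⟩
      ℤ.∣ k ℤ.* + n ∣                  ≡⟨ ℤₚ.abs-* k (+ n) ⟩
      ℤ.∣ k ∣ ℕ.* n                    ∎)
    n∣xa : n ∣ x ℕ.* a ℕ.* (2 ℕ.* H′)
    n∣xa = divisor (x ℕ.* a) (+ R₂.T ℤ.+ R₂.V) ι-xa (trans (ι-+ (+ R₂.T) R₂.V) (cong (_+_ t₂) (sym c₂.vT)))
      (combine (d ∷ nᵛ ∷ nʷ ∷ vv ∷ v₂ ∷ w₂ ∷ t₂ ∷ t⁴ ∷ []) (λ { (d ∷ nᵛ ∷ nʷ ∷ vv ∷ v₂ ∷ w₂ ∷ t₂ ∷ t⁴ ∷ []) →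
        (lit (+ 2) :* (w₂ :* t₂) :* (t⁴ :* vv) := (t₂ :+ v₂ :* t₂) :* (t⁴ :* nʷ)) ,
        (t₂ :* t⁴ :* (lit (+ 1) :+ v₂) , (w₂ :* d := nʷ)) ∷ (:- (t₂ :* t⁴ :* w₂) , (d :+ nᵛ := vv :+ vv)) ∷
        (:- (t₂ :* t⁴ :* w₂) , (v₂ :* d := nᵛ)) ∷ [] }) (hʷ , h₁ , hᵛ) refl)
    n∣xb : n ∣ x ℕ.* b ℕ.* (2 ℕ.* H′)
    n∣xb = divisor (x ℕ.* b) (+ R₂.T ℤ.+ R₂.W) ι-xb (trans (ι-+ (+ R₂.T) R₂.W) (cong (_+_ t₂) (sym c₂.wT)))
      (combine (d ∷ nʷ ∷ ww ∷ w₂ ∷ t₂ ∷ t⁴ ∷ []) (λ { (d ∷ nʷ ∷ ww ∷ w₂ ∷ t₂ ∷ t⁴ ∷ []) →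
        (lit (+ 2) :* (w₂ :* t₂) :* (t⁴ :* ww) := (t₂ :+ w₂ :* t₂) :* (t⁴ :* nʷ)) ,
        (t₂ :* t⁴ , (w₂ :* d := nʷ)) ∷ (:- (t₂ :* t⁴ :* w₂) , (d :+ nʷ := ww :+ ww)) ∷ [] }) (hʷ , h₂) refl)
    n∣ab : n ∣ a ℕ.* b ℕ.* (2 ℕ.* H′)
    n∣ab = divisor (a ℕ.* b) (R₂.V ℤ.+ R₂.W) ι-ab (trans (ι-+ R₂.V R₂.W) (cong₂ _+_ (sym c₂.vT) (sym c₂.wT)))
      (combine (d ∷ nᵛ ∷ nʷ ∷ vv ∷ ww ∷ v₂ ∷ w₂ ∷ t₂ ∷ t⁴ ∷ []) (λ { (d ∷ nᵛ ∷ nʷ ∷ vv ∷ ww ∷ v₂ ∷ w₂ ∷ t₂ ∷ t⁴ ∷ []) →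
        (lit (+ 2) :* (w₂ :* t₂) :* (t⁴ :* (vv :* ww)) := (v₂ :* t₂ :+ w₂ :* t₂) :* (t⁴ :* nʷ)) ,
        (t₂ :* t⁴ :* v₂ , (w₂ :* d := nʷ)) ∷ (:- (t₂ :* t⁴ :* w₂) , (v₂ :* d := nᵛ)) ∷
        (:- (t₂ :* t⁴ :* w₂) , (nᵛ :+ nʷ := vv :* ww :+ vv :* ww)) ∷ [] }) (hʷ , hᵛ , h₃) refl)
    n∣2H′ : n ∣ 2 ℕ.* H′
    n∣2H′ = coprime-factors {x} {a} (coprime-squares (coprime-TV pp pq isConcordant))
      ( coprime-factors {a} {b} (coprime-squares (coprime-VW pp pq isConcordant))
          (subst (n ∣_) (rotate x a (2 ℕ.* H′)) n∣xa , subst (n ∣_) (rotate x b (2 ℕ.* H′)) n∣xb)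
      , coprime-factors {x} {b} (coprime-squares (coprime-TW pp pq isConcordant))
          (subst (n ∣_) (ℕₚ.*-assoc x a (2 ℕ.* H′)) n∣xa , subst (n ∣_) (rotate a b (2 ℕ.* H′)) n∣ab) )
      where
      rotate : ∀ x a h → x ℕ.* a ℕ.* h ≡ a ℕ.* (x ℕ.* h)
      rotate = solve-∀

  -- Up to scaling, `w (P ± Q)` are the roots of an integral quadratic with coefficients `Dz`, `Sz`,
  -- `N`. The product of the linear forms with coprime coefficients `(T , W)` of the two points has
  -- the same roots and is primitive by Gauss's lemma, so its constant term `W₊ W₋` divides `N`.
  -- Replacing `p` by `q` in `N` bounds it by `W₁² W₂²`.
  parallelogram : ∀ P Q → height (P ⊕ Q) ℕ.* height (P ⊕ ⊖ Q) ℕ.≤ (height P ℕ.* height P) ℕ.* (height Q ℕ.* height Q)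
  parallelogram P Q = ℕₚ.≤-trans (∣.∣⇒≤ {{ℕ.≢-nonZero N≢0}} n∣N) N≤
    where
    module P = Representative (representative P)
    module Q = Representative (representative Q)
    module S = Representative (representative (P ⊕ Q))
    module M = Representative (representative (P ⊕ ⊖ Q))
    module cP = Coordinates P.coords
    module cQ = Coordinates Q.coords
    module cS = Coordinates S.coords
    module cM = Coordinates M.coords
    x₁ = P.T ℕ.* P.T
    x₂ = Q.T ℕ.* Q.T
    y₁ = ℤ.∣ P.U ∣ ℕ.* ℤ.∣ P.U ∣
    y₂ = ℤ.∣ Q.U ∣ ℕ.* ℤ.∣ Q.U ∣
    N = x₁ ℕ.* x₂ ℕ.+ q ℕ.* (y₁ ℕ.* x₂ ℕ.+ y₂ ℕ.* x₁) ℕ.+ p ℕ.* q ℕ.* (y₁ ℕ.* y₂)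
    n = height (P ⊕ Q) ℕ.* height (P ⊕ ⊖ Q)
    N≢0 : N ≢ 0
    N≢0 e with ℕₚ.m*n≡0⇒m≡0∨n≡0 x₁ (ℕₚ.m+n≡0⇒m≡0 (x₁ ℕ.* x₂) (ℕₚ.m+n≡0⇒m≡0 (x₁ ℕ.* x₂ ℕ.+ q ℕ.* (y₁ ℕ.* x₂ ℕ.+ y₂ ℕ.* x₁)) e))
    ... | inj₁ h = T-nonzero (representative P) (ℕₚ.m*n≡0⇒m≡0 P.T P.T {{ℕ.≢-nonZero (T-nonzero (representative P))}} h)
    ... | inj₂ h = T-nonzero (representative Q) (ℕₚ.m*n≡0⇒m≡0 Q.T Q.T {{ℕ.≢-nonZero (T-nonzero (representative Q))}} h)
    N≤ : N ℕ.≤ (height P ℕ.* height P) ℕ.* (height Q ℕ.* height Q)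
    N≤ = subst (N ℕ.≤_) (trans (expand x₁ x₂ y₁ y₂ q) (cong₂ ℕ._*_ (Concordant.norm-q P.isConcordant) (Concordant.norm-q Q.isConcordant)))
      (ℕₚ.+-monoʳ-≤ (x₁ ℕ.* x₂ ℕ.+ q ℕ.* (y₁ ℕ.* x₂ ℕ.+ y₂ ℕ.* x₁)) (ℕₚ.*-monoˡ-≤ (y₁ ℕ.* y₂) (ℕₚ.*-monoˡ-≤ q p≤q)))
      where
      expand : ∀ x₁ x₂ y₁ y₂ q → x₁ ℕ.* x₂ ℕ.+ q ℕ.* (y₁ ℕ.* x₂ ℕ.+ y₂ ℕ.* x₁) ℕ.+ q ℕ.* q ℕ.* (y₁ ℕ.* y₂) ≡ (x₁ ℕ.+ q ℕ.* y₁) ℕ.* (x₂ ℕ.+ q ℕ.* y₂)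
      expand = solve-∀
    t₁ = ι (+ P.T)
    t₂ = ι (+ Q.T)
    t₊ = ι (+ S.T)
    t₋ = ι (+ M.T)
    w₊ = w (P ⊕ Q)
    w₋ = w (P ⊕ ⊖ Q)
    θ = t₁ * t₂ * (t₁ * t₂)
    δN = 1ℚ + qℚ * (u P * u P + u Q * u Q) + pℚ * qℚ * (u P * u Q * (u P * u Q))
    δS = w P * w Q + w P * w Q
    d = D P Q
    product : w₊ * w₋ * d ≡ δN
    product = w-⊕-product P Q
    sum : (w₊ + w₋) * d ≡ δS
    sum = w-⊕-sum P Q
    ι-x₁ : ι (+ x₁) ≡ t₁ * t₁
    ι-x₁ = ι-nat-* P.T P.T
    ι-x₂ : ι (+ x₂) ≡ t₂ * t₂
    ι-x₂ = ι-nat-* Q.T Q.T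
    ι-y₁ : ι (+ y₁) ≡ u P * t₁ * (u P * t₁)
    ι-y₁ = ι-abs-square P.U cP.uT
    ι-y₂ : ι (+ y₂) ≡ u Q * t₂ * (u Q * t₂)
    ι-y₂ = ι-abs-square Q.U cQ.uT
    ι-pqyy : ι (+ (p ℕ.* q ℕ.* (y₁ ℕ.* y₂))) ≡ pℚ * qℚ * (u P * t₁ * (u P * t₁) * (u Q * t₂ * (u Q * t₂)))
    ι-pqyy = trans (ι-nat-* (p ℕ.* q) (y₁ ℕ.* y₂)) (cong₂ _*_ (ι-nat-* p q) (trans (ι-nat-* y₁ y₂) (cong₂ _*_ ι-y₁ ι-y₂)))
    ι-xx : ι (+ (x₁ ℕ.* x₂)) ≡ t₁ * t₁ * (t₂ * t₂)
    ι-xx = trans (ι-nat-* x₁ x₂) (cong₂ _*_ ι-x₁ ι-x₂)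
    ι-N : ι (+ N) ≡ δN * θ
    ι-N = trans (ι-nat-+ (x₁ ℕ.* x₂ ℕ.+ q ℕ.* (y₁ ℕ.* x₂ ℕ.+ y₂ ℕ.* x₁)) (p ℕ.* q ℕ.* (y₁ ℕ.* y₂)))
      (trans (cong₂ _+_ (trans (ι-nat-+ (x₁ ℕ.* x₂) (q ℕ.* (y₁ ℕ.* x₂ ℕ.+ y₂ ℕ.* x₁))) (cong₂ _+_ ι-xx
          (trans (ι-nat-* q (y₁ ℕ.* x₂ ℕ.+ y₂ ℕ.* x₁)) (cong (qℚ *_) (trans (ι-nat-+ (y₁ ℕ.* x₂) (y₂ ℕ.* x₁))
            (cong₂ _+_ (trans (ι-nat-* y₁ x₂) (cong₂ _*_ ι-y₁ ι-x₂)) (trans (ι-nat-* y₂ x₁) (cong₂ _*_ ι-y₂ ι-x₁)))))))) ι-pqyy)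
      (ring (t₁ ∷ t₂ ∷ u P ∷ u Q ∷ pℚ ∷ qℚ ∷ []) (λ { (t ∷ s ∷ u ∷ v ∷ p ∷ q ∷ []) →
        t :* t :* (s :* s) :+ q :* (u :* t :* (u :* t) :* (s :* s) :+ v :* s :* (v :* s) :* (t :* t)) :+ p :* q :* (u :* t :* (u :* t) :* (v :* s :* (v :* s))) :=
        (lit (+ 1) :+ q :* (u :* u :+ v :* v) :+ p :* q :* (u :* v :* (u :* v))) :* (t :* s :* (t :* s)) }) refl))
    Dz Sz : ℤ
    Dz = + (x₁ ℕ.* x₂) ℤ.+ ℤ.- (+ (p ℕ.* q ℕ.* (y₁ ℕ.* y₂)))
    Sz = + 2 ℤ.* (P.W ℤ.* Q.W) ℤ.* (+ P.T ℤ.* + Q.T)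
    ι-Dz : ι Dz ≡ d * θ
    ι-Dz = trans (ι-+ (+ (x₁ ℕ.* x₂)) (ℤ.- (+ (p ℕ.* q ℕ.* (y₁ ℕ.* y₂))))) (trans (cong₂ _+_ ι-xx (trans (ι-neg (+ (p ℕ.* q ℕ.* (y₁ ℕ.* y₂)))) (cong -_ ι-pqyy)))
      (ring (t₁ ∷ t₂ ∷ u P ∷ u Q ∷ pℚ ∷ qℚ ∷ []) (λ { (t ∷ s ∷ u ∷ v ∷ p ∷ q ∷ []) →
        t :* t :* (s :* s) :+ :- (p :* q :* (u :* t :* (u :* t) :* (v :* s :* (v :* s)))) :=
        (lit (+ 1) :- p :* q :* (u :* v :* (u :* v))) :* (t :* s :* (t :* s)) }) refl))
    ι-Sz : ι Sz ≡ δS * θ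
    ι-Sz = trans (ι-* (+ 2 ℤ.* (P.W ℤ.* Q.W)) (+ P.T ℤ.* + Q.T)) (trans (cong₂ _*_ (trans (ι-* (+ 2) (P.W ℤ.* Q.W)) (cong (ι (+ 2) *_) (trans (ι-* P.W Q.W) (cong₂ _*_ (sym cP.wT) (sym cQ.wT))))) (ι-* (+ P.T) (+ Q.T)))
      (ring (t₁ ∷ t₂ ∷ w P ∷ w Q ∷ []) (λ { (t ∷ s ∷ a ∷ b ∷ []) → lit (+ 2) :* (a :* t :* (b :* s)) :* (t :* s) := (a :* b :+ a :* b) :* (t :* s :* (t :* s)) }) refl))
    ι-W₊ : ι S.W ≡ w₊ * t₊
    ι-W₊ = sym cS.wT
    ι-W₋ : ι M.W ≡ w₋ * t₋
    ι-W₋ = sym cM.wT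
    e₁ : + N ℤ.* (+ S.T ℤ.* + M.T) ≡ S.W ℤ.* M.W ℤ.* Dz
    e₁ = ι-injective {+ N ℤ.* (+ S.T ℤ.* + M.T)} {S.W ℤ.* M.W ℤ.* Dz}
      (trans (trans (ι-* (+ N) (+ S.T ℤ.* + M.T)) (cong₂ _*_ ι-N (ι-* (+ S.T) (+ M.T))))
      (trans (combine (δN ∷ θ ∷ t₊ ∷ t₋ ∷ w₊ ∷ w₋ ∷ d ∷ []) (λ { (N ∷ θ ∷ s ∷ m ∷ a ∷ b ∷ d ∷ []) →
          (N :* θ :* (s :* m) := a :* s :* (b :* m) :* (d :* θ)) , (:- (θ :* s :* m) , (a :* b :* d := N)) ∷ [] }) product refl)
        (sym (trans (ι-* (S.W ℤ.* M.W) Dz) (cong₂ _*_ (trans (ι-* S.W M.W) (cong₂ _*_ ι-W₊ ι-W₋)) ι-Dz)))))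
    e₂ : + N ℤ.* (S.W ℤ.* + M.T ℤ.+ M.W ℤ.* + S.T) ≡ S.W ℤ.* M.W ℤ.* Sz
    e₂ = ι-injective {+ N ℤ.* (S.W ℤ.* + M.T ℤ.+ M.W ℤ.* + S.T)} {S.W ℤ.* M.W ℤ.* Sz}
      (trans (trans (ι-* (+ N) (S.W ℤ.* + M.T ℤ.+ M.W ℤ.* + S.T)) (cong₂ _*_ ι-N (trans (ι-+ (S.W ℤ.* + M.T) (M.W ℤ.* + S.T))
          (cong₂ _+_ (trans (ι-* S.W (+ M.T)) (cong (_* t₋) ι-W₊)) (trans (ι-* M.W (+ S.T)) (cong (_* t₊) ι-W₋))))))
      (trans (combine (δN ∷ δS ∷ θ ∷ t₊ ∷ t₋ ∷ w₊ ∷ w₋ ∷ d ∷ []) (λ { (N ∷ S ∷ θ ∷ s ∷ m ∷ a ∷ b ∷ d ∷ []) →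
          (N :* θ :* (a :* s :* m :+ b :* m :* s) := a :* s :* (b :* m) :* (S :* θ)) ,
          (:- (θ :* s :* m :* (a :+ b)) , (a :* b :* d := N)) ∷ (a :* b :* θ :* s :* m , ((a :+ b) :* d := S)) ∷ [] }) (product , sum) refl)
        (sym (trans (ι-* (S.W ℤ.* M.W) Sz) (cong₂ _*_ (trans (ι-* S.W M.W) (cong₂ _*_ ι-W₊ ι-W₋)) ι-Sz)))))
    divisor : ∀ z k → + N ℤ.* z ≡ S.W ℤ.* M.W ℤ.* k → n ∣ N ℕ.* ℤ.∣ z ∣
    divisor z k e = divides ℤ.∣ k ∣ (trans (sym (ℤₚ.abs-* (+ N) z)) (trans (cong ℤ.∣_∣ e) (trans (ℤₚ.abs-* (S.W ℤ.* M.W) k)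
      (trans (ℕₚ.*-comm ℤ.∣ S.W ℤ.* M.W ∣ ℤ.∣ k ∣) (cong (ℤ.∣ k ∣ ℕ.*_) (ℤₚ.abs-* S.W M.W))))))
    abs₃ : ∀ x y → ℤ.∣ x ℤ.* (y ℤ.* y) ∣ ≡ ℤ.∣ x ∣ ℕ.* (ℤ.∣ y ∣ ℕ.* ℤ.∣ y ∣)
    abs₃ x y = trans (ℤₚ.abs-* x (y ℤ.* y)) (cong (ℤ.∣ x ∣ ℕ.*_) (ℤₚ.abs-* y y))
    multiple : ∀ x y k → + N ℤ.* (x ℤ.* (y ℤ.* y)) ≡ S.W ℤ.* M.W ℤ.* k → n ∣ ℤ.∣ x ∣ ℕ.* (N ℕ.* (ℤ.∣ y ∣ ℕ.* ℤ.∣ y ∣))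
    multiple x y k e = subst (n ∣_) (trans (cong (N ℕ.*_) (abs₃ x y)) (rotate N ℤ.∣ x ∣ _)) (divisor (x ℤ.* (y ℤ.* y)) k e)
      where
      rotate : ∀ N x y → N ℕ.* (x ℕ.* y) ≡ x ℕ.* (N ℕ.* y)
      rotate = solve-∀
    ρ : Vec ℤ 7
    ρ = + N ∷ + S.T ∷ + M.T ∷ S.W ∷ M.W ∷ Dz ∷ Sz ∷ []
    -- Gauss's lemma by hand: `n` divides `N` times each product of `T₋` or `W₋` with `T₊²` or
    -- `W₊²`, and coprimality removes first the factors from `P - Q`, then those from `P + Q`.
    m₁ : n ∣ M.T ℕ.* (N ℕ.* (S.T ℕ.* S.T))
    m₁ = multiple (+ M.T) (+ S.T) (+ S.T ℤ.* Dz) (ℤcombine ρ (λ { (N ∷ s ∷ m ∷ a ∷ b ∷ d ∷ S ∷ []) →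
      (N :* (m :* (s :* s)) := a :* b :* (s :* d)) , (s , (N :* (s :* m) := a :* b :* d)) ∷ [] }) e₁ refl)
    m₂ : n ∣ ℤ.∣ M.W ∣ ℕ.* (N ℕ.* (S.T ℕ.* S.T))
    m₂ = multiple M.W (+ S.T) (+ S.T ℤ.* Sz ℤ.+ ℤ.- (S.W ℤ.* Dz)) (ℤcombine ρ (λ { (N ∷ s ∷ m ∷ a ∷ b ∷ d ∷ S ∷ []) →
      (N :* (b :* (s :* s)) := a :* b :* (s :* S :+ :- (a :* d))) ,
      (s , (N :* (a :* m :+ b :* s) := a :* b :* S)) ∷ (:- a , (N :* (s :* m) := a :* b :* d)) ∷ [] }) (e₂ , e₁) refl)
    m₃ : n ∣ M.T ℕ.* (N ℕ.* (ℤ.∣ S.W ∣ ℕ.* ℤ.∣ S.W ∣))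
    m₃ = multiple (+ M.T) S.W (S.W ℤ.* Sz ℤ.+ ℤ.- (+ S.T ℤ.* + N)) (ℤcombine ρ (λ { (N ∷ s ∷ m ∷ a ∷ b ∷ d ∷ S ∷ []) →
      (N :* (m :* (a :* a)) := a :* b :* (a :* S :+ :- (s :* N))) , (a , (N :* (a :* m :+ b :* s) := a :* b :* S)) ∷ [] }) e₂ refl)
    m₄ : n ∣ ℤ.∣ M.W ∣ ℕ.* (N ℕ.* (ℤ.∣ S.W ∣ ℕ.* ℤ.∣ S.W ∣))
    m₄ = multiple M.W S.W (S.W ℤ.* + N) (ℤring ρ (λ { (N ∷ s ∷ m ∷ a ∷ b ∷ d ∷ S ∷ []) → N :* (b :* (a :* a)) := a :* b :* (a :* N) }) refl)
    n∣N : n ∣ N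
    n∣N = coprime-factors {S.T ℕ.* S.T} {ℤ.∣ S.W ∣ ℕ.* ℤ.∣ S.W ∣} (coprime-squares (coprime-TW pp pq S.isConcordant))
      ( subst (n ∣_) (ℕₚ.*-comm N (S.T ℕ.* S.T)) (coprime-factors (coprime-TW pp pq M.isConcordant) (m₁ , m₂))
      , subst (n ∣_) (ℕₚ.*-comm N (ℤ.∣ S.W ∣ ℕ.* ℤ.∣ S.W ∣)) (coprime-factors (coprime-TW pp pq M.isConcordant) (m₃ , m₄)) )

-- Infinite halving of independent pairs

module UpperBound (p : ℕ) (pp : Prime p) (pq : Prime (p ℕ.+ 2)) (p3 : p % 8 ≡ 3) where
  open import Data.Rational using (_+_; _*_; -_; _-_)
  open RationalIntegers
  open ConcordantForms
  open ≡-Reasoning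
  open Twin p pp pq p3
  open Heights p pp pq p3
  open Multiples (AbelianGroup.isAbelianGroup abelianGroup)

  square-≤-cancel : ∀ {m n} → m ℕ.* m ℕ.≤ n ℕ.* n → m ℕ.≤ n
  square-≤-cancel {m} {n} h with ℕₚ.≤-<-connex m n
  ... | inj₁ m≤n = m≤n
  ... | inj₂ n<m = ⊥-elim (ℕₚ.<⇒≱ (ℕₚ.*-mono-< n<m n<m) h)

  factor-≤ : ∀ {a b m} → a ℕ.* b ℕ.≤ m ℕ.* m → a ℕ.≤ m ⊎ b ℕ.≤ m
  factor-≤ {a} {b} {m} h with ℕₚ.≤-<-connex a m | ℕₚ.≤-<-connex b m
  ... | inj₁ a≤m | _ = inj₁ a≤m
  ... | inj₂ _ | inj₁ b≤m = inj₂ b≤m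
  ... | inj₂ m<a | inj₂ m<b = ⊥-elim (ℕₚ.<⇒≱ (ℕₚ.*-mono-< m<a m<b) h)

  -- The chain is `h⁴ ≤ 2q m ≤ M · M² ≤ M⁴`. It leaves room for a point of height up to `M²`, as is
  -- needed when a sum or difference is halved.
  fourth-root-bound : ∀ {h m q M} → (h ℕ.* h) ℕ.* (h ℕ.* h) ℕ.≤ q ℕ.* (2 ℕ.* m) → q ℕ.+ q ℕ.≤ M → 0 ℕ.< M →
    m ℕ.≤ M ℕ.* M → h ℕ.≤ M
  fourth-root-bound {h} {m} {q} {M} quartic 2q≤M M>0 m≤MM = square-≤-cancel (square-≤-cancel (ℕₚ.≤-trans quartic
    (ℕₚ.≤-trans (ℕₚ.≤-reflexive (double q m))
      (ℕₚ.≤-trans (ℕₚ.*-mono-≤ 2q≤M m≤MM) (ℕₚ.*-monoˡ-≤ (M ℕ.* M) (ℕₚ.m≤m*n M M {{ℕ.>-nonZero M>0}}))))))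
    where
    double : ∀ q m → q ℕ.* (2 ℕ.* m) ≡ (q ℕ.+ q) ℕ.* m
    double = solve-∀

  bound>0 : ∀ {M} → q ℕ.+ q ℕ.≤ M → 0 ℕ.< M
  bound>0 = ℕₚ.<-≤-trans (ℕₚ.≤-trans (ℕ.s≤s ℕ.z≤n) (ℕₚ.≤-trans (ℕₚ.m≤n+m 2 p) (ℕₚ.m≤m+n q q)))

  half-height : ∀ {M} R {τ Z} → q ℕ.+ q ℕ.≤ M → Torsion τ → (R ⊕ R) ⊕ τ ≡ Z → height Z ℕ.≤ M ℕ.* M → height R ℕ.≤ M
  half-height {M} R {τ} {Z} 2q≤M tτ e hZ = bounded {height (R ⊕ R)} (double-height R) (ℕₚ.≤-trans (height-unshift (R ⊕ R) {τ} tτ) hZ′)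
    where
    hZ′ : height ((R ⊕ R) ⊕ τ) ℕ.≤ M ℕ.* M
    hZ′ = subst (λ Z → height Z ℕ.≤ M ℕ.* M) (sym e) hZ
    bounded : ∀ {m} → (height R ℕ.* height R) ℕ.* (height R ℕ.* height R) ℕ.≤ q ℕ.* (2 ℕ.* m) → m ℕ.≤ M ℕ.* M → height R ℕ.≤ M
    bounded {m} d f = fourth-root-bound {height R} {m} {q} {M} d 2q≤M (bound>0 2q≤M) f

  -- Heights are bounded for the points themselves but independence is required of their doubles:
  -- replacing `P` by a half of it changes `2P` in a way that does not see the torsion ambiguity.
  State : ℕ → Set
  State M = ∃ λ P → ∃ λ Q → height P ℕ.≤ M × height Q ℕ.≤ M × Independent₂ (P ⊕ P) (Q ⊕ Q)

  pattern state P Q hP hQ independent = P , Q , hP , hQ , independent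

  first second : ∀ {M} → State M → J
  first (state P _ _ _ _) = P
  second (state _ Q _ _ _) = Q

  independent : ∀ {M} (s : State M) → Independent₂ (first s ⊕ first s) (second s ⊕ second s)
  independent (state _ _ _ _ ind) = ind

  Next : ∀ {M} → State M → Set
  Next {M} s = Σ (State M) λ s′ → Refines (first s ⊕ first s) (second s ⊕ second s) (first s′ ⊕ first s′) (second s′ ⊕ second s′)

  private
    interchange : ∀ A B C D → (A ⊕ B) ⊕ (C ⊕ D) ≡ (A ⊕ C) ⊕ (B ⊕ D)
    interchange = CS.interchange
      where import Algebra.Properties.CommutativeSemigroup (AbelianGroup.commutativeSemigroup abelianGroup) as CS

    ⊕-identityʳ : ∀ P → P ⊕ 𝟘 ≡ P
    ⊕-identityʳ P = trans (⊕-comm P 𝟘) (⊕-identityˡ P)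

    ⊖-⊕ : ∀ P Q → ⊖ P ⊕ ⊖ Q ≡ ⊖ (P ⊕ Q)
    ⊖-⊕ = AG.⁻¹-∙-comm
      where import Algebra.Properties.AbelianGroup abelianGroup as AG

    twice-shifted : ∀ P {τ} → Torsion τ → (P ⊕ τ) ⊕ (P ⊕ τ) ≡ P ⊕ P
    twice-shifted P {τ} tτ = trans (interchange P τ P τ) (trans (cong ((P ⊕ P) ⊕_) (torsion-double {τ} tτ)) (⊕-identityʳ (P ⊕ P)))

  refine-left : ∀ {M} (s : State M) → let P = first s ; Q = second s in ∀ R k → height R ℕ.≤ M →
    (P ⊕ P) ⊕ (k · (Q ⊕ Q)) ≡ (R ⊕ R) ⊕ (R ⊕ R) → Next s
  refine-left (state P Q hP hQ ind) R k hR e = state R Q hR hQ (refines-independent r ind) , r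
    where
    r : Refines (P ⊕ P) (Q ⊕ Q) (R ⊕ R) (Q ⊕ Q)
    r = left k e

  refine-right : ∀ {M} (s : State M) → let P = first s ; Q = second s in ∀ R → height R ℕ.≤ M →
    Q ⊕ Q ≡ (R ⊕ R) ⊕ (R ⊕ R) → Next s
  refine-right (state P Q hP hQ ind) R hR e = state P R hP hR (refines-independent r ind) , r
    where
    r : Refines (P ⊕ P) (Q ⊕ Q) (P ⊕ P) (R ⊕ R)
    r = right e

  -- Of P + Q and P - Q the one of smaller height is halved.
  refine-special : ∀ {M} → q ℕ.+ q ℕ.≤ M → (s : State M) → let P = first s ; Q = second s in
    ∀ {τ σ} → Torsion τ → Torsion σ → Special (P ⊕ τ) → Special (Q ⊕ σ) → Next s
  refine-special {M} 2q≤M s@(state P Q hP hQ ind) {τ} {σ} tτ tσ sP sQ = choose (factor-≤ bound)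
    where
    P₁ = P ⊕ τ
    Q₁ = Q ⊕ σ
    hP₁ : height P₁ ℕ.≤ M
    hP₁ = ℕₚ.≤-trans (height-shift P {τ} tτ) hP
    hQ₁ : height Q₁ ℕ.≤ M
    hQ₁ = ℕₚ.≤-trans (height-shift Q {σ} tσ) hQ
    bound : height (P₁ ⊕ Q₁) ℕ.* height (P₁ ⊕ ⊖ Q₁) ℕ.≤ (M ℕ.* M) ℕ.* (M ℕ.* M)
    bound = ℕₚ.≤-trans (parallelogram P₁ Q₁) (ℕₚ.*-mono-≤ (ℕₚ.*-mono-≤ hP₁ hP₁) (ℕₚ.*-mono-≤ hQ₁ hQ₁))
    twice : ∀ R {ρ} Z → Torsion ρ → (R ⊕ R) ⊕ ρ ≡ Z → Z ⊕ Z ≡ (R ⊕ R) ⊕ (R ⊕ R)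
    twice R {ρ} Z tρ e = trans (cong₂ _⊕_ (sym e) (sym e)) (twice-shifted (R ⊕ R) {ρ} tρ)
    plus : Double (P₁ ⊕ Q₁) → height (P₁ ⊕ Q₁) ℕ.≤ M ℕ.* M → Next s
    plus (R , ρ , tρ , e) h = refine-left s R (+ 1) (half-height R {ρ} 2q≤M tρ e h) (begin
      (P ⊕ P) ⊕ (+ 1 · (Q ⊕ Q))        ≡⟨ cong₂ _⊕_ (sym (twice-shifted P {τ} tτ)) (trans (·-one (Q ⊕ Q)) (sym (twice-shifted Q {σ} tσ))) ⟩
      (P₁ ⊕ P₁) ⊕ (Q₁ ⊕ Q₁)            ≡⟨ interchange P₁ P₁ Q₁ Q₁ ⟩
      (P₁ ⊕ Q₁) ⊕ (P₁ ⊕ Q₁)            ≡⟨ twice R {ρ} (P₁ ⊕ Q₁) tρ e ⟩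
      (R ⊕ R) ⊕ (R ⊕ R)                ∎)
    minus : Double (P₁ ⊕ ⊖ Q₁) → height (P₁ ⊕ ⊖ Q₁) ℕ.≤ M ℕ.* M → Next s
    minus (R , ρ , tρ , e) h = refine-left s R -[1+ 0 ] (half-height R {ρ} 2q≤M tρ e h) (begin
      (P ⊕ P) ⊕ (-[1+ 0 ] · (Q ⊕ Q))   ≡⟨ cong₂ _⊕_ (sym (twice-shifted P {τ} tτ)) (cong ⊖_ (trans (·-one (Q ⊕ Q)) (sym (twice-shifted Q {σ} tσ)))) ⟩
      (P₁ ⊕ P₁) ⊕ ⊖ (Q₁ ⊕ Q₁)          ≡⟨ cong ((P₁ ⊕ P₁) ⊕_) (sym (⊖-⊕ Q₁ Q₁)) ⟩
      (P₁ ⊕ P₁) ⊕ (⊖ Q₁ ⊕ ⊖ Q₁)        ≡⟨ interchange P₁ P₁ (⊖ Q₁) (⊖ Q₁) ⟩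
      (P₁ ⊕ ⊖ Q₁) ⊕ (P₁ ⊕ ⊖ Q₁)        ≡⟨ twice R {ρ} (P₁ ⊕ ⊖ Q₁) tρ e ⟩
      (R ⊕ R) ⊕ (R ⊕ R)                ∎)
    choose : height (P₁ ⊕ Q₁) ℕ.≤ M ℕ.* M ⊎ height (P₁ ⊕ ⊖ Q₁) ℕ.≤ M ℕ.* M → Next s
    choose (inj₁ h) = plus (special-sum P₁ Q₁ sP sQ) h
    choose (inj₂ h) = minus (special-sum P₁ (⊖ Q₁) sP sQ) h

  abstract
    next : ∀ {M} → q ℕ.+ q ℕ.≤ M → (s : State M) → Next s
    next {M} 2q≤M s@(state P Q hP hQ ind) = go (classify P) (classify Q)
      where
      M≤MM : M ℕ.≤ M ℕ.* M
      M≤MM = ℕₚ.m≤m*n M M {{ℕ.>-nonZero (bound>0 2q≤M)}}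
      go : Double P ⊎ (∃ λ τ → Torsion τ × Special (P ⊕ τ)) → Double Q ⊎ (∃ λ τ → Torsion τ × Special (Q ⊕ τ)) → Next s
      go (inj₁ (R , τ , tτ , e)) _ = refine-left s R (+ 0) (half-height R {τ} 2q≤M tτ e (ℕₚ.≤-trans hP M≤MM))
        (trans (⊕-identityʳ (P ⊕ P)) (trans (cong₂ _⊕_ (sym e) (sym e)) (twice-shifted (R ⊕ R) {τ} tτ)))
      go (inj₂ _) (inj₁ (R , τ , tτ , e)) = refine-right s R (half-height R {τ} 2q≤M tτ e (ℕₚ.≤-trans hQ M≤MM))
        (trans (cong₂ _⊕_ (sym e) (sym e)) (twice-shifted (R ⊕ R) {τ} tτ))
      go (inj₂ (τ , tτ , sP)) (inj₂ (σ , tσ , sQ)) = refine-special 2q≤M s {τ} {σ} tτ tσ sP sQ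

  private
    signᶠ : ℤ → Fin 2
    signᶠ (+ _) = Fin.zero
    signᶠ -[1+ _ ] = Fin.suc Fin.zero

    sign-abs-injective : ∀ i j → signᶠ i ≡ signᶠ j → ℤ.∣ i ∣ ≡ ℤ.∣ j ∣ → i ≡ j
    sign-abs-injective (+ m) (+ n) _ e = cong +_ e
    sign-abs-injective -[1+ m ] -[1+ n ] _ e = cong -[1+_] (ℕₚ.suc-injective e)

  codeℤ : ∀ {M} i → ℤ.∣ i ∣ ℕ.≤ M → Fin (2 ℕ.* suc M)
  codeℤ i h = Fin.combine (signᶠ i) (Fin.fromℕ< (ℕ.s≤s h))

  codeℤ-injective : ∀ {M} i j (hi : ℤ.∣ i ∣ ℕ.≤ M) (hj : ℤ.∣ j ∣ ℕ.≤ M) → codeℤ i hi ≡ codeℤ j hj → i ≡ j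
  codeℤ-injective {M} i j hi hj e =
    let (e₁ , e₂) = Finₚ.combine-injective (signᶠ i) (Fin.fromℕ< (ℕ.s≤s hi)) (signᶠ j) (Fin.fromℕ< (ℕ.s≤s hj)) e
    in sign-abs-injective i j e₁ (Finₚ.fromℕ<-injective ℤ.∣ i ∣ ℤ.∣ j ∣ (ℕ.s≤s hi) (ℕ.s≤s hj) e₂)

  codes : ℕ → ℕ
  codes M = let k = 2 ℕ.* suc M in (k ℕ.* k) ℕ.* (k ℕ.* k)

  private
    -- By `W² = T² + q U² = V² + 2 U²` a bound on `W` bounds all coordinates, which is why `|W|` can
    -- serve as the height.
    module Bounds {P : J} (r : Representative P) {M} (h : ℤ.∣ Representative.W r ∣ ℕ.≤ M) where
      open Representative r public
      open Concordant isConcordant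
      boundT : T ℕ.≤ M
      boundT = ℕₚ.≤-trans (norm-≤ {X = T} {U = ℤ.∣ U ∣} pq norm-q) h
      boundV : ℤ.∣ V ∣ ℕ.≤ M
      boundV = ℕₚ.≤-trans (norm-≤ {X = ℤ.∣ V ∣} {U = ℤ.∣ U ∣} prime[2] norm-2) h
      boundU : ℤ.∣ U ∣ ℕ.≤ M
      boundU = ℕₚ.≤-trans (square-≤-cancel (subst (ℤ.∣ U ∣ ℕ.* ℤ.∣ U ∣ ℕ.≤_) norm-q
        (ℕₚ.≤-trans (ℕₚ.m≤n*m (ℤ.∣ U ∣ ℕ.* ℤ.∣ U ∣) q {{ℕ.≢-nonZero (ℕₚ.m+1+n≢0 p)}}) (ℕₚ.m≤n+m _ (T ℕ.* T))))) h
      code : Fin (codes M)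
      code = Fin.combine (Fin.combine (codeℤ (+ T) boundT) (codeℤ U boundU)) (Fin.combine (codeℤ V boundV) (codeℤ W h))

    code-injective : ∀ {P Q M} (r : Representative P) (s : Representative Q) (hr : ℤ.∣ Representative.W r ∣ ℕ.≤ M) (hs : ℤ.∣ Representative.W s ∣ ℕ.≤ M) →
      Bounds.code r hr ≡ Bounds.code s hs → P ≡ Q
    code-injective {P} {Q} r s hr hs e =
      let (e₁ , e₂) = Finₚ.combine-injective (Fin.combine (codeℤ (+ r.T) r.boundT) (codeℤ r.U r.boundU)) (Fin.combine (codeℤ r.V r.boundV) (codeℤ r.W hr))
                                             (Fin.combine (codeℤ (+ s.T) s.boundT) (codeℤ s.U s.boundU)) (Fin.combine (codeℤ s.V s.boundV) (codeℤ s.W hs)) e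
          (eT , eU) = Finₚ.combine-injective (codeℤ (+ r.T) r.boundT) (codeℤ r.U r.boundU) (codeℤ (+ s.T) s.boundT) (codeℤ s.U s.boundU) e₁
          (eV , eW) = Finₚ.combine-injective (codeℤ r.V r.boundV) (codeℤ r.W hr) (codeℤ s.V s.boundV) (codeℤ s.W hs) e₂
      in same {+ r.T} {r.U} {r.V} {r.W} {+ s.T} {s.U} {s.V} {s.W} r.coords s.coords (codeℤ-injective (+ r.T) (+ s.T) r.boundT s.boundT eT) (codeℤ-injective (r.U) (s.U) r.boundU s.boundU eU)
           (codeℤ-injective (r.V) (s.V) r.boundV s.boundV eV) (codeℤ-injective (r.W) (s.W) hr hs eW)
      where
      module r = Bounds r hr
      module s = Bounds s hs
      same : ∀ {T U V W T′ U′ V′ W′} → Coordinates P (ι T) (ι U) (ι V) (ι W) → Coordinates Q (ι T′) (ι U′) (ι V′) (ι W′) →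
        T ≡ T′ → U ≡ U′ → V ≡ V′ → W ≡ W′ → P ≡ Q
      same cP cQ refl refl refl refl = coordinates-unique cP cQ refl refl refl

  state-code : ∀ {M} → State M → Fin (codes M ℕ.* codes M)
  state-code (state P Q hP hQ _) = Fin.combine (Bounds.code (representative P) hP) (Bounds.code (representative Q) hQ)

  state-code-injective : ∀ {M} (s s′ : State M) → state-code s ≡ state-code s′ → first s ≡ first s′ × second s ≡ second s′
  state-code-injective (state P Q hP hQ _) (state P′ Q′ hP′ hQ′ _) e =
    let (eP , eQ) = Finₚ.combine-injective (Bounds.code (representative P) hP) (Bounds.code (representative Q) hQ)
                                           (Bounds.code (representative P′) hP′) (Bounds.code (representative Q′) hQ′) e
    in code-injective (representative P) (representative P′) hP hP′ eP , code-injective (representative Q) (representative Q′) hQ hQ′ eQ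

  -- Halving forever inside a finite set of points returns to an earlier pair, although each step
  -- properly enlarges the spanned group.
  module _ {M} (2q≤M : q ℕ.+ q ℕ.≤ M) (s₀ : State M) where
    private
      s : ℕ → State M
      s zero = s₀
      s (suc n) = proj₁ (next 2q≤M (s n))
      x y : ℕ → J
      x n = first (s n) ⊕ first (s n)
      y n = second (s n) ⊕ second (s n)
      step : ∀ n → Refines (x n) (y n) (x (suc n)) (y (suc n))
      step n = proj₂ (next 2q≤M (s n))
      spans : ∀ n k → Span (x (k ℕ.+ n)) (y (k ℕ.+ n)) (x n) × Span (x (k ℕ.+ n)) (y (k ℕ.+ n)) (y n)
      spans n zero = span-left (x n) (y n) , span-right (x n) (y n)
      spans n (suc k) =
        let (a , b) = refines-span (step (k ℕ.+ n)) ; (c , d) = spans n k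
        in span-trans a b c , span-trans a b d

    no-state : ⊥
    no-state =
      let (i , j , i<j , e) = Finₚ.pigeonhole (ℕₚ.n<1+n (codes M ℕ.* codes M)) (λ i → state-code (s (Fin.toℕ i)))
          (eP , eQ) = state-code-injective (s (Fin.toℕ i)) (s (Fin.toℕ j)) e
      in returns (Fin.toℕ i) (Fin.toℕ j) i<j eP eQ
      where
      returns : ∀ i j → i ℕ.< j → first (s i) ≡ first (s j) → second (s i) ≡ second (s j) → ⊥
      returns i j i<j eP eQ = refines-proper (step i) (independent (s i)) (back (proj₁ sp)) (back (proj₂ sp))
        where
        -- The count starts at `suc i`: the pair reached by the step from `i` lies in the span at
        -- `j`, which is the span at `i`, against the properness of that step.
        k = j ℕ.∸ suc i
        k+1+i≡j : k ℕ.+ suc i ≡ j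
        k+1+i≡j = ℕₚ.m∸n+n≡m i<j
        sp : Span (x j) (y j) (x (suc i)) × Span (x j) (y j) (y (suc i))
        sp = subst (λ j → Span (x j) (y j) (x (suc i)) × Span (x j) (y j) (y (suc i))) k+1+i≡j (spans (suc i) k)
        back : ∀ {z} → Span (x j) (y j) z → Span (x i) (y i) z
        back {z} = subst₂ (λ P Q → Span (P ⊕ P) (Q ⊕ Q) z) (sym eP) (sym eQ)

  halve-zero : ∀ m → m ℤ.* + 2 ≡ + 0 → m ≡ + 0
  halve-zero m e with ℤₚ.i*j≡0⇒i≡0∨j≡0 m e
  ... | inj₁ m≡0 = m≡0

  no-independent-pair : ∀ P Q → ¬ Independent₂ P Q
  no-independent-pair P Q ind = no-state {M} 2q≤M (state P Q hP hQ doubled)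
    where
    -- The summand `2q` absorbs the constant of the doubling inequality, the rest makes the given
    -- pair a first state.
    M = q ℕ.+ q ℕ.+ (height P ℕ.+ height Q)
    2q≤M : q ℕ.+ q ℕ.≤ M
    2q≤M = ℕₚ.m≤m+n (q ℕ.+ q) _
    hP : height P ℕ.≤ M
    hP = ℕₚ.≤-trans (ℕₚ.m≤m+n (height P) (height Q)) (ℕₚ.m≤n+m _ (q ℕ.+ q))
    hQ : height Q ℕ.≤ M
    hQ = ℕₚ.≤-trans (ℕₚ.m≤n+m (height Q) (height P)) (ℕₚ.m≤n+m _ (q ℕ.+ q))
    doubled : Independent₂ (P ⊕ P) (Q ⊕ Q)
    doubled m n e =
      let (a , b) = ind (m ℤ.* + 2) (n ℤ.* + 2) (trans (cong₂ _⊕_ (twice m P) (twice n Q)) e)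
      in halve-zero m a , halve-zero n b
      where
      twice : ∀ m P → (m ℤ.* + 2) · P ≡ m · (P ⊕ P)
      twice m P = trans (·-* m (+ 2) P) (cong (m ·_) (·-two P))

-- Additivity of the map from the elliptic curve

module Addition (E : Curve) where
  open import Data.Rational using (_+_; _*_; -_; _-_)

  third-point : ℚ → ℚ → ℚ → ℚ → Point
  third-point l x₁ y₁ x₂ = aff x₃ (- (l * (x₃ - x₁) + y₁))
    where x₃ = l * l - A E - x₁ - x₂

  chord-slope : ℚ → ℚ → ℚ → ℚ → ℚ
  chord-slope x₁ y₁ x₂ y₂ = (y₂ - y₁) /' (x₂ - x₁)

  tangent-slope : ℚ → ℚ → ℚ
  tangent-slope x y = (three * x * x + two * A E * x + B E) /' (two * y)

  add-chord : ∀ x₁ y₁ x₂ y₂ → x₁ ≢ x₂ → add E (aff x₁ y₁) (aff x₂ y₂) ≡ third-point (chord-slope x₁ y₁ x₂ y₂) x₁ y₁ x₂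
  add-chord x₁ y₁ x₂ y₂ x₁≢x₂ with x₁ ℚₚ.≟ x₂
  ... | yes x₁≡x₂ = ⊥-elim (x₁≢x₂ x₁≡x₂)
  ... | no _ = refl

  add-opposite : ∀ x y₁ y₂ → y₁ + y₂ ≡ 0ℚ → add E (aff x y₁) (aff x y₂) ≡ O
  add-opposite x y₁ y₂ e with x ℚₚ.≟ x
  ... | no x≢x = ⊥-elim (x≢x refl)
  ... | yes _ with (y₁ + y₂) ℚₚ.≟ 0ℚ
  ... | yes _ = refl
  ... | no h = ⊥-elim (h e)

  add-tangent : ∀ x y₁ y₂ → y₁ + y₂ ≢ 0ℚ → add E (aff x y₁) (aff x y₂) ≡ third-point (tangent-slope x y₁) x y₁ x
  add-tangent x y₁ y₂ h with x ℚₚ.≟ x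
  ... | no x≢x = ⊥-elim (x≢x refl)
  ... | yes _ with (y₁ + y₂) ℚₚ.≟ 0ℚ
  ... | yes e = ⊥-elim (h e)
  ... | no _ = refl

module Embedding (p : ℕ) (pp : Prime p) (pq : Prime (p ℕ.+ 2)) (p3 : p % 8 ≡ 3) where
  open import Data.Rational using (_+_; _*_; -_; _-_)
  open RationalIntegers
  open ≡-Reasoning
  open FieldProperties ℚ-field
  open Solver ℚ-ring using (ring; combine)
  open Twin p pp pq p3
  open Heights p pp pq p3
  open Multiples (AbelianGroup.isAbelianGroup abelianGroup)

  E : Curve
  E = curvePQ p q

  open Addition E

  A≡ : A E ≡ pℚ + qℚ
  A≡ = trans (/1≡integral (+ (p ℕ.+ q))) (trans (sym (ι≡integral (+ (p ℕ.+ q)))) (ι-nat-+ p q))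

  B≡ : B E ≡ pℚ * qℚ
  B≡ = trans (/1≡integral (+ (p ℕ.* q))) (trans (sym (ι≡integral (+ (p ℕ.* q)))) (ι-nat-* p q))

  expanded : ∀ {a b} x → a ≡ pℚ + qℚ → b ≡ pℚ * qℚ → x * x * x + a * x * x + b * x + 0ℚ ≡ x * (x + pℚ) * (x + qℚ)
  expanded x refl refl = ring (x ∷ pℚ ∷ qℚ ∷ []) (λ { (x ∷ p ∷ q ∷ []) →
    x :* x :* x :+ (p :+ q) :* x :* x :+ p :* q :* x :+ lit (+ 0) := x :* (x :+ p) :* (x :+ q) }) refl

  onE : ∀ {x y} → OnCurve E (aff x y) → OnE x y
  onE {x} h = trans h (expanded x A≡ B≡)

  onE⁻¹ : ∀ {x y} → OnE x y → OnCurve E (aff x y)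
  onE⁻¹ {x} h = trans h (sym (expanded x A≡ B≡))

  -- X corresponds to P under an isomorphism for which u⁻² is the abscissa of 2P.
  Image : Point → J → Set
  Image O X = X ≡ 𝟘
  Image (aff x y) X = OnE x y × Coordinates X (Tᴱ x) (y + y) (Vᴱ x) (Wᴱ x)

  Tᴱ≢0 : ∀ x → Tᴱ x ≢ 0ℚ
  Tᴱ≢0 x e = 1≢0 (nonsquare (product-nonsquare pp pq p≢q) x 1ℚ (trans (Solver.x-y≡0⇒x≡y ℚ-ring {x * x} {pℚ * qℚ} e)
    (trans pqℚ (sym (ℚₚ.*-identityʳ (ι (+ (p ℕ.* q))))))))
    where open ≡-Field ℚ-field using (1≢0)

  image : ∀ x y → OnE x y → ∃ (Image (aff x y))
  image x y o = point {Tᴱ x} {y + y} {Vᴱ x} {Wᴱ x} (Tᴱ≢0 x) eᵛ eʷ , o , point-coordinates {Tᴱ x} {y + y} {Vᴱ x} {Wᴱ x} (Tᴱ≢0 x) eᵛ eʷ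
    where
    eᵛ : Vᴱ x * Vᴱ x ≡ Tᴱ x * Tᴱ x + pℚ * ((y + y) * (y + y))
    eᵛ = combine (x ∷ y ∷ pℚ ∷ qℚ ∷ []) (λ { (x ∷ y ∷ p ∷ q ∷ []) → let V = x :* x :+ (p :+ p) :* x :+ p :* q ; T = x :* x :- p :* q in
      (V :* V := T :* T :+ p :* ((y :+ y) :* (y :+ y))) , (:- lit (+ 4) :* p , (y :* y := x :* (x :+ p) :* (x :+ q))) ∷ [] }) o refl
    eʷ : Wᴱ x * Wᴱ x ≡ Tᴱ x * Tᴱ x + qℚ * ((y + y) * (y + y))
    eʷ = combine (x ∷ y ∷ pℚ ∷ qℚ ∷ []) (λ { (x ∷ y ∷ p ∷ q ∷ []) → let W = x :* x :+ (q :+ q) :* x :+ p :* q ; T = x :* x :- p :* q in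
      (W :* W := T :* T :+ q :* ((y :+ y) :* (y :+ y))) , (:- lit (+ 4) :* q , (y :* y := x :* (x :+ p) :* (x :+ q))) ∷ [] }) o refl

  image-exists : ∀ P → OnCurve E P → ∃ (Image P)
  image-exists O _ = 𝟘 , refl
  image-exists (aff x y) h = image x y (onE {x} {y} h)

  image-neg : ∀ P {X} → Image P X → Image (neg P) (⊖ X)
  image-neg O refl = J-≡ refl refl refl
  image-neg (aff x y) {X} (o , c) = trans (ring (y ∷ []) (λ { (y ∷ []) → :- y :* :- y := y :* y }) refl) o ,
    coordinates (Coordinates.T≢0 c)
      (trans (ring (u X ∷ Tᴱ x ∷ []) (λ { (u ∷ t ∷ []) → :- u :* t := :- (u :* t) }) refl)
        (trans (cong -_ (Coordinates.uT c)) (ring (y ∷ []) (λ { (y ∷ []) → :- (y :+ y) := :- y :+ :- y }) refl)))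
      (Coordinates.vT c) (Coordinates.wT c)

  private
    -- The third point is first shown to lie on the curve and given an image of its own;
    -- collinearity then identifies that image with `X ⊕ Y`.
    image-third : ∀ {x₁ y₁ x₂ y₂ l X Y} → Line x₁ x₂ (l * l - A E - x₁ - x₂) l (y₁ - l * x₁) → y₂ ≡ l * x₂ + (y₁ - l * x₁) →
      Coordinates X (Tᴱ x₁) (y₁ + y₁) (Vᴱ x₁) (Wᴱ x₁) → Coordinates Y (Tᴱ x₂) (y₂ + y₂) (Vᴱ x₂) (Wᴱ x₂) →
      Image (third-point l x₁ y₁ x₂) (X ⊕ Y)
    image-third {x₁} {y₁} {x₂} {y₂} {l} {X} {Y} L y₂≡ cX cY = o₃ ,
      subst (λ Z → Coordinates Z (Tᴱ x₃) (y₃ + y₃) (Vᴱ x₃) (Wᴱ x₃)) (collinear-sum {x₁} {y₁} {x₂} {y₂} {x₃} {y₃} {l} {y₁ - l * x₁} L y₁≡ y₂≡ y₃≡ cX cY (proj₂ (proj₂ Z))) (proj₂ (proj₂ Z))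
      where
      x₃ = l * l - A E - x₁ - x₂
      y₃ = - (l * (x₃ - x₁) + y₁)
      y₁≡ : y₁ ≡ l * x₁ + (y₁ - l * x₁)
      y₁≡ = ring (x₁ ∷ y₁ ∷ l ∷ []) (λ { (x ∷ y ∷ l ∷ []) → y := l :* x :+ (y :- l :* x) }) refl
      y₃≡ : y₃ ≡ - (l * x₃ + (y₁ - l * x₁))
      y₃≡ = ring (x₁ ∷ y₁ ∷ x₃ ∷ l ∷ []) (λ { (x ∷ y ∷ z ∷ l ∷ []) → :- (l :* (z :- x) :+ y) := :- (l :* z :+ (y :- l :* x)) }) refl
      o₃ : OnE x₃ y₃
      o₃ = line-third {x₁} {x₂} {x₃} {l} {y₁ - l * x₁} {y₃} L y₃≡
      Z : ∃ (Image (aff x₃ y₃))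
      Z = image x₃ y₃ o₃

    vieta : ∀ {a} l x₁ x₂ → a ≡ pℚ + qℚ → x₁ + x₂ + (l * l - a - x₁ - x₂) + pℚ + qℚ ≡ l * l
    vieta l x₁ x₂ refl = ring (l ∷ x₁ ∷ x₂ ∷ pℚ ∷ qℚ ∷ []) (λ { (l ∷ x ∷ y ∷ p ∷ q ∷ []) →
      x :+ y :+ (l :* l :- (p :+ q) :- x :- y) :+ p :+ q := l :* l }) refl

    image-chord : ∀ {x₁ y₁ x₂ y₂ X Y} → x₁ ≢ x₂ → Image (aff x₁ y₁) X → Image (aff x₂ y₂) Y →
      Image (third-point (chord-slope x₁ y₁ x₂ y₂) x₁ y₁ x₂) (X ⊕ Y)
    image-chord {x₁} {y₁} {x₂} {y₂} x₁≢x₂ (o₁ , cX) (o₂ , cY) = image-third {x₁} {y₁} {x₂} {y₂} {l}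
        (chord-line {x₁} {y₁} {x₂} {y₂} {l * l - A E - x₁ - x₂} {l} o₁ o₂ x₂-x₁≢0 slope (vieta l x₁ x₂ A≡))
        (combine (x₁ ∷ y₁ ∷ x₂ ∷ y₂ ∷ l ∷ []) (λ { (x₁ ∷ y₁ ∷ x₂ ∷ y₂ ∷ l ∷ []) → (y₂ := l :* x₂ :+ (y₁ :- l :* x₁)) ,
          (:- lit (+ 1) , ((x₂ :- x₁) :* l := y₂ :- y₁)) ∷ [] }) slope refl) cX cY
      where
      l = chord-slope x₁ y₁ x₂ y₂
      x₂-x₁≢0 : x₂ - x₁ ≢ 0ℚ
      x₂-x₁≢0 e = x₁≢x₂ (sym (Solver.x-y≡0⇒x≡y ℚ-ring {x₂} {x₁} e))
      slope : (x₂ - x₁) * l ≡ y₂ - y₁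
      slope = /'-inverse (y₂ - y₁) {x₂ - x₁} x₂-x₁≢0

    image-tangent : ∀ {x y X Y} → y ≢ 0ℚ → Image (aff x y) X → Image (aff x y) Y → Image (third-point (tangent-slope x y) x y x) (X ⊕ Y)
    image-tangent {x} {y} y≢0 (o , cX) (_ , cY) = image-third {x} {y} {x} {y} {l}
        (tangent-line {x} {y} {l * l - A E - x - x} {l} o slope (vieta l x x A≡))
        (ring (x ∷ y ∷ l ∷ []) (λ { (x ∷ y ∷ l ∷ []) → y := l :* x :+ (y :- l :* x) }) refl) cX cY
      where
      l = tangent-slope x y
      slope : two * y * l ≡ three * x * x + two * (pℚ + qℚ) * x + pℚ * qℚ
      slope = trans (/'-inverse (three * x * x + two * A E * x + B E) {two * y} (*-nonzero {two} {y} (λ ()) y≢0))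
        (cong₂ (λ a b → three * x * x + two * a * x + b) A≡ B≡)

    same-abscissa : ∀ {x y₁ y₂} → OnE x y₁ → OnE x y₂ → y₁ + y₂ ≢ 0ℚ → y₂ ≡ y₁
    same-abscissa {x} {y₁} {y₂} o₁ o₂ h = Solver.x-y≡0⇒x≡y ℚ-ring {y₂} {y₁} (go (*-zero-split (y₁ + y₂) (y₂ - y₁)
      (combine (y₁ ∷ y₂ ∷ x * (x + pℚ) * (x + qℚ) ∷ []) (λ { (y₁ ∷ y₂ ∷ f ∷ []) → ((y₁ :+ y₂) :* (y₂ :- y₁) := lit (+ 0)) ,
        (lit (+ 1) , (y₂ :* y₂ := f)) ∷ (:- lit (+ 1) , (y₁ :* y₁ := f)) ∷ [] }) (o₂ , o₁) refl)))
      where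
      go : y₁ + y₂ ≡ 0ℚ ⊎ y₂ - y₁ ≡ 0ℚ → y₂ - y₁ ≡ 0ℚ
      go (inj₁ e) = ⊥-elim (h e)
      go (inj₂ e) = e

    opposite-images : ∀ {x y₁ y₂ X Y} → y₁ + y₂ ≡ 0ℚ → Image (aff x y₁) X → Image (aff x y₂) Y → X ≡ ⊖ Y
    opposite-images {x} {y₁} {y₂} e (_ , cX) iY@(_ , cY) = coordinates-unique cX (proj₂ (image-neg (aff x y₂) iY))
      (cong (_* Tᴱ x) (combine (y₁ ∷ y₂ ∷ []) (λ { (y ∷ z ∷ []) → (y :+ y := :- z :+ :- z) , (lit (+ 2) , (y :+ z := lit (+ 0))) ∷ [] }) e refl)) refl refl

  image-add : ∀ P Q {X Y} → Image P X → Image Q Y → Image (add E P Q) (X ⊕ Y)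
  image-add O Q {Y = Y} refl i = subst (Image Q) (sym (⊕-identityˡ Y)) i
  image-add (aff x y) O {X} i refl = subst (Image (aff x y)) (sym (trans (⊕-comm X 𝟘) (⊕-identityˡ X))) i
  image-add (aff x₁ y₁) (aff x₂ y₂) {X} {Y} iX iY = go (x₁ ℚₚ.≟ x₂) ((y₁ + y₂) ℚₚ.≟ 0ℚ)
    where
    same : ∀ {x₂} → x₁ ≡ x₂ → Image (aff x₂ y₂) Y → Dec (y₁ + y₂ ≡ 0ℚ) → Image (add E (aff x₁ y₁) (aff x₂ y₂)) (X ⊕ Y)
    same refl iY (yes e) = subst (λ P → Image P (X ⊕ Y)) (sym (add-opposite x₁ y₁ y₂ e))
      (trans (cong (_⊕ Y) (opposite-images {x₁} {y₁} {y₂} e iX iY)) (⊕-inverseˡ Y))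
    same refl iY (no h) = subst (λ P → Image P (X ⊕ Y)) (sym (add-tangent x₁ y₁ y₂ h))
      (image-tangent {x₁} {y₁} (λ y₁≡0 → h (cong₂ _+_ y₁≡0 (trans y₂≡y₁ y₁≡0))) iX (subst (λ y → Image (aff x₁ y) Y) y₂≡y₁ iY))
      where
      y₂≡y₁ : y₂ ≡ y₁
      y₂≡y₁ = same-abscissa {x₁} {y₁} {y₂} (proj₁ iX) (proj₁ iY) h
    go : Dec (x₁ ≡ x₂) → Dec (y₁ + y₂ ≡ 0ℚ) → Image (add E (aff x₁ y₁) (aff x₂ y₂)) (X ⊕ Y)
    go (no h) _ = subst (λ P → Image P (X ⊕ Y)) (sym (add-chord x₁ y₁ x₂ y₂ h)) (image-chord {x₁} {y₁} {x₂} {y₂} h iX iY)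
    go (yes x₁≡x₂) d = same x₁≡x₂ iY d

  image-natMul : ∀ n P {X} → Image P X → Image (natMul E n P) (n ×ⁿ X)
  image-natMul zero P i = refl
  image-natMul (suc n) P i = image-add P (natMul E n P) i (image-natMul n P i)

  image-intMul : ∀ k P {X} → Image P X → Image (intMul E k P) (k · X)
  image-intMul (+ n) P i = image-natMul n P i
  image-intMul -[1+ n ] P i = image-neg (natMul E (suc n) P) (image-natMul (suc n) P i)

  -- v = 1 and w = 1 would give x = - q and x = - p.
  image-zero : ∀ P → Image P 𝟘 → P ≡ O
  image-zero O _ = refl
  image-zero (aff x y) (_ , c) = ⊥-elim (p≢q (ℤₚ.+-injective (ι-injective {+ p} {+ q} (begin
      pℚ             ≡⟨ ring (pℚ ∷ x ∷ []) (λ { (p ∷ x ∷ []) → p := x :+ p :- x }) refl ⟩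
      x + pℚ - x     ≡⟨ cong (_- x) (trans x+p≡0 (sym x+q≡0)) ⟩
      x + qℚ - x     ≡⟨ ring (qℚ ∷ x ∷ []) (λ { (p ∷ x ∷ []) → x :+ p :- x := p }) refl ⟩
      qℚ             ∎))))
    where
    x+q≡0 : x + qℚ ≡ 0ℚ
    x+q≡0 = *-cancelʳ (ι (+ 2) * pℚ) (*-nonzero {ι (+ 2)} {pℚ} (λ ()) pℚ≢0)
      (combine (x ∷ pℚ ∷ qℚ ∷ []) (λ { (x ∷ p ∷ q ∷ []) → ((x :+ q) :* (lit (+ 2) :* p) := lit (+ 0) :* (lit (+ 2) :* p)) ,
        (:- lit (+ 1) , (lit (+ 1) :* (x :* x :- p :* q) := x :* x :+ (p :+ p) :* x :+ p :* q)) ∷ [] }) (Coordinates.vT c) refl)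
    x+p≡0 : x + pℚ ≡ 0ℚ
    x+p≡0 = *-cancelʳ (ι (+ 2) * qℚ) (*-nonzero {ι (+ 2)} {qℚ} (λ ()) qℚ≢0)
      (combine (x ∷ pℚ ∷ qℚ ∷ []) (λ { (x ∷ p ∷ q ∷ []) → ((x :+ p) :* (lit (+ 2) :* q) := lit (+ 0) :* (lit (+ 2) :* q)) ,
        (:- lit (+ 1) , (lit (+ 1) :* (x :* x :- p :* q) := x :* x :+ (q :+ q) :* x :+ p :* q)) ∷ [] }) (Coordinates.wT c) refl)

  image-O : ∀ {P X} → P ≡ O → Image P X → X ≡ 𝟘
  image-O refl i = i

-- Points of infinite order

module LowerBound (p : ℕ) (pp : Prime p) (pq : Prime (p ℕ.+ 2)) (p3 : p % 8 ≡ 3) where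
  open import Data.Rational using (_+_; _*_; -_; _-_)
  open RationalIntegers
  open ≡-Reasoning
  open ≡-Field ℚ-field using (1≢0)
  open FieldProperties ℚ-field
  open Solver ℚ-ring using (ring; combine)
  open Twin p pp pq p3
  open Heights p pp pq p3
  open Multiples (AbelianGroup.isAbelianGroup abelianGroup)

  private
    -- From `0 = 1 + n y²` it would follow that `(n y)² = - n`.
    coordinate≢0 : ∀ n → n ≢ 0 → ∀ {x y} → x * x ≡ 1ℚ + ι (+ n) * (y * y) → x ≢ 0ℚ
    coordinate≢0 n n≢0 {x} {y} e refl = 1≢0 (nonsquare (negative-integer-nonsquare n n≢0) (ι (+ n) * y) 1ℚ (begin
      ι (+ n) * y * (ι (+ n) * y)
        ≡⟨ combine (ι (+ n) ∷ y ∷ []) (λ { (n ∷ y ∷ []) → (n :* y :* (n :* y) := :- n :* (lit (+ 1) :* lit (+ 1))) ,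
           (:- n , (lit (+ 0) :* lit (+ 0) := lit (+ 1) :+ n :* (y :* y))) ∷ [] }) e refl ⟩
      - ι (+ n) * (1ℚ * 1ℚ)
        ≡⟨ cong (_* (1ℚ * 1ℚ)) (sym (ι-neg (+ n))) ⟩
      ι (ℤ.- (+ n)) * (1ℚ * 1ℚ) ∎))

  v≢0 : ∀ P → v P ≢ 0ℚ
  v≢0 P = coordinate≢0 p p≢0 {v P} {u P} (v² P)

  w≢0 : ∀ P → w P ≢ 0ℚ
  w≢0 P = coordinate≢0 q (ℕₚ.m+1+n≢0 p) {w P} {u P} (w² P)

  -- u (2R) is a multiple of u R v R w R, so there are no points of order four.
  half-torsion : ∀ R → Torsion (R ⊕ R) → Torsion R
  half-torsion R t = go (*-zero-split (u R) (v R * w R) (*-cancelʳ (ι (+ 2)) (λ ()) (begin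
      u R * (v R * w R) * ι (+ 2)     ≡⟨ ring (u R ∷ v R ∷ w R ∷ []) (λ { (u ∷ v ∷ w ∷ []) → u :* (v :* w) :* lit (+ 2) := u :* (v :* w) :+ u :* (v :* w) }) refl ⟩
      Nᵘ R R                          ≡⟨ sym (u-⊕ R R) ⟩
      u (R ⊕ R) * D R R               ≡⟨ cong (_* D R R) t ⟩
      0ℚ * D R R                      ≡⟨ trans (ℚₚ.*-zeroˡ (D R R)) (sym (ℚₚ.*-zeroˡ (ι (+ 2)))) ⟩
      0ℚ * ι (+ 2)                    ∎)))
    where
    go : u R ≡ 0ℚ ⊎ v R * w R ≡ 0ℚ → u R ≡ 0ℚ
    go (inj₁ e) = e
    go (inj₂ e) = ⊥-elim (*-nonzero {v R} {w R} (v≢0 R) (w≢0 R) e)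

  -- δ takes the values 1, pq, -p, -q at the torsion points and squares at doubles, never minus a square.
  negative-not-double : ∀ X s → s ≢ 0ℚ → δ X ≡ - (s * s) → ¬ Double X
  negative-not-double X s s≢0 eδ (R , τ , tτ , e) = *-nonzero {s} {r} s≢0 r≢0 (vanishes (δ-torsion X {τ} tτ))
    where
    d = D R R
    c = v R * w R + v R * w R
    r = c ÷ d
    c≢0 : c ≢ 0ℚ
    c≢0 h = *-nonzero {ι (+ 2)} {v R * w R} (λ ()) (*-nonzero {v R} {w R} (v≢0 R) (w≢0 R))
      (trans (ring (v R * w R ∷ []) (λ { (x ∷ []) → lit (+ 2) :* x := x :+ x }) refl) h)
    rd : r * d ≡ c
    rd = ÷-* c (D≢0 R R)
    r≢0 : r ≢ 0ℚ
    r≢0 h = c≢0 (trans (sym rd) (trans (cong (_* d) h) (ℚₚ.*-zeroˡ d)))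
    δ-shifted : δ (X ⊕ τ) ≡ r * r
    δ-shifted = begin
      δ (X ⊕ τ)         ≡⟨ cong δ (trans (cong (_⊕ τ) (sym e)) (⊕-torsion-involutive (R ⊕ R) {τ} tτ)) ⟩
      δ (R ⊕ R)         ≡⟨ *-cancelʳ (d * d) (*-nonzero {d} {d} (D≢0 R R) (D≢0 R R)) (begin
        δ (R ⊕ R) * (d * d)   ≡⟨ δ-double R ⟩
        c * c                 ≡⟨ sym (cong₂ _*_ rd rd) ⟩
        r * d * (r * d)       ≡⟨ ring (r ∷ d ∷ []) (λ { (r ∷ d ∷ []) → r :* d :* (r :* d) := r :* r :* (d :* d) }) refl ⟩
        r * r * (d * d)       ∎) ⟩
      r * r             ∎
    y = s * r
    product : ∀ {k z} → δ X * δ (X ⊕ τ) ≡ k * (z * z) → - (y * y) ≡ k * (z * z)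
    product {k} {z} h = begin
      - (y * y)              ≡⟨ ring (s ∷ r ∷ []) (λ { (s ∷ r ∷ []) → :- (s :* r :* (s :* r)) := :- (s :* s) :* (r :* r) }) refl ⟩
      - (s * s) * (r * r)    ≡⟨ sym (cong₂ _*_ eδ δ-shifted) ⟩
      δ X * δ (X ⊕ τ)        ≡⟨ h ⟩
      k * (z * z)            ∎
    vanishes : (∃ λ k → ∃ λ z → Torsion-δ k × δ X * δ (X ⊕ τ) ≡ k * (z * z)) → y ≡ 0ℚ
    vanishes (_ , z , δ-1 , h) = nonsquare (negative-nonsquare {0}) z y
      (combine (y ∷ z ∷ []) (λ { (y ∷ z ∷ []) → (z :* z := lit -[1+ 0 ] :* (y :* y)) ,
        (:- lit (+ 1) , (:- (y :* y) := lit (+ 1) :* (z :* z))) ∷ [] }) (product {1ℚ} {z} h) refl)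
    vanishes (_ , z , δ-pq , h) = nonsquare (negative-integer-nonsquare (p ℕ.* q) pq≢0) (pℚ * qℚ * z) y (trans
      (combine (pℚ * qℚ ∷ y ∷ z ∷ []) (λ { (k ∷ y ∷ z ∷ []) → (k :* z :* (k :* z) := :- k :* (y :* y)) ,
        (:- k , (:- (y :* y) := k :* (z :* z))) ∷ [] }) (product {pℚ * qℚ} {z} h) refl) (cong (_* (y * y)) (sym -pqℚ)))
    vanishes (_ , z , δ--p , h) = nonsquare (prime-nonsquare pp) (pℚ * z) y
      (combine (pℚ ∷ y ∷ z ∷ []) (λ { (k ∷ y ∷ z ∷ []) → (k :* z :* (k :* z) := k :* (y :* y)) ,
        (k , (:- (y :* y) := :- k :* (z :* z))) ∷ [] }) (product { - pℚ} {z} h) refl)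
    vanishes (_ , z , δ--q , h) = nonsquare (prime-nonsquare pq) (qℚ * z) y
      (combine (qℚ ∷ y ∷ z ∷ []) (λ { (k ∷ y ∷ z ∷ []) → (k :* z :* (k :* z) := k :* (y :* y)) ,
        (k , (:- (y :* y) := :- k :* (z :* z))) ∷ [] }) (product { - qℚ} {z} h) refl)

  data Parity : ℕ → Set where
    even : ∀ k → Parity (k ℕ.+ k)
    odd : ∀ k → Parity (suc (k ℕ.+ k))

  parity : ∀ n → Parity n
  parity zero = even 0
  parity (suc n) with parity n
  ... | even k = odd k
  ... | odd k = subst Parity (cong suc (ℕₚ.+-suc k k)) (even (suc k))

  -- Here `Torsion` means order dividing two. Even `n` are halved, as there are no points of order
  -- four. For `n = 2k + 1` the identity `X = 2 (- k X) + n X` would make `X` a double up to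
  -- torsion.
  infinite-order : ∀ X → ¬ Double X → ∀ n → n ≢ 0 → ¬ Torsion (n ×ⁿ X)
  infinite-order X X∉2J n = go n (<-wellFounded n) (parity n)
    where
    multiple-+ : ∀ m n → (m ℕ.+ n) ×ⁿ X ≡ (m ×ⁿ X) ⊕ (n ×ⁿ X)
    multiple-+ m n = ·-+ (+ m) (+ n) X
    go : ∀ n → Acc ℕ._<_ n → Parity n → n ≢ 0 → ¬ Torsion (n ×ⁿ X)
    go _ _ (even zero) n≢0 _ = n≢0 refl
    go _ (acc rs) (even (suc k)) _ t = go (suc k) (rs (ℕₚ.m<m+n (suc k) (ℕ.s≤s ℕ.z≤n))) (parity (suc k)) (λ ())
      (half-torsion (suc k ×ⁿ X) (subst Torsion (multiple-+ (suc k) (suc k)) t))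
    go _ _ (odd k) _ t = X∉2J (⊖ (k ×ⁿ X) , X ⊕ ((k ℕ.+ k) ×ⁿ X) , t , (begin
      (⊖ Y ⊕ ⊖ Y) ⊕ (X ⊕ ((k ℕ.+ k) ×ⁿ X))     ≡⟨ cong₂ _⊕_ (AG.⁻¹-∙-comm Y Y) (trans (cong (X ⊕_) (multiple-+ k k)) (⊕-comm X (Y ⊕ Y))) ⟩
      ⊖ (Y ⊕ Y) ⊕ ((Y ⊕ Y) ⊕ X)                 ≡⟨ sym (⊕-assoc (⊖ (Y ⊕ Y)) (Y ⊕ Y) X) ⟩
      (⊖ (Y ⊕ Y) ⊕ (Y ⊕ Y)) ⊕ X                 ≡⟨ cong (_⊕ X) (⊕-inverseˡ (Y ⊕ Y)) ⟩
      𝟘 ⊕ X                                     ≡⟨ ⊕-identityˡ X ⟩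
      X                                         ∎))
      where
      Y = k ×ⁿ X
      import Algebra.Properties.AbelianGroup abelianGroup as AG

  multiple-zero : ∀ X → ¬ Double X → ∀ i → i · X ≡ 𝟘 → i ≡ + 0
  multiple-zero X h (+ zero) _ = refl
  multiple-zero X h (+ suc n) e = ⊥-elim (infinite-order X h (suc n) (λ ()) (cong u e))
  multiple-zero X h -[1+ n ] e = ⊥-elim (infinite-order X h (suc n) (λ ()) (begin
    u (suc n ×ⁿ X)          ≡⟨ ring (u (suc n ×ⁿ X) ∷ []) (λ { (x ∷ []) → x := :- :- x }) refl ⟩
    - - u (suc n ×ⁿ X)      ≡⟨ cong -_ (cong u e) ⟩
    - 0ℚ                    ≡⟨⟩
    0ℚ                      ∎))

-- The point built from the two circles

-- With α = (a , b), β = (ε , δ) of norms q and 2 and c = |α + β|, take m, n to be the components of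
-- α, β along α + β and r their common orthogonal component, so q = m² + r² and 2 = n² + r².
module Generator (p : ℕ) (pp : Prime p) (pq : Prime (p ℕ.+ 2)) (p3 : p % 8 ≡ 3)
  (a b c ε δ : ℤ) (ε² : ε ℤ.* ε ≡ + 1) (δ² : δ ℤ.* δ ≡ + 1)
  (norm-α : + (p ℕ.+ 2) ≡ a ℤ.* a ℤ.+ b ℤ.* b)
  (norm-α+β : (a ℤ.+ ε) ℤ.* (a ℤ.+ ε) ℤ.+ (b ℤ.+ δ) ℤ.* (b ℤ.+ δ) ≡ c ℤ.* c) where
  open import Data.Rational using (_+_; _*_; -_; _-_)
  open RationalIntegers
  open ≡-Reasoning
  open ≡-Field ℚ-field using (1≢0)
  open FieldProperties ℚ-field
  open Solver ℚ-ring using (ring; combine)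
  open Solver ℤ-ring using () renaming (combine to ℤcombine)
  open Twin p pp pq p3 hiding (δ)
  open Embedding p pp pq p3

  private
    sum-of-squares-zero : ∀ i j → i ℤ.* i ℤ.+ j ℤ.* j ≡ + 0 → i ≡ + 0
    sum-of-squares-zero i j e = ℤₚ.∣i∣≡0⇒i≡0 (square-zero ℤ.∣ i ∣ (ℕₚ.m+n≡0⇒m≡0 _ (ℤₚ.+-injective (begin
      + (ℤ.∣ i ∣ ℕ.* ℤ.∣ i ∣ ℕ.+ ℤ.∣ j ∣ ℕ.* ℤ.∣ j ∣)       ≡⟨ ℤₚ.pos-+ (ℤ.∣ i ∣ ℕ.* ℤ.∣ i ∣) _ ⟩
      + (ℤ.∣ i ∣ ℕ.* ℤ.∣ i ∣) ℤ.+ + (ℤ.∣ j ∣ ℕ.* ℤ.∣ j ∣)   ≡⟨ sym (cong₂ ℤ._+_ (square-abs i) (square-abs j)) ⟩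
      i ℤ.* i ℤ.+ j ℤ.* j                                  ≡⟨ e ⟩
      + 0                                                  ∎))))
      where
      square-zero : ∀ n → n ℕ.* n ≡ 0 → n ≡ 0
      square-zero zero _ = refl

    -- If `c` were zero, then `α = - β`, and comparing norms would give `q = 2`.
    c≢0 : c ≢ + 0
    c≢0 refl = ℕₚ.1+n≢0 (ℕₚ.+-cancelʳ-≡ 2 _ 0 (trans (cong (ℕ._+ 2) (sym suc-pred-p)) (ℤₚ.+-injective q≡2)))
      where
      instance _ = prime⇒nonZero pp
      suc-pred-p : p ≡ suc (ℕ.pred p)
      suc-pred-p = sym (ℕₚ.suc-pred p)
      a+ε≡0 : a ℤ.+ ε ≡ + 0
      a+ε≡0 = sum-of-squares-zero (a ℤ.+ ε) (b ℤ.+ δ) norm-α+β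
      b+δ≡0 : b ℤ.+ δ ≡ + 0
      b+δ≡0 = sum-of-squares-zero (b ℤ.+ δ) (a ℤ.+ ε) (trans (ℤₚ.+-comm _ ((a ℤ.+ ε) ℤ.* (a ℤ.+ ε))) norm-α+β)
      q≡2 : + (p ℕ.+ 2) ≡ + 2
      q≡2 = trans norm-α (ℤcombine (a ∷ b ∷ ε ∷ δ ∷ []) (λ { (a ∷ b ∷ ε ∷ δ ∷ []) → (a :* a :+ b :* b := lit (+ 2)) ,
        (a :- ε , (a :+ ε := lit (+ 0))) ∷ (b :- δ , (b :+ δ := lit (+ 0))) ∷
        (lit (+ 1) , (ε :* ε := lit (+ 1))) ∷ (lit (+ 1) , (δ :* δ := lit (+ 1))) ∷ [] }) (a+ε≡0 , b+δ≡0 , ε² , δ²) refl)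

    M N R : ℤ
    M = a ℤ.* (a ℤ.+ ε) ℤ.+ b ℤ.* (b ℤ.+ δ)
    N = ε ℤ.* (a ℤ.+ ε) ℤ.+ δ ℤ.* (b ℤ.+ δ)
    R = a ℤ.* δ ℤ.- b ℤ.* ε

    -- Lagrange's identity for `α` and `α + β`, whose scalar product is `M`; their determinant
    -- equals that of `α` and `β`, which is `R`.
    M²+R² : M ℤ.* M ℤ.+ R ℤ.* R ≡ + q ℤ.* (c ℤ.* c)
    M²+R² = ℤcombine (a ∷ b ∷ c ∷ ε ∷ δ ∷ + q ∷ []) (λ { (a ∷ b ∷ c ∷ ε ∷ δ ∷ q ∷ []) →
      let M = a :* (a :+ ε) :+ b :* (b :+ δ) ; R = a :* δ :- b :* ε in
      (M :* M :+ R :* R := q :* (c :* c)) ,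
      (:- ((a :+ ε) :* (a :+ ε) :+ (b :+ δ) :* (b :+ δ)) , (q := a :* a :+ b :* b)) ∷
      (q , ((a :+ ε) :* (a :+ ε) :+ (b :+ δ) :* (b :+ δ) := c :* c)) ∷ [] }) (norm-α , norm-α+β) refl

    N²+R² : N ℤ.* N ℤ.+ R ℤ.* R ≡ + 2 ℤ.* (c ℤ.* c)
    N²+R² = ℤcombine (a ∷ b ∷ c ∷ ε ∷ δ ∷ []) (λ { (a ∷ b ∷ c ∷ ε ∷ δ ∷ []) →
      let N = ε :* (a :+ ε) :+ δ :* (b :+ δ) ; R = a :* δ :- b :* ε ; s = (a :+ ε) :* (a :+ ε) :+ (b :+ δ) :* (b :+ δ) in
      (N :* N :+ R :* R := lit (+ 2) :* (c :* c)) ,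
      (s , (ε :* ε := lit (+ 1))) ∷ (s , (δ :* δ := lit (+ 1))) ∷ (lit (+ 2) , (s := c :* c)) ∷ [] }) (ε² , δ² , norm-α+β) refl

    c′ m n r : ℚ
    c′ = ι c
    m = ι M ÷ c′
    n = ι N ÷ c′
    r = ι R ÷ c′

    c′≢0 : c′ ≢ 0ℚ
    c′≢0 = ι≢0 {c} c≢0

    normalised : ∀ X k → X ℤ.* X ℤ.+ R ℤ.* R ≡ k ℤ.* (c ℤ.* c) → ι X ÷ c′ * (ι X ÷ c′) + r * r ≡ ι k
    normalised X k e = *-cancelʳ (c′ * c′) (*-nonzero {c′} {c′} c′≢0 c′≢0) (begin
      (x * x + r * r) * (c′ * c′)
        ≡⟨ ring (x ∷ r ∷ c′ ∷ []) (λ { (x ∷ r ∷ c ∷ []) → (x :* x :+ r :* r) :* (c :* c) := x :* c :* (x :* c) :+ r :* c :* (r :* c) }) refl ⟩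
      x * c′ * (x * c′) + r * c′ * (r * c′)
        ≡⟨ cong₂ (λ x r → x * x + r * r) (÷-* (ι X) c′≢0) (÷-* (ι R) c′≢0) ⟩
      ι X * ι X + ι R * ι R
        ≡⟨ trans (cong₂ _+_ (sym (ι-* X X)) (sym (ι-* R R))) (sym (ι-+ (X ℤ.* X) (R ℤ.* R))) ⟩
      ι (X ℤ.* X ℤ.+ R ℤ.* R)
        ≡⟨ cong ι e ⟩
      ι (k ℤ.* (c ℤ.* c))
        ≡⟨ trans (ι-* k (c ℤ.* c)) (cong (ι k *_) (ι-* c c)) ⟩
      ι k * (c′ * c′) ∎)
      where x = ι X ÷ c′

    m²+r² : m * m + r * r ≡ qℚ
    m²+r² = normalised M (+ q) M²+R²

    n²+r² : n * n + r * r ≡ ι (+ 2)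
    n²+r² = normalised N (+ 2) N²+R²

    qℚ≡ : qℚ ≡ pℚ + ι (+ 2)
    qℚ≡ = ι-nat-+ p 2

    n²+p : n * n + pℚ ≡ m * m
    n²+p = combine (m ∷ n ∷ r ∷ pℚ ∷ qℚ ∷ []) (λ { (m ∷ n ∷ r ∷ p ∷ q ∷ []) → (n :* n :+ p := m :* m) ,
      (lit (+ 1) , (n :* n :+ r :* r := lit (+ 2))) ∷ (:- lit (+ 1) , (m :* m :+ r :* r := q)) ∷ (:- lit (+ 1) , (q := p :+ lit (+ 2))) ∷ [] })
      (n²+r² , m²+r² , qℚ≡) refl

    square-of-prime : ∀ {k x} → Prime k → x * x ≢ ι (+ k)
    square-of-prime {k} {x} pk e = 1≢0 (nonsquare (prime-nonsquare pk) x 1ℚ (trans e (sym (ℚₚ.*-identityʳ (ι (+ k))))))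

    zero-square : ∀ {x y k} → x ≡ 0ℚ → y * y + x * x ≡ k → y * y ≡ k
    zero-square {y = y} refl e = trans (sym (ℚₚ.+-identityʳ (y * y))) e

    -- If one of `n`, `r`, `m` vanished, one of the primes `p`, 2, `q` would be a rational square.
    n≢0 : n ≢ 0ℚ
    n≢0 e = square-of-prime {p} {m} pp (sym (trans (sym (ℚₚ.+-identityˡ pℚ)) (trans (cong (λ n → n * n + pℚ) (sym e)) n²+p)))

    r≢0 : r ≢ 0ℚ
    r≢0 e = square-of-prime {2} {n} prime[2] (zero-square {r} {n} e n²+r²)

    m≢0 : m ≢ 0ℚ
    m≢0 e = square-of-prime {q} {r} pq (zero-square {m} {r} e (trans (ℚₚ.+-comm (r * r) (m * m)) m²+r²))

    -- The choice makes the factors squares up to sign: `x = - m²`, `x + p = - n²` and `x + q = r²`.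
    x y : ℚ
    x = - (m * m)
    y = m * n * r

    onCurve : OnE x y
    onCurve = combine (m ∷ n ∷ r ∷ pℚ ∷ qℚ ∷ []) (λ { (m ∷ n ∷ r ∷ p ∷ q ∷ []) →
      (m :* n :* r :* (m :* n :* r) := :- (m :* m) :* (:- (m :* m) :+ p) :* (:- (m :* m) :+ q)) ,
      (m :* m :* (:- (m :* m) :+ q) , (n :* n :+ p := m :* m)) ∷
      (m :* m :* (n :* n) , (m :* m :+ r :* r := q)) ∷ [] }) (n²+p , m²+r²) refl

  generator : Point
  generator = aff x y

  generator-on : OnCurve E generator
  generator-on = onE⁻¹ {x} {y} onCurve

  generator-not-double : ∀ {X} → Image generator X → ¬ Double X
  generator-not-double {X} (_ , C) = LowerBound.negative-not-double p pp pq p3 X s s≢0 δX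
    where
    t = Tᴱ x
    t≢0 : t ≢ 0ℚ
    t≢0 = Coordinates.T≢0 C
    z = m * y + m * y
    s = z ÷ t
    st : s * t ≡ z
    st = ÷-* z t≢0
    s≢0 : s ≢ 0ℚ
    s≢0 h = *-nonzero {ι (+ 2)} {m * y} (λ ()) (*-nonzero {m} {y} m≢0 (*-nonzero {m * n} {r} (*-nonzero {m} {n} m≢0 n≢0) r≢0)) (begin
      ι (+ 2) * (m * y)   ≡⟨ ring (m * y ∷ []) (λ { (x ∷ []) → lit (+ 2) :* x := x :+ x }) refl ⟩
      z                   ≡⟨ sym st ⟩
      s * t               ≡⟨ trans (cong (_* t) h) (ℚₚ.*-zeroˡ t) ⟩
      0ℚ                  ∎)
    δX : (1ℚ + v X) * (1ℚ + w X) ≡ - (s * s)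
    δX = *-cancelʳ (t * t) (*-nonzero {t} {t} t≢0 t≢0) (begin
      (1ℚ + v X) * (1ℚ + w X) * (t * t)
        ≡⟨ ring (v X ∷ w X ∷ t ∷ []) (λ { (v ∷ w ∷ t ∷ []) → (lit (+ 1) :+ v) :* (lit (+ 1) :+ w) :* (t :* t) := (t :+ v :* t) :* (t :+ w :* t) }) refl ⟩
      (t + v X * t) * (t + w X * t)
        ≡⟨ cong₂ (λ a b → (t + a) * (t + b)) (Coordinates.vT C) (Coordinates.wT C) ⟩
      (t + Vᴱ x) * (t + Wᴱ x)
        -- On the curve `(T + V) (T + W) = 4 x y²`, and `x = - m²` makes this minus a square.
        ≡⟨ combine (m ∷ y ∷ pℚ ∷ qℚ ∷ []) (λ { (m ∷ y ∷ p ∷ q ∷ []) → let x = :- (m :* m) ; t = x :* x :- p :* q in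
           ((t :+ (x :* x :+ (p :+ p) :* x :+ p :* q)) :* (t :+ (x :* x :+ (q :+ q) :* x :+ p :* q)) := :- ((m :* y :+ m :* y) :* (m :* y :+ m :* y))) ,
           (lit (+ 4) :* (m :* m) , (y :* y := x :* (x :+ p) :* (x :+ q))) ∷ [] }) onCurve refl ⟩
      - (z * z)
        ≡⟨ cong -_ (sym (cong₂ _*_ st st)) ⟩
      - (s * t * (s * t))
        ≡⟨ ring (s ∷ t ∷ []) (λ { (s ∷ t ∷ []) → :- (s :* t :* (s :* t)) := :- (s :* s) :* (t :* t) }) refl ⟩
      - (s * s) * (t * t) ∎)

-- Transfer to the rank of the elliptic curve

module Rank (p : ℕ) (pp : Prime p) (pq : Prime (p ℕ.+ 2)) (p3 : p % 8 ≡ 3) where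
  open Twin p pp pq p3
  open Embedding p pp pq p3
  open Multiples (AbelianGroup.isAbelianGroup abelianGroup)

  independent-point : ∀ P → (∀ {X} → Image P X → ¬ Double X) → OnCurve E P → Independent E (P ∷ [])
  independent-point P h on (i ∷ []) e Fin.zero = LowerBound.multiple-zero p pp pq p3 (proj₁ X) (h (proj₂ X)) i
    (trans (sym (trans (⊕-comm (i · proj₁ X) 𝟘) (⊕-identityˡ (i · proj₁ X))))
      (image-O e (image-add (intMul E i P) O (image-intMul i P (proj₂ X)) refl)))
    where
    X = image-exists P on

  dependent-pair : ∀ P Q → OnCurve E P → OnCurve E Q → ¬ Independent E (P ∷ Q ∷ [])
  dependent-pair P Q onP onQ ind = UpperBound.no-independent-pair p pp pq p3 (proj₁ X) (proj₁ Y) independent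
    where
    X = image-exists P onP
    Y = image-exists Q onQ
    independent : Independent₂ (proj₁ X) (proj₁ Y)
    independent m n e = zeros Fin.zero , zeros (Fin.suc Fin.zero)
      where
      combination : Image (linComb E (m ∷ n ∷ []) (P ∷ Q ∷ [])) ((m · proj₁ X) ⊕ ((n · proj₁ Y) ⊕ 𝟘))
      combination = image-add (intMul E m P) (add E (intMul E n Q) O) (image-intMul m P (proj₂ X))
        (image-add (intMul E n Q) O (image-intMul n Q (proj₂ Y)) refl)
      vanishes : (m · proj₁ X) ⊕ ((n · proj₁ Y) ⊕ 𝟘) ≡ 𝟘
      vanishes = trans (cong ((m · proj₁ X) ⊕_) (trans (⊕-comm (n · proj₁ Y) 𝟘) (⊕-identityˡ (n · proj₁ Y)))) e
      zeros : (i : Fin 2) → Vec.lookup (m ∷ n ∷ []) i ≡ + 0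
      zeros = ind (m ∷ n ∷ []) (image-zero _ (subst (Image (linComb E (m ∷ n ∷ []) (P ∷ Q ∷ []))) vanishes combination))

unit-square : ∀ {ε} → (ε ≡ + 1 ⊎ ε ≡ ℤ.- (+ 1)) → ε ℤ.* ε ≡ + 1
unit-square (inj₁ refl) = refl
unit-square (inj₂ refl) = refl

open import Data.Nat using (ℕ; _%_)
open import Data.Integer using (ℤ; +_; -_; _+_; _*_; 1ℤ)

theorem5 : (p q : ℕ) → Prime p → Prime q → q ≡ p Data.Nat.+ 2 → p % 8 ≡ 3
    → (a b c ε δ : ℤ) → (ε ≡ 1ℤ ⊎ ε ≡ - 1ℤ) → (δ ≡ 1ℤ ⊎ δ ≡ - 1ℤ)
    → + q ≡ a * a + b * b
    → (a + ε) * (a + ε) + (b + δ) * (b + δ) ≡ c * c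
    → HasRank (curvePQ p q) 1
theorem5 p _ pp pq refl p3 a b c ε δ ε≡ δ≡ norm-α norm-α+β =
  ((G.generator ∷ []) , (λ { Fin.zero → G.generator-on }) , independent-point G.generator (λ {X} → G.generator-not-double {X}) G.generator-on) ,
  λ { (P ∷ Q ∷ []) on → dependent-pair P Q (on Fin.zero) (on (Fin.suc Fin.zero)) }
  where
  open Rank p pp pq p3
  module G = Generator p pp pq p3 a b c ε δ (unit-square ε≡) (unit-square δ≡) norm-α norm-α+β
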